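{- Let $t \ge 3$ and $n \ge 1$ be integers, and let $I \subset [t]^n$ be an independent set of $K_t^n$ with $\epsilon := 1 - t\mu(I) < 1 - \frac{3}{t} + \frac{2}{t^2}$ (equivalently, $\mu(I) > \frac{3t-2}{t^3}$). Then there exists an independent set $J \subset [t]^n$ of $K_t^n$ of maximum size (so $\mu(J)=1/t$) such that \[ \mu(I \setminus J) \le 4\epsilon^{\eta(t)}, \qquad \text{where } \eta(t) = \frac{\log t}{\log t - \log(t-1)}. \]
   Context: $K_t^n$ is the graph with vertex set $[t]^n = \{1,\dots,t\}^n$ in which $x,y$ are adjacent iff $x_i \neq y_i$ for all $i \in [n]$. For $S \subseteq [t]^n$, $\mu(S) := |S|/t^n$. $\log$ is the natural logarithm. -}

module Defs where

open import Data.Nat as ℕ using (ℕ; zero; suc; _^_; NonZero)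
open import Data.Nat.Properties using (m^n≢0)
open import Data.Fin using (Fin)
open import Data.Vec using (Vec; []; _∷_; lookup)
open import Data.List using (List; []; _∷_; concatMap; map; filter; length)
open import Data.List using (allFin)
open import Data.Bool using (Bool; true; false; _∧_; not; T)
open import Data.Integer using (+_)
open import Data.Rational using (ℚ; _/_; _*_; _-_; 1ℚ)
open import Relation.Binary.PropositionalEquality using (_≡_; _≢_)
open import Relation.Nullary using (¬_)
open import Relation.Unary using (Decidable)
open import Data.Bool.Properties using (T?)

Vertex : ℕ → ℕ → Set
Vertex t n = Vec (Fin t) n

allVertices : (t n : ℕ) → List (Vertex t n)
allVertices t zero    = [] ∷ []
allVertices t (suc n) =
  concatMap (λ a → map (a ∷_) (allVertices t n)) (allFin t)

VSet : ℕ → ℕ → Set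
VSet t n = Vertex t n → Bool

card : ∀ {t n} → VSet t n → ℕ
card {t} {n} S = length (filter (λ x → T? (S x)) (allVertices t n))

_∖_ : ∀ {t n} → VSet t n → VSet t n → VSet t n
(S ∖ T′) x = S x ∧ not (T′ x)

Adjacent : ∀ {t n} → Vertex t n → Vertex t n → Set
Adjacent {n = n} x y = (i : Fin n) → lookup x i ≢ lookup y i

Independent : ∀ {t n} → VSet t n → Set
Independent S = ∀ x y → S x ≡ true → S y ≡ true → ¬ Adjacent x y

MaxIndependent : ∀ {t n} → VSet t n → Set
MaxIndependent {t} {n} J =
  Independent J × (∀ (K : VSet t n) → Independent K → card K ℕ.≤ card J)
  where open import Data.Product using (_×_)

μ : ∀ t n .{{_ : NonZero t}} → VSet t n → ℚ
μ t n S = (+ card S) / (t ^ n)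
  where instance _ = m^n≢0 t n

_^ℚ_ : ℚ → ℕ → ℚ
q ^ℚ zero  = 1ℚ
q ^ℚ suc k = q * (q ^ℚ k)

ε : ∀ t n .{{_ : NonZero t}} → VSet t n → ℚ
ε t n I = 1ℚ - ((+ t) / 1) * μ t n I

-- A rational a (≥ 0) and ε ∈ [0,1) satisfy  a ≤ 4 ε^{η(t)},
-- η(t) = log t / (log t - log (t-1)), expressed without reals:
-- for every rational exponent p/q < η(t) (i.e. t^p < t^q (t-1)^p, all in ℕ)
-- we have (a/4)^q ≤ ε^p.  Since 0 ≤ ε < 1, ε^x is continuous and
-- non-increasing in x ≥ 0, so this is equivalent to a/4 ≤ ε^η.
BoundedByFourEpsPowEta : (t : ℕ) → (a e : ℚ) → Set
BoundedByFourEpsPowEta t a e =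
  ∀ (p q : ℕ) → .{{_ : NonZero q}} →
    t ^ p ℕ.< t ^ q ℕ.* (t ℕ.∸ 1) ^ p →
    Data.Rational._≤_ ((a * (+ 1 / 4)) ^ℚ q) (e ^ℚ p)
  where import Data.Rational

{-# OPTIONS --safe #-}

-- Write p = 1/t, and let μ be the uniform measure.
--
-- If A and B are cross-independent (no vertex of A is adjacent to one of B), induction over slices gives
-- μ(A) ≤ (1 - μ(B))^s for every rational s with t - 1 ≤ s ≤ η(t), and also 1 - μ(B) ≥ ψ(μ(A)), where ψ is the
-- concave piecewise linear function through the points (pᵏ, (1-p)ᵏ).  Applied to the slices of I along a
-- coordinate, ψ shows that for μ(I) > 3p² - 2p³ the measure b of I outside a dictator (normalised by 1 - p) is
-- never in [p³, p²].  Suppose that b > p² for all dictators.  Compressing I, first within each coordinate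
-- towards the value 0 and then towards the first coordinate, keeps I independent and keeps b > p²: by ψ again,
-- no single compression can jump over the gap.  Once I is stable, its slices off the dictator x₀ = 0 consist of
-- vectors which pairwise agree at least twice, and Hoffman's bound gives b ≤ p², a contradiction.  So b < p³ for
-- some dictator J.  Then b is negligible against 1 - μ(slice of J), which is therefore close to ε, and the
-- power bound for cross-independent sets yields μ(I ∖ J) ≤ 4 ε^s.
module Submission where

open import Defs

-- The threshold is dictated by `ψ`. With `m = t - 1`, the slices of `I` give
-- `t μ(I) ≤ 1 - ψ(b) + m b`. On `[p³, p²]` the slope of `ψ` is exactly `m`, so the right-hand side
-- is constant there, namely `t (3p² - 2p³)`. The same constant comes out again when a coordinate
-- compression is kept from jumping over the gap. The two kinds of compression work on different
-- properties. Value compression leads to a set in which any two vectors vanish at a common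
-- coordinate; this property, stronger than independence, is what the exchange of coordinates is
-- shown to preserve. The factor 4 pays for replacing `1 - μ(slice)` by `ε`: their ratio is at most
-- `m² / (m² - 1)`, and its power with exponent `s ≤ η(t)` is at most 4. As `η(t)` is reached only
-- through rationals `p / q`, all bounds are cleared of roots and denominators and live in the
-- natural numbers.

-- The piecewise linear bound `ψ` and its behaviour under averaging slices.

module PiecewiseLinear where
  open import Data.Nat
  open import Data.Nat.Properties
  open import Data.Nat.Tactic.RingSolver using (solve-∀)
  open import Data.Product using (_×_; _,_; proj₁; proj₂)
  open import Data.Sum using (inj₁; inj₂)
  open import Relation.Binary.PropositionalEquality using (_≡_; refl; sym; trans; cong; subst; subst₂)

  ≤-cancel-common : ∀ {l r l′ r′} c → l + c ≡ l′ → r′ ≡ r + c → l′ ≤ r′ → l ≤ r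
  ≤-cancel-common {l} {r} c e₁ e₂ h = +-cancelʳ-≤ c l r (subst₂ _≤_ (sym e₁) e₂ h)

  *-cancelˡ-pos : ∀ k {a b} → 0 < k → k * a ≤ k * b → a ≤ b
  *-cancelˡ-pos k {a} {b} 0<k = *-cancelˡ-≤ {a} {b} k {{>-nonZero 0<k}}

  module PL (m₁ : ℕ) where
    m t : ℕ
    m = suc m₁
    t = suc m

    -- Here K = tᵏ and M = mᵏ, and x, v are measured in units of T.  Line says that v/T lies above the segment of ψ
    -- between the points (t⁻ᵏ⁻¹, (m/t)ᵏ⁺¹) and (t⁻ᵏ, (m/t)ᵏ), Chord that it lies above the chord from the origin to
    -- the latter point; both are stated only for x/T in the corresponding interval.
    Chord : (K M T x v : ℕ) → Set
    Chord K M T x v = K * x ≤ T → M * x ≤ v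

    Line : (K M T x v : ℕ) → Set
    Line K M T x v = T ≤ t * K * x → K * x ≤ T → M * m * T + M * (K * x) ≤ m * K * v + M * T

    PL : (T x v : ℕ) → Set
    PL T x v = ∀ k → Chord (t ^ k) (m ^ k) T x v × Line (t ^ k) (m ^ k) T x v

    -- The larger argument `a` has weight 1 in the argument of `ψ`, while its value has weight `m`.
    -- On a single linear piece the crossed weights are reconciled by this inequality and
    -- monotonicity.
    swap-≤ : ∀ {a b} → b ≤ a → a + m * b ≤ m * a + b
    swap-≤ {a} {b} b≤a = subst₂ _≤_ (e₁ m₁ a b) (e₂ m₁ a b) (+-monoʳ-≤ (a + b) (*-monoʳ-≤ m₁ b≤a))
      where
      e₁ : ∀ m₁ a b → (a + b) + m₁ * b ≡ a + suc m₁ * b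
      e₁ = solve-∀
      e₂ : ∀ m₁ a b → (a + b) + m₁ * a ≡ suc m₁ * a + b
      e₂ = solve-∀

    mean≤max : ∀ {a b} → b ≤ a → a + m * b ≤ t * a
    mean≤max {a} b≤a = +-monoʳ-≤ a (*-monoʳ-≤ m b≤a)

    chord-same : ∀ {M a b u v} → b ≤ a → M * a ≤ u → M * b ≤ v → M * (a + m * b) ≤ m * u + v
    chord-same {M} {a} {b} {u} {v} b≤a ha hb = begin
      M * (a + m * b)           ≤⟨ *-monoʳ-≤ M (swap-≤ b≤a) ⟩
      M * (m * a + b)           ≡⟨ e m M a b ⟩
      m * (M * a) + M * b       ≤⟨ +-mono-≤ (*-monoʳ-≤ m ha) hb ⟩
      m * u + v                 ∎
      where
      open ≤-Reasoning
      e : ∀ m M a b → M * (m * a + b) ≡ m * (M * a) + M * b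
      e = solve-∀

    -- The mean lies below a breakpoint and `a` above it: `a` is charged to its own segment, `b` to
    -- the chord ending at that breakpoint, and the deficit is `M * m₁` times the bound on the mean.
    chord-above : ∀ {K M T a b u v} → 0 < K → M * m * T + M * (K * a) ≤ m * K * u + M * T →
      m * M * b ≤ v → K * (a + m * b) ≤ T → m * M * (a + m * b) ≤ m * u + v
    chord-above {K} {M} {T} {a} {b} {u} {v} 0<K ha hb hX =
      *-cancelˡ-pos K 0<K (≤-cancel-common (M * m * T) (e₁ m₁ K M T a b) (e₂ m₁ K M T u v)
        (+-mono-≤ (+-mono-≤ ha (*-monoʳ-≤ K hb)) (*-monoʳ-≤ (M * m₁) hX)))
      where
      e₁ : ∀ m₁ K M T a b → K * (suc m₁ * M * (a + suc m₁ * b)) + M * suc m₁ * T ≡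
         M * suc m₁ * T + M * (K * a) + K * (suc m₁ * M * b) + M * m₁ * (K * (a + suc m₁ * b))
      e₁ = solve-∀
      e₂ : ∀ m₁ K M T u v → suc m₁ * K * u + M * T + K * v + M * m₁ * T ≡
         K * (suc m₁ * u + v) + M * suc m₁ * T
      e₂ = solve-∀

    line-same : ∀ {K M T a b u v} → b ≤ a → M * m * T + M * (K * a) ≤ m * K * u + M * T →
      M * m * T + M * (K * b) ≤ m * K * v + M * T →
      M * m * (t * T) + M * (K * (a + m * b)) ≤ m * K * (m * u + v) + M * (t * T)
    line-same {K} {M} {T} {a} {b} {u} {v} b≤a ha hb = begin
      M * m * (t * T) + M * (K * (a + m * b))
        ≤⟨ +-monoʳ-≤ (M * m * (t * T)) (*-monoʳ-≤ M (*-monoʳ-≤ K (swap-≤ b≤a))) ⟩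
      M * m * (t * T) + M * (K * (m * a + b)) ≡⟨ e₁ m K M T a b ⟩
      m * (M * m * T + M * (K * a)) + (M * m * T + M * (K * b)) ≤⟨ +-mono-≤ (*-monoʳ-≤ m ha) hb ⟩
      m * (m * K * u + M * T) + (m * K * v + M * T) ≡⟨ e₂ m K M T u v ⟩
      m * K * (m * u + v) + M * (t * T) ∎
      where
      open ≤-Reasoning
      e₁ : ∀ m K M T a b → M * m * (suc m * T) + M * (K * (m * a + b)) ≡
        m * (M * m * T + M * (K * a)) + (M * m * T + M * (K * b))
      e₁ = solve-∀
      e₂ : ∀ m K M T u v → m * (m * K * u + M * T) + (m * K * v + M * T) ≡ m * K * (m * u + v) + M * (suc m * T)
      e₂ = solve-∀

    -- The mean shares the segment of `a`, but `b` is below it; using the chord for `b` is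
    -- affordable because the mean is not below the lower end of the segment.
    line-below : ∀ {K M T a b u v} → M * m * T + M * (K * a) ≤ m * K * u + M * T →
      m * M * b ≤ v → T ≤ K * (a + m * b) →
      M * m * (t * T) + M * (K * (a + m * b)) ≤ m * K * (m * u + v) + M * (t * T)
    line-below {K} {M} {T} {a} {b} {u} {v} ha hb hX =
      ≤-cancel-common (M * m₁ * (K * (a + m * b))) (e₁ m₁ K M T a b) (e₂ m₁ K M T a b u v)
        (+-monoˡ-≤ (M * T) (+-mono-≤ (+-mono-≤ (*-monoʳ-≤ m ha) (*-monoʳ-≤ (m * K) hb)) (*-monoʳ-≤ (M * m₁) hX)))
      where
      e₁ : ∀ m₁ K M T a b →
        M * suc m₁ * (suc (suc m₁) * T) + M * (K * (a + suc m₁ * b)) + M * m₁ * (K * (a + suc m₁ * b)) ≡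
        suc m₁ * (M * suc m₁ * T + M * (K * a)) + suc m₁ * K * (suc m₁ * M * b) + M * m₁ * T + M * T
      e₁ = solve-∀
      e₂ : ∀ m₁ K M T a b u v →
        suc m₁ * (suc m₁ * K * u + M * T) + suc m₁ * K * v + M * m₁ * (K * (a + suc m₁ * b)) + M * T ≡
        suc m₁ * K * (suc m₁ * u + v) + M * (suc (suc m₁) * T) + M * m₁ * (K * (a + suc m₁ * b))
      e₂ = solve-∀

    line-above : ∀ {K M T a b u v} → M * m * T + M * (K * a) ≤ m * K * u + M * T → m * M * b ≤ v →
      m * M * m * (t * T) + m * M * (t * K * (a + m * b)) ≤ m * (t * K) * (m * u + v) + m * M * (t * T)
    line-above {K} {M} {T} {a} {b} {u} {v} ha hb = begin
      m * M * m * (t * T) + m * M * (t * K * (a + m * b))     ≡⟨ e₁ m K M T a b ⟩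
      m * t * ((M * m * T + M * (K * a)) + K * (m * M * b))   ≤⟨ *-monoʳ-≤ (m * t) (+-mono-≤ ha (*-monoʳ-≤ K hb)) ⟩
      m * t * ((m * K * u + M * T) + K * v)                   ≡⟨ e₂ m K M T u v ⟩
      m * (t * K) * (m * u + v) + m * M * (t * T)             ∎
      where
      open ≤-Reasoning
      e₁ : ∀ m K M T a b → m * M * m * (suc m * T) + m * M * (suc m * K * (a + m * b)) ≡
        m * suc m * ((M * m * T + M * (K * a)) + K * (m * M * b))
      e₁ = solve-∀
      e₂ : ∀ m K M T u v → m * suc m * ((m * K * u + M * T) + K * v) ≡
        m * (suc m * K) * (m * u + v) + m * M * (suc m * T)
      e₂ = solve-∀

    -- The mean `X / t` lies between `a / t` and `a`, and consecutive breakpoints differ by the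
    -- factor `t`. So `a` is in the segment of the mean or in the next higher one, and in the latter
    -- case `b` is below the breakpoint between them.
    module Step {T a b u v : ℕ} (b≤a : b ≤ a) (a≤T : a ≤ T) (pa : PL T a u) (pb : PL T b v) where
      X : ℕ
      X = a + m * b

      b-small : ∀ {K} → K * X ≤ t * T → T ≤ K * a → K * b ≤ T
      b-small {K} h h′ = *-cancelˡ-pos m z<s (≤-cancel-common (K * a) (e m K a b) refl (begin
        K * X ≤⟨ h ⟩ t * T ≡⟨ +-comm T (m * T) ⟩ m * T + T ≤⟨ +-monoʳ-≤ (m * T) h′ ⟩ m * T + K * a ∎))
        where
        open ≤-Reasoning
        e : ∀ m K a b → m * (K * b) + K * a ≡ K * (a + m * b)
        e = solve-∀

      a-small : ∀ {K} → t * K * X ≤ t * T → K * a ≤ T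
      a-small {K} h = ≤-trans (*-monoʳ-≤ K (m≤m+n a (m * b)))
        (*-cancelˡ-pos t z<s (subst (_≤ t * T) (*-assoc t K X) h))

      X-scale : ∀ {K} → t * K * X ≤ t * T → K * X ≤ T
      X-scale {K} h = *-cancelˡ-pos t z<s (subst (_≤ t * T) (*-assoc t K X) h)

      a-large : ∀ {K} → t * T ≤ t * K * X → T ≤ t * K * a
      a-large {K} h = *-cancelˡ-pos t z<s (begin
        t * T            ≤⟨ h ⟩
        t * K * X        ≤⟨ *-monoʳ-≤ (t * K) (mean≤max b≤a) ⟩
        t * K * (t * a)  ≡⟨ e t K a ⟩
        t * (t * K * a)  ∎)
        where
        open ≤-Reasoning
        e : ∀ t K a → t * K * (t * a) ≡ t * (t * K * a)
        e = solve-∀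

      line-in : ∀ k → t ^ k * a ≤ T → Line (t ^ k) (m ^ k) (t * T) X (m * u + v)
      line-in k ka≤T lo hi with ≤-total T (t * t ^ k * b)
      ... | inj₁ b-in = line-same {t ^ k} {m ^ k} {T} b≤a (proj₂ (pa k) (a-large {t ^ k} lo) ka≤T)
        (proj₂ (pb k) b-in (≤-trans (*-monoʳ-≤ (t ^ k) b≤a) ka≤T))
      ... | inj₂ b-below = line-below {t ^ k} {m ^ k} {T} (proj₂ (pa k) (a-large {t ^ k} lo) ka≤T)
        (proj₁ (pb (suc k)) b-below)
        (*-cancelˡ-pos t z<s (subst (t * T ≤_) (*-assoc t (t ^ k) X) lo))

      step : PL (t * T) X (m * u + v)
      step zero = (λ _ → chord-same {1} b≤a (proj₁ (pa 0) a≤T′) (proj₁ (pb 0) (≤-trans (*-monoʳ-≤ 1 b≤a) a≤T′)))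
                , line-in 0 a≤T′
        where
        a≤T′ : 1 * a ≤ T
        a≤T′ = subst (_≤ T) (sym (*-identityˡ a)) a≤T
      step (suc k) with ≤-total (t ^ suc k * a) T
      ... | inj₁ a-in = (λ _ → chord-same {m ^ suc k} b≤a (proj₁ (pa (suc k)) a-in)
                                 (proj₁ (pb (suc k)) (≤-trans (*-monoʳ-≤ (t ^ suc k) b≤a) a-in)))
                      , line-in (suc k) a-in
      ... | inj₂ a-above =
          (λ hi → chord-above {t ^ k} {m ^ k} {T} (m^n>0 t k) (proj₂ (pa k) a-above (a-small {t ^ k} hi))
                    (proj₁ (pb (suc k)) (b-small {t ^ suc k} hi a-above)) (X-scale {t ^ k} hi))
        , (λ lo hi → line-above {t ^ k} {m ^ k} {T} (proj₂ (pa k) a-above (a-small {t ^ k} hi))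
                    (proj₁ (pb (suc k)) (b-small {t ^ suc k} hi a-above)))

    PL-scale : ∀ c {T x v} → 0 < c → PL (c * T) (c * x) (c * v) → PL T x v
    PL-scale c {T} {x} {v} 0<c h k =
        (λ hi → *-cancelˡ-pos c 0<c (subst (_≤ c * v) (e₁ c M x) (proj₁ (h k) (hi′ hi))))
      , (λ lo hi → *-cancelˡ-pos c 0<c (subst₂ _≤_ (e₂ c M m T K x) (e₃ c M m T K v)
           (proj₂ (h k) (subst (c * T ≤_) (sym (e₁ c (t * K) x)) (*-monoʳ-≤ c lo)) (hi′ hi))))
      where
      K M : ℕ
      K = t ^ k
      M = m ^ k
      e₁ : ∀ c M x → M * (c * x) ≡ c * (M * x)
      e₁ = solve-∀
      e₂ : ∀ c M m T K x → M * m * (c * T) + M * (K * (c * x)) ≡ c * (M * m * T + M * (K * x))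
      e₂ = solve-∀
      e₃ : ∀ c M m T K v → m * K * (c * v) + M * (c * T) ≡ c * (m * K * v + M * T)
      e₃ = solve-∀
      hi′ : K * x ≤ T → K * (c * x) ≤ c * T
      hi′ hi = subst (_≤ c * T) (sym (e₁ c K x)) (*-monoʳ-≤ c hi)

    -- Quantifying over all fractions x/d ≤ g makes the bound usable for averages of slices.
    PLCount : (n g v : ℕ) → Set
    PLCount n g v = g ≤ t ^ n × (∀ d x → x ≤ d * g → PL (d * t ^ n) x (d * v))

    PLCount-mono : ∀ {n g g′ v v′} → g′ ≤ g → v ≤ v′ → PLCount n g v → PLCount n g′ v′
    PLCount-mono {n} {g} {g′} {v} {v′} g′≤g v≤v′ (g≤ , h) =
      ≤-trans g′≤g g≤ , λ d x x≤ k →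
        let (c , l) = h d x (≤-trans x≤ (*-monoʳ-≤ d g′≤g)) k in
        (λ hi → ≤-trans (c hi) (*-monoʳ-≤ d v≤v′)) ,
        (λ lo hi → ≤-trans (l lo hi)
           (+-monoˡ-≤ (m ^ k * (d * t ^ n)) (*-monoʳ-≤ (m * t ^ k) (*-monoʳ-≤ d v≤v′))))

    -- The fraction `x / d` is distributed by filling the largest slice first and spreading the
    -- remainder evenly over the `m` others. The even spreading multiplies denominators by `m`,
    -- which `PL-scale` removes.
    PLCount-step : ∀ {n g g′ v v′} → g′ ≤ g → v′ ≤ v → PLCount n g v → PLCount n g′ v′ →
      PLCount (suc n) (g + m * g′) (m * v + v′)
    PLCount-step {n} {g} {g′} {v} {v′} g′≤g _ (g≤ , h) (g′≤ , h′) =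
      +-mono-≤ g≤ (*-monoʳ-≤ m g′≤) , λ d x x≤ → PL-scale m z<s (main d x x≤)
      where
      assemble : ∀ d x a b → m * x ≡ a + m * b → b ≤ a → a ≤ d * m * g → b ≤ d * m * g′ →
        PL (m * (d * t ^ suc n)) (m * x) (m * (d * (m * v + v′)))
      assemble d x a b eq b≤a ha hb k rewrite eq =
        subst₂ (λ T V → Chord (t ^ k) (m ^ k) T (a + m * b) V × Line (t ^ k) (m ^ k) T (a + m * b) V)
          (e₁ m d t (t ^ n)) (e₂ m d v v′)
          (Step.step b≤a (≤-trans ha (*-monoʳ-≤ (d * m) g≤)) (h (d * m) a ha) (h′ (d * m) b hb) k)
        where
        e₁ : ∀ m d t N → t * (d * m * N) ≡ m * (d * (t * N))
        e₁ = solve-∀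
        e₂ : ∀ m d v v′ → m * (d * m * v) + d * m * v′ ≡ m * (d * (m * v + v′))
        e₂ = solve-∀
      main : ∀ d x → x ≤ d * (g + m * g′) → PL (m * (d * t ^ suc n)) (m * x) (m * (d * (m * v + v′)))
      main d x x≤ with ≤-total (m * x) (d * m * g)
      ... | inj₁ le = assemble d x (m * x) 0 (e m (m * x)) z≤n le z≤n
        where
        e : ∀ m a → a ≡ a + m * 0
        e = solve-∀
      ... | inj₂ ge = assemble d x (d * m * g) (x ∸ d * g) eq
          (≤-trans b≤ (*-monoʳ-≤ (d * m) g′≤g)) ≤-refl b≤
        where
        dg≤x : d * g ≤ x
        dg≤x = *-cancelˡ-pos m z<s (subst (_≤ m * x) (e d m g) ge)
          where
          e : ∀ d m g → d * m * g ≡ m * (d * g)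
          e = solve-∀
        eq : m * x ≡ d * m * g + m * (x ∸ d * g)
        eq = trans (cong (m *_) (sym (m+[n∸m]≡n dg≤x))) (e d m g (x ∸ d * g))
          where
          e : ∀ d m g b → m * (d * g + b) ≡ d * m * g + m * b
          e = solve-∀
        b≤ : x ∸ d * g ≤ d * m * g′
        b≤ = subst (x ∸ d * g ≤_) (trans (cong (_∸ d * g) (e d m g g′)) (m+n∸m≡n (d * g) (d * m * g′)))
               (∸-monoˡ-≤ (d * g) x≤)
          where
          e : ∀ d m g g′ → d * (g + m * g′) ≡ d * g + d * m * g′
          e = solve-∀

    PLCount-base₀ : PLCount 0 0 0
    PLCount-base₀ = z≤n , λ d x x≤ → subst (λ y → PL (d * 1) y (d * 0))
        (sym (n≤0⇒n≡0 (subst (x ≤_) (*-zeroʳ d) x≤))) (zero-PL (d * 1) (d * 0))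
      where
      zero-PL : ∀ T v → PL T 0 v
      zero-PL T v k =
          (λ _ → subst (_≤ v) (sym (*-zeroʳ (m ^ k))) z≤n)
        , (λ lo _ → subst (λ T → m ^ k * m * T + m ^ k * (t ^ k * 0) ≤ m * t ^ k * v + m ^ k * T)
            (sym (n≤0⇒n≡0 (subst (T ≤_) (*-zeroʳ (t * t ^ k)) lo)))
            (subst (_≤ m * t ^ k * v + m ^ k * 0) (e (m ^ k) m (t ^ k)) z≤n))
        where
        e : ∀ M m K → 0 ≡ M * m * 0 + M * (K * 0)
        e = solve-∀

    PLCount-base₁ : PLCount 0 1 1
    PLCount-base₁ = ≤-refl , λ d x _ k →
        (λ hi → ≤-trans (*-monoˡ-≤ x (m^k≤t^k k)) hi)
      , (λ _ hi → +-mono-≤ (*-monoˡ-≤ (d * 1) (subst (_≤ m * t ^ k) (*-comm m (m ^ k)) (*-monoʳ-≤ m (m^k≤t^k k))))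
                    (*-monoʳ-≤ (m ^ k) hi))
      where
      m^k≤t^k : ∀ k → m ^ k ≤ t ^ k
      m^k≤t^k k = ^-monoˡ-≤ k (n≤1+n m)

-- Tangent inequalities and the power bound, without real exponents.

module PowerMeans where
  open import Data.Nat
  open import Data.Nat.Properties
  open import Data.Nat.Tactic.RingSolver using (solve-∀)
  open import Data.Sum using (inj₁; inj₂)
  open import Relation.Binary.PropositionalEquality using (_≡_; refl; sym; trans; cong; cong₂; subst; subst₂)
  open PiecewiseLinear using (≤-cancel-common; *-cancelˡ-pos)

  ^-distribʳ-* : ∀ k a b → (a * b) ^ k ≡ a ^ k * b ^ k
  ^-distribʳ-* zero a b = refl
  ^-distribʳ-* (suc k) a b = trans (cong (a * b *_) (^-distribʳ-* k a b)) (e a b (a ^ k) (b ^ k))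
    where
    e : ∀ a b c d → a * b * (c * d) ≡ a * c * (b * d)
    e = solve-∀

  two-squares : ∀ x y → 2 * (x * y) ≤ x * x + y * y
  two-squares x y with ≤-total x y
  ... | inj₁ x≤y = subst (λ y → 2 * (x * y) ≤ x * x + y * y) (m+[n∸m]≡n x≤y)
    (≤-cancel-common 0 (+-identityʳ _) (e x (y ∸ x)) (m≤m+n _ _))
    where
    e : ∀ x d → 2 * (x * (x + d)) + d * d ≡ x * x + (x + d) * (x + d) + 0
    e = solve-∀
  ... | inj₂ y≤x = subst (λ x → 2 * (x * y) ≤ x * x + y * y) (m+[n∸m]≡n y≤x)
    (≤-cancel-common 0 (+-identityʳ _) (e y (x ∸ y)) (m≤m+n _ _))
    where
    e : ∀ y d → 2 * ((y + d) * y) + d * d ≡ (y + d) * (y + d) + y * y + 0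
    e = solve-∀

  young : ∀ n x y → suc n * (x ^ n * y) ≤ y ^ suc n + n * x ^ suc n
  young zero x y = ≤-reflexive (e y)
    where
    e : ∀ y → 1 * (1 * y) ≡ y * 1 + 0
    e = solve-∀
  young (suc n) x y = ≤-cancel-common (suc n * (X * (y * y)) + n * (x * X * y)) (e₁ n x X y) (e₂ n x X y (y ^ n))
    (+-mono-≤ (*-monoʳ-≤ y (young n x y)) (*-monoʳ-≤ (suc n * X) (two-squares x y)))
    where
    X = x ^ n
    e₁ : ∀ n x X y → suc (suc n) * (x * X * y) + (suc n * (X * (y * y)) + n * (x * X * y)) ≡
      y * (suc n * (X * y)) + suc n * X * (2 * (x * y))
    e₁ = solve-∀
    e₂ : ∀ n x X y Y → y * (y * Y + n * (x * X)) + suc n * X * (x * x + y * y) ≡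
      y * (y * Y) + suc n * (x * (x * X)) + (suc n * (X * (y * y)) + n * (x * X * y))
    e₂ = solve-∀

  -- Inductive step of the inequality of arithmetic and geometric means, a term `c` joining `n`
  -- terms of sum `S`: for positive `n` it is `young` at `(n + 1) S` and `n (S + c)`.
  amgm-add : ∀ n S c → suc n ^ suc n * (c * S ^ n) ≤ n ^ n * (S + c) ^ suc n
  amgm-add zero S c = subst₂ _≤_ (e₁ c) (e₂ S c) (m≤n+m c S)
    where
    e₁ : ∀ c → c ≡ 1 * 1 * (c * 1)
    e₁ = solve-∀
    e₂ : ∀ S c → S + c ≡ 1 * ((S + c) * 1)
    e₂ = solve-∀
  amgm-add n@(suc k) S c = *-cancelˡ-pos n z<s (≤-cancel-common (n * X ^ suc n) E₁ E₂ (young n X Y))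
    where
    X Y : ℕ
    X = suc n * S
    Y = n * (S + c)
    E₁ : n * (suc n ^ suc n * (c * S ^ n)) + n * X ^ suc n ≡ suc n * (X ^ n * Y)
    E₁ = trans (cong (λ z → n * (suc n ^ suc n * (c * S ^ n)) + n * (X * z)) (^-distribʳ-* n (suc n) S))
      (trans (e n (suc n ^ n) c (S ^ n) S) (cong (λ z → suc n * (z * Y)) (sym (^-distribʳ-* n (suc n) S))))
      where
      e : ∀ n N c Sn S → n * (suc n * N * (c * Sn)) + n * (suc n * S * (N * Sn)) ≡
        suc n * (N * Sn * (n * (S + c)))
      e = solve-∀
    E₂ : Y ^ suc n + n * X ^ suc n ≡ n * (n ^ n * (S + c) ^ suc n) + n * X ^ suc n
    E₂ = cong (_+ n * X ^ suc n) (trans (^-distribʳ-* (suc n) n (S + c)) (*-assoc n (n ^ n) _))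

  n^n>0 : ∀ n → 0 < n ^ n
  n^n>0 zero = z<s
  n^n>0 (suc n) = m^n>0 (suc n) (suc n)

  amgm : ∀ q r a c → (q + r) ^ (q + r) * (a ^ r * c ^ q) ≤ (r * a + q * c) ^ (q + r)
  amgm zero r a c = ≤-reflexive (trans (cong (r ^ r *_) (*-identityʳ (a ^ r)))
    (trans (sym (^-distribʳ-* r r a)) (cong (_^ r) (sym (+-identityʳ (r * a))))))
  amgm (suc q) r a c = *-cancelˡ-pos (n ^ n) (n^n>0 n) (begin
    n ^ n * (suc n ^ suc n * (a ^ r * (c * c ^ q)))   ≡⟨ e (n ^ n) (suc n ^ suc n) (a ^ r) c (c ^ q) ⟩
    suc n ^ suc n * (c * (n ^ n * (a ^ r * c ^ q)))   ≤⟨ *-monoʳ-≤ (suc n ^ suc n) (*-monoʳ-≤ c (amgm q r a c)) ⟩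
    suc n ^ suc n * (c * S ^ n)                       ≤⟨ amgm-add n S c ⟩
    n ^ n * (S + c) ^ suc n                           ≡⟨ cong (λ z → n ^ n * z ^ suc n) (e′ r a q c) ⟩
    n ^ n * (r * a + suc q * c) ^ suc n               ∎)
    where
    open ≤-Reasoning
    n S : ℕ
    n = q + r
    S = r * a + q * c
    e : ∀ N M A c C → N * (M * (A * (c * C))) ≡ M * (c * (N * (A * C)))
    e = solve-∀
    e′ : ∀ r a q c → r * a + q * c + c ≡ r * a + suc q * c
    e′ = solve-∀

  -- The tangent to `w ↦ w^{p/q}` at `a`, where `p = q + r`: the equation makes `a^{r/q} (c / q)`
  -- its value at `w`. It is `amgm` for `r` copies of `q * a` and `q` copies of `c`.
  bernoulli : ∀ q r {a c w} → 0 < q → r * a + c ≡ (q + r) * w → a ^ r * c ^ q ≤ q ^ q * w ^ (q + r)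
  bernoulli q r {a} {c} {w} 0<q eq =
    *-cancelˡ-pos (q ^ r) (m^n>0 q {{>-nonZero 0<q}} r) (*-cancelˡ-pos (p ^ p) (n^n>0 p) (begin
      p ^ p * (q ^ r * (a ^ r * c ^ q))      ≡⟨ cong (p ^ p *_) (sym (*-assoc (q ^ r) (a ^ r) (c ^ q))) ⟩
      p ^ p * (q ^ r * a ^ r * c ^ q)        ≡⟨ cong (λ z → p ^ p * (z * c ^ q)) (sym (^-distribʳ-* r q a)) ⟩
      p ^ p * ((q * a) ^ r * c ^ q)          ≤⟨ amgm q r (q * a) c ⟩
      (r * (q * a) + q * c) ^ p              ≡⟨ cong (_^ p) (trans (e r q a c) (trans (cong (q *_) eq) (e′ q p w))) ⟩
      (p * (q * w)) ^ p                      ≡⟨ ^-distribʳ-* p p (q * w) ⟩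
      p ^ p * (q * w) ^ p                    ≡⟨ cong (p ^ p *_) (^-distribʳ-* p q w) ⟩
      p ^ p * (q ^ (q + r) * w ^ p)          ≡⟨ cong (λ z → p ^ p * (z * w ^ p)) (^-distribˡ-+-* q q r) ⟩
      p ^ p * (q ^ q * q ^ r * w ^ p)        ≡⟨ cong (p ^ p *_) (e″ (q ^ q) (q ^ r) (w ^ p)) ⟩
      p ^ p * (q ^ r * (q ^ q * w ^ p))      ∎))
    where
    open ≤-Reasoning
    p : ℕ
    p = q + r
    e : ∀ r q a c → r * (q * a) + q * c ≡ q * (r * a + c)
    e = solve-∀
    e′ : ∀ q p w → q * (p * w) ≡ p * (q * w)
    e′ = solve-∀
    e″ : ∀ a b c → a * b * c ≡ b * (a * c)
    e″ = solve-∀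

  -- The mediant `(a + b) / (c + d)` does not exceed the larger ratio `b / d`, so the comparison of
  -- `b` with `d` decides.
  root-mediant : ∀ q {G H} a b c d → 0 < q → a ^ q * G ≤ c ^ q * H → b ^ q * G ≤ d ^ q * H →
    a * d ≤ b * c → (a + b) ^ q * G ≤ (c + d) ^ q * H
  root-mediant q {G} {H} a zero c zero 0<q ha hb h =
    subst₂ (λ y z → y ^ q * G ≤ z ^ q * H) (sym (+-identityʳ a)) (sym (+-identityʳ c)) ha
  root-mediant q@(suc _) {G} {H} a b@(suc _) c zero 0<q ha hb h with m*n≡0⇒m≡0∨n≡0 (b ^ q) (n≤0⇒n≡0 hb)
  ... | inj₁ b^q≡0 with () ← m^n≡0⇒m≡0 b q b^q≡0
  ... | inj₂ refl = subst (_≤ (c + 0) ^ q * H) (sym (*-zeroʳ ((a + b) ^ q))) z≤n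
  root-mediant q {G} {H} a b c d@(suc _) 0<q ha hb h = *-cancelˡ-pos (d ^ q) (m^n>0 d q) (begin
    d ^ q * ((a + b) ^ q * G)    ≡⟨ e₁ (d ^ q) ((a + b) ^ q) G ⟩
    (a + b) ^ q * d ^ q * G      ≡⟨ cong (_* G) (sym (^-distribʳ-* q (a + b) d)) ⟩
    ((a + b) * d) ^ q * G        ≤⟨ *-monoˡ-≤ G (^-monoˡ-≤ q med) ⟩
    (b * (c + d)) ^ q * G        ≡⟨ cong (_* G) (^-distribʳ-* q b (c + d)) ⟩
    b ^ q * (c + d) ^ q * G      ≡⟨ e₂ (b ^ q) ((c + d) ^ q) G ⟩
    (c + d) ^ q * (b ^ q * G)    ≤⟨ *-monoʳ-≤ ((c + d) ^ q) hb ⟩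
    (c + d) ^ q * (d ^ q * H)    ≡⟨ e₃ ((c + d) ^ q) (d ^ q) H ⟩
    d ^ q * ((c + d) ^ q * H)    ∎)
    where
    open ≤-Reasoning
    e₁ : ∀ x y z → x * (y * z) ≡ y * x * z
    e₁ = solve-∀
    e₂ : ∀ x y z → x * y * z ≡ y * (x * z)
    e₂ = solve-∀
    e₃ : ∀ x y z → x * (y * z) ≡ y * (x * z)
    e₃ = solve-∀
    med : (a + b) * d ≤ b * (c + d)
    med = subst₂ _≤_ (sym (*-distribʳ-+ d a b)) (sym (*-distribˡ-+ b c d)) (+-monoˡ-≤ (b * d) h)

  -- Comparisons a G^{1/q} ≤ c H^{1/q} can be added.
  root-add : ∀ q {G H} a b c d → 0 < q → a ^ q * G ≤ c ^ q * H → b ^ q * G ≤ d ^ q * H →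
    (a + b) ^ q * G ≤ (c + d) ^ q * H
  root-add q {G} {H} a b c d 0<q ha hb with ≤-total (a * d) (b * c)
  ... | inj₁ ad≤bc = root-mediant q a b c d 0<q ha hb ad≤bc
  ... | inj₂ bc≤ad = subst₂ (λ y z → y ^ q * G ≤ z ^ q * H) (+-comm b a) (+-comm d c)
    (root-mediant q b a d c 0<q hb ha bc≤ad)

  -- PowerBound says x / T ≤ (u / T)^{p/q}.  The hypothesis m q ≤ p makes the two tangents used below sufficient.
  module PowerStep (m q r : ℕ) (0<m : 0 < m) (0<q : 0 < q) (0<r : 0 < r) (mq≤p : m * q ≤ q + r)
    (η : suc m ^ (q + r) ≤ suc m ^ q * m ^ (q + r)) where

    private
      t p : ℕ
      t = suc m
      p = q + r

      split : ∀ a → a ^ p ≡ a ^ q * a ^ r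
      split a = ^-distribˡ-+-* a q r

      0^ : ∀ {k} → 0 < k → 0 ^ k ≡ 0
      0^ {suc _} _ = refl

    PowerBound : (T x u : ℕ) → Set
    PowerBound T x u = x ^ q * T ^ p ≤ u ^ p * T ^ q

    open ≤-Reasoning

    -- u/v large: compare with the tangent of w ↦ w^{p/q} at the point m u.
    step-large : ∀ {T x y u v} → 0 < u → m ^ q * v ^ r ≤ u ^ r → PowerBound T x u → PowerBound T y v →
      PowerBound (t * T) (x + m * y) (m * u + v)
    step-large {T} {x} {y} {u} {v} 0<u large hx hy = *-cancelˡ-pos ((q * (m * u)) ^ q) pos (begin
      D * ((x + m * y) ^ q * (t * T) ^ p)
        ≡⟨ cong (λ z → D * ((x + m * y) ^ q * z)) (^-distribʳ-* p t T) ⟩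
      D * ((x + m * y) ^ q * (t ^ p * T ^ p))
        ≡⟨ e₁ D ((x + m * y) ^ q) (t ^ p) (T ^ p) ⟩
      t ^ p * ((x + m * y) ^ q * (D * T ^ p))
        ≤⟨ *-mono-≤ η added ⟩
      t ^ q * m ^ p * ((q * (m * u) + p * v) ^ q * (u ^ p * T ^ q))
        ≡⟨ e₂ (t ^ q) (m ^ p) ((q * (m * u) + p * v) ^ q) (u ^ p) (T ^ q) ⟩
      t ^ q * T ^ q * (m ^ p * u ^ p * (q * (m * u) + p * v) ^ q)
        ≡⟨ cong₂ (λ y z → y * (z * (q * (m * u) + p * v) ^ q)) (sym (^-distribʳ-* q t T))
             (trans (sym (^-distribʳ-* p m u)) (split (m * u))) ⟩
      (t * T) ^ q * ((m * u) ^ q * (m * u) ^ r * (q * (m * u) + p * v) ^ q)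
        ≡⟨ cong ((t * T) ^ q *_) (*-assoc ((m * u) ^ q) ((m * u) ^ r) _) ⟩
      (t * T) ^ q * ((m * u) ^ q * ((m * u) ^ r * (q * (m * u) + p * v) ^ q))
        ≤⟨ *-monoʳ-≤ ((t * T) ^ q) (*-monoʳ-≤ ((m * u) ^ q) (bernoulli q r 0<q (e₃ q r (m * u) v))) ⟩
      (t * T) ^ q * ((m * u) ^ q * (q ^ q * (m * u + v) ^ p))
        ≡⟨ e₄ ((t * T) ^ q) ((m * u) ^ q) (q ^ q) ((m * u + v) ^ p) ⟩
      q ^ q * (m * u) ^ q * ((m * u + v) ^ p * (t * T) ^ q)
        ≡⟨ cong (_* ((m * u + v) ^ p * (t * T) ^ q)) (sym (^-distribʳ-* q q (m * u))) ⟩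
      D * ((m * u + v) ^ p * (t * T) ^ q) ∎)
      where
      D : ℕ
      D = (q * (m * u)) ^ q
      pos : 0 < D
      pos = m^n>0 (q * (m * u)) {{>-nonZero (*-mono-≤ 0<q (*-mono-≤ 0<m 0<u))}} q
      e₁ : ∀ D X tp Tp → D * (X * (tp * Tp)) ≡ tp * (X * (D * Tp))
      e₁ = solve-∀
      e₂ : ∀ tq mp X up Tq → tq * mp * (X * (up * Tq)) ≡ tq * Tq * (mp * up * X)
      e₂ = solve-∀
      e₃ : ∀ q r a v → r * a + (q * a + (q + r) * v) ≡ (q + r) * (a + v)
      e₃ = solve-∀
      e₄ : ∀ a b c d → a * (b * (c * d)) ≡ c * b * (d * a)
      e₄ = solve-∀
      e₅ : ∀ a b c → a * (b * c) ≡ b * (a * c)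
      e₅ = solve-∀
      e₆ : ∀ mq yq D Tp → mq * yq * (D * Tp) ≡ mq * D * (yq * Tp)
      e₆ = solve-∀
      e₇ : ∀ mq qm uq vq vr Tq → mq * (qm * uq) * (vq * vr * Tq) ≡ mq * vr * (qm * (uq * (vq * Tq)))
      e₇ = solve-∀
      e₈ : ∀ ur pq uq vq Tq → ur * (pq * (uq * (vq * Tq))) ≡ pq * vq * (uq * ur * Tq)
      e₈ = solve-∀
      -- With `s = p / q`, the linear term `s (m u)^{s-1} v` of the tangent has to absorb
      -- `m^{s+1} v^s`: `large` supplies one factor `m` and `m * q ≤ p` the other.
      hy′ : (m * y) ^ q * (D * T ^ p) ≤ (p * v) ^ q * (u ^ p * T ^ q)
      hy′ = begin
        (m * y) ^ q * (D * T ^ p)            ≡⟨ cong (_* (D * T ^ p)) (^-distribʳ-* q m y) ⟩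
        m ^ q * y ^ q * (D * T ^ p)          ≡⟨ e₆ (m ^ q) (y ^ q) D (T ^ p) ⟩
        m ^ q * D * (y ^ q * T ^ p)          ≤⟨ *-monoʳ-≤ (m ^ q * D) hy ⟩
        m ^ q * D * (v ^ p * T ^ q)
          ≡⟨ cong₂ (λ y z → m ^ q * y * (z * T ^ q))
               (trans (cong (_^ q) (sym (*-assoc q m u))) (^-distribʳ-* q (q * m) u)) (split v) ⟩
        m ^ q * ((q * m) ^ q * u ^ q) * (v ^ q * v ^ r * T ^ q)
          ≡⟨ e₇ (m ^ q) ((q * m) ^ q) (u ^ q) (v ^ q) (v ^ r) (T ^ q) ⟩
        m ^ q * v ^ r * ((q * m) ^ q * (u ^ q * (v ^ q * T ^ q)))
          ≤⟨ *-mono-≤ large (*-monoˡ-≤ _ (^-monoˡ-≤ q (subst (_≤ p) (*-comm m q) mq≤p))) ⟩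
        u ^ r * (p ^ q * (u ^ q * (v ^ q * T ^ q)))
          ≡⟨ e₈ (u ^ r) (p ^ q) (u ^ q) (v ^ q) (T ^ q) ⟩
        p ^ q * v ^ q * (u ^ q * u ^ r * T ^ q)
          ≡⟨ cong₂ (λ y z → y * (z * T ^ q)) (sym (^-distribʳ-* q p v)) (sym (split u)) ⟩
        (p * v) ^ q * (u ^ p * T ^ q)        ∎
      added : (x + m * y) ^ q * (D * T ^ p) ≤ (q * (m * u) + p * v) ^ q * (u ^ p * T ^ q)
      added = root-add q x (m * y) (q * (m * u)) (p * v) 0<q
        (subst (_≤ D * (u ^ p * T ^ q)) (e₅ D (x ^ q) (T ^ p)) (*-monoʳ-≤ D hx)) hy′

    -- u/v small: compare with the tangent of w ↦ w^{p/q} at the point v.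
    step-small : ∀ {T x y v} δ → 0 < v → (v + δ) ^ r ≤ m ^ q * v ^ r → PowerBound T x (v + δ) → PowerBound T y v →
      PowerBound (t * T) (x + m * y) (m * (v + δ) + v)
    step-small {T} {x} {y} {v} δ 0<v small hx hy = *-cancelˡ-pos ((q * v) ^ q) pos (begin
      D * ((x + m * y) ^ q * (t * T) ^ p)
        ≡⟨ cong (λ z → D * ((x + m * y) ^ q * z)) (^-distribʳ-* p t T) ⟩
      D * ((x + m * y) ^ q * (t ^ p * T ^ p))
        ≡⟨ e₁ D ((x + m * y) ^ q) (t ^ p) (T ^ p) ⟩
      t ^ p * ((x + m * y) ^ q * (D * T ^ p))
        ≤⟨ *-monoʳ-≤ (t ^ p) added ⟩
      t ^ p * ((C + m * (q * v)) ^ q * (v ^ p * T ^ q))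
        ≡⟨ cong (λ z → t ^ p * (z ^ q * (v ^ p * T ^ q))) (e₂ q v p m δ) ⟩
      t ^ p * (C′ ^ q * (v ^ p * T ^ q))
        ≡⟨ e₃ (t ^ p) (C′ ^ q) (v ^ p) (T ^ q) ⟩
      t ^ p * v ^ p * C′ ^ q * T ^ q
        ≡⟨ cong (λ z → z * C′ ^ q * T ^ q) (trans (sym (^-distribʳ-* p t v)) (split (t * v))) ⟩
      (t * v) ^ q * (t * v) ^ r * C′ ^ q * T ^ q
        ≡⟨ e₄ ((t * v) ^ q) ((t * v) ^ r) (C′ ^ q) (T ^ q) ⟩
      (t * v) ^ q * T ^ q * ((t * v) ^ r * C′ ^ q)
        ≤⟨ *-monoʳ-≤ ((t * v) ^ q * T ^ q) (bernoulli q r 0<q (e₅ q r m v δ)) ⟩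
      (t * v) ^ q * T ^ q * (q ^ q * (m * (v + δ) + v) ^ p)
        ≡⟨ cong (λ z → z * T ^ q * (q ^ q * (m * (v + δ) + v) ^ p)) (^-distribʳ-* q t v) ⟩
      t ^ q * v ^ q * T ^ q * (q ^ q * (m * (v + δ) + v) ^ p)
        ≡⟨ e₆ (t ^ q) (v ^ q) (T ^ q) (q ^ q) ((m * (v + δ) + v) ^ p) ⟩
      q ^ q * v ^ q * ((m * (v + δ) + v) ^ p * (t ^ q * T ^ q))
        ≡⟨ cong₂ (λ y z → y * ((m * (v + δ) + v) ^ p * z)) (sym (^-distribʳ-* q q v)) (sym (^-distribʳ-* q t T)) ⟩
      D * ((m * (v + δ) + v) ^ p * (t * T) ^ q) ∎)
      where
      u D C C′ : ℕ
      u = v + δ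
      D = (q * v) ^ q
      C = q * v + p * (m * δ)
      C′ = q * (t * v) + p * (m * δ)
      pos : 0 < D
      pos = m^n>0 (q * v) {{>-nonZero (*-mono-≤ 0<q 0<v)}} q
      e₁ : ∀ D X tp Tp → D * (X * (tp * Tp)) ≡ tp * (X * (D * Tp))
      e₁ = solve-∀
      e₂ : ∀ q v p m δ → q * v + p * (m * δ) + m * (q * v) ≡ q * (suc m * v) + p * (m * δ)
      e₂ = solve-∀
      e₃ : ∀ a b c d → a * (b * (c * d)) ≡ a * c * b * d
      e₃ = solve-∀
      e₄ : ∀ a b c d → a * b * c * d ≡ a * d * (b * c)
      e₄ = solve-∀
      e₅ : ∀ q r m v δ → r * (suc m * v) + (q * (suc m * v) + (q + r) * (m * δ)) ≡ (q + r) * (m * (v + δ) + v)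
      e₅ = solve-∀
      e₆ : ∀ a b c d e → a * b * c * (d * e) ≡ d * b * (e * (a * c))
      e₆ = solve-∀
      e₇ : ∀ a b c → a * (b * c) ≡ b * (a * c)
      e₇ = solve-∀
      -- Up to a factor, `E` is the value at `v = u - δ` of the tangent at `u`; truncated
      -- subtraction takes care of a negative value.
      E : ℕ
      E = q * u ∸ p * δ
      tangent : E ^ q * u ^ r ≤ (q * v) ^ q * v ^ r
      tangent with ≤-total (p * δ) (q * u)
      ... | inj₂ le = subst (_≤ (q * v) ^ q * v ^ r) (sym zero′) z≤n
        where
        zero′ : E ^ q * u ^ r ≡ 0
        zero′ = cong (_* u ^ r) (trans (cong (_^ q) (m≤n⇒m∸n≡0 le)) (0^ 0<q))
      ... | inj₁ le = begin
        E ^ q * u ^ r        ≡⟨ *-comm (E ^ q) (u ^ r) ⟩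
        u ^ r * E ^ q        ≤⟨ bernoulli q r 0<q eq ⟩
        q ^ q * v ^ p        ≡⟨ cong (q ^ q *_) (split v) ⟩
        q ^ q * (v ^ q * v ^ r) ≡⟨ sym (*-assoc (q ^ q) (v ^ q) (v ^ r)) ⟩
        q ^ q * v ^ q * v ^ r ≡⟨ cong (_* v ^ r) (sym (^-distribʳ-* q q v)) ⟩
        (q * v) ^ q * v ^ r  ∎
        where
        eq : r * u + E ≡ p * v
        eq = +-cancelʳ-≡ (p * δ) _ _ (trans (+-assoc (r * u) E (p * δ))
          (trans (cong (r * u +_) (m∸n+n≡m le)) (f q r v δ)))
          where
          f : ∀ q r v δ → r * (v + δ) + q * (v + δ) ≡ (q + r) * v + (q + r) * δ
          f = solve-∀
      linear : (p * δ) ^ q * u ^ r ≤ (p * (m * δ)) ^ q * v ^ r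
      linear = begin
        (p * δ) ^ q * u ^ r               ≤⟨ *-monoʳ-≤ ((p * δ) ^ q) small ⟩
        (p * δ) ^ q * (m ^ q * v ^ r)     ≡⟨ sym (*-assoc ((p * δ) ^ q) (m ^ q) (v ^ r)) ⟩
        (p * δ) ^ q * m ^ q * v ^ r       ≡⟨ cong (_* v ^ r) (trans (sym (^-distribʳ-* q (p * δ) m))
                                                (cong (_^ q) (f p δ m))) ⟩
        (p * (m * δ)) ^ q * v ^ r         ∎
        where
        f : ∀ p δ m → p * δ * m ≡ p * (m * δ)
        f = solve-∀
      -- This is `u^s ≤ v^s + s m δ v^{s-1}`: the tangent at `u` has slope `s u^{s-1}`, and `small`
      -- bounds `u^{s-1}` by `m v^{s-1}`.
      growth : u ^ p * D ≤ C ^ q * v ^ p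
      growth = begin
        u ^ p * D                        ≡⟨ cong₂ _*_ (split u) (^-distribʳ-* q q v) ⟩
        u ^ q * u ^ r * (q ^ q * v ^ q)  ≡⟨ f (u ^ q) (u ^ r) (q ^ q) (v ^ q) ⟩
        v ^ q * (q ^ q * u ^ q * u ^ r)  ≡⟨ cong (λ z → v ^ q * (z * u ^ r)) (sym (^-distribʳ-* q q u)) ⟩
        v ^ q * ((q * u) ^ q * u ^ r)    ≤⟨ *-monoʳ-≤ (v ^ q) (*-monoˡ-≤ (u ^ r) (^-monoˡ-≤ q (m≤n+m∸n (q * u) (p * δ)))) ⟩
        v ^ q * ((p * δ + E) ^ q * u ^ r) ≤⟨ *-monoʳ-≤ (v ^ q) (root-add q (p * δ) E (p * (m * δ)) (q * v) 0<q linear tangent) ⟩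
        v ^ q * ((p * (m * δ) + q * v) ^ q * v ^ r) ≡⟨ cong (λ z → v ^ q * (z ^ q * v ^ r)) (+-comm (p * (m * δ)) (q * v)) ⟩
        v ^ q * (C ^ q * v ^ r)          ≡⟨ e₇ (v ^ q) (C ^ q) (v ^ r) ⟩
        C ^ q * (v ^ q * v ^ r)          ≡⟨ cong (C ^ q *_) (sym (split v)) ⟩
        C ^ q * v ^ p ∎
        where
        f : ∀ a b c d → a * b * (c * d) ≡ d * (c * a * b)
        f = solve-∀
      added : (x + m * y) ^ q * (D * T ^ p) ≤ (C + m * (q * v)) ^ q * (v ^ p * T ^ q)
      added = root-add q x (m * y) C (m * (q * v)) 0<q hx′ hy′
        where
        hx′ : x ^ q * (D * T ^ p) ≤ C ^ q * (v ^ p * T ^ q)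
        hx′ = begin
          x ^ q * (D * T ^ p)  ≡⟨ e₇ (x ^ q) D (T ^ p) ⟩
          D * (x ^ q * T ^ p)  ≤⟨ *-monoʳ-≤ D hx ⟩
          D * (u ^ p * T ^ q)  ≡⟨ f D (u ^ p) (T ^ q) ⟩
          u ^ p * D * T ^ q    ≤⟨ *-monoˡ-≤ (T ^ q) growth ⟩
          C ^ q * v ^ p * T ^ q ≡⟨ *-assoc (C ^ q) (v ^ p) (T ^ q) ⟩
          C ^ q * (v ^ p * T ^ q) ∎
          where
          f : ∀ a b c → a * (b * c) ≡ b * a * c
          f = solve-∀
        hy′ : (m * y) ^ q * (D * T ^ p) ≤ (m * (q * v)) ^ q * (v ^ p * T ^ q)
        hy′ = begin
          (m * y) ^ q * (D * T ^ p)     ≡⟨ cong (_* (D * T ^ p)) (^-distribʳ-* q m y) ⟩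
          m ^ q * y ^ q * (D * T ^ p)   ≡⟨ f (m ^ q) (y ^ q) D (T ^ p) ⟩
          m ^ q * D * (y ^ q * T ^ p)   ≤⟨ *-monoʳ-≤ (m ^ q * D) hy ⟩
          m ^ q * D * (v ^ p * T ^ q)   ≡⟨ cong (_* (v ^ p * T ^ q)) (sym (^-distribʳ-* q m (q * v))) ⟩
          (m * (q * v)) ^ q * (v ^ p * T ^ q) ∎
          where
          f : ∀ a b c d → a * b * (c * d) ≡ a * c * (b * d)
          f = solve-∀

    PowerBound-zero : ∀ {T x} → 0 < T → PowerBound T x 0 → x ≡ 0
    PowerBound-zero {T} {x} 0<T hx with m*n≡0⇒m≡0∨n≡0 (x ^ q)
      (n≤0⇒n≡0 (≤-trans hx (≤-reflexive (cong (_* T ^ q) (0^ (≤-trans 0<q (m≤m+n q r)))))))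
    ... | inj₁ e = m^n≡0⇒m≡0 x q e
    ... | inj₂ e with () ← subst (0 <_) (m^n≡0⇒m≡0 T p e) 0<T

    zero-PowerBound : ∀ T u → PowerBound T 0 u
    zero-PowerBound T u = subst (_≤ u ^ p * T ^ q) (sym (cong (_* T ^ p) (0^ 0<q))) z≤n

    -- What has to hold is `t^{s-1} (u^s + m v^s) ≤ (m u + v)^s` for `s = p / q`: an equality at
    -- `u = v`, and the hypothesis `η` at `v = 0`. Which of the two tangents suffices depends on
    -- whether `(u / v)^{s-1}` exceeds `m`.
    step : ∀ {T x y u v} → 0 < T → y ≤ x → v ≤ u → PowerBound T x u → PowerBound T y v →
      PowerBound (t * T) (x + m * y) (m * u + v)
    step {T} {x} {y} {zero} {v} 0<T y≤x v≤u hx hy =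
      subst (λ z → PowerBound (t * T) z (m * 0 + v)) (sym x+my≡0) (zero-PowerBound (t * T) (m * 0 + v))
      where
      x≡0 : x ≡ 0
      x≡0 = PowerBound-zero 0<T hx
      x+my≡0 : x + m * y ≡ 0
      x+my≡0 = cong₂ _+_ x≡0 (trans (cong (m *_) (n≤0⇒n≡0 (subst (y ≤_) x≡0 y≤x))) (*-zeroʳ m))
    step {T} {x} {y} {u@(suc _)} {v} 0<T y≤x v≤u hx hy with ≤-total (m ^ q * v ^ r) (u ^ r)
    ... | inj₁ large = step-large {T} {x} {y} z<s large hx hy
    ... | inj₂ small = subst (λ u → PowerBound (t * T) (x + m * y) (m * u + v)) eq
        (step-small {T} {x} {y} (u ∸ v) 0<v (subst (λ u → u ^ r ≤ m ^ q * v ^ r) (sym eq) small)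
          (subst (PowerBound T x) (sym eq) hx) hy)
      where
      eq : v + (u ∸ v) ≡ u
      eq = m+[n∸m]≡n v≤u
      0<v : 0 < v
      0<v = n≢0⇒n>0 λ { refl → <-irrefl refl (≤-trans (m^n>0 u r)
        (≤-trans small (≤-reflexive (trans (cong (m ^ q *_) (0^ 0<r)) (*-zeroʳ (m ^ q)))))) }

    PowerCount : (n g v : ℕ) → Set
    PowerCount n = PowerBound (t ^ n)

    PowerCount-mono : ∀ {n g g′ v v′} → g′ ≤ g → v ≤ v′ → PowerCount n g v → PowerCount n g′ v′
    PowerCount-mono {n} g′≤g v≤v′ h = ≤-trans (*-monoˡ-≤ _ (^-monoˡ-≤ q g′≤g)) (≤-trans h (*-monoˡ-≤ _ (^-monoˡ-≤ p v≤v′)))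

    PowerCount-base₀ : PowerCount 0 0 0
    PowerCount-base₀ = zero-PowerBound 1 0

    PowerCount-base₁ : PowerCount 0 1 1
    PowerCount-base₁ = ≤-reflexive (*-comm (1 ^ q) (1 ^ p))

    PowerCount-step : ∀ {n g g′ v v′} → g′ ≤ g → v′ ≤ v → PowerCount n g v → PowerCount n g′ v′ →
      PowerCount (suc n) (g + m * g′) (m * v + v′)
    PowerCount-step {n} = step (m^n>0 t n)

-- Counting by slices, and the induction for cross-independent sets.

module Counting where
  open import Data.Nat
  open import Data.Nat.Properties
  open import Data.Bool using (Bool; true; false; not; _∧_; if_then_else_)
  open import Data.Bool.Properties using (T?)
  open import Data.Fin using (Fin; zero; suc; punchIn)
  open import Data.Fin.Properties using (punchInᵢ≢i)
  open import Data.Vec using ([]; _∷_; insertAt)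
  open import Data.List as List using (List; []; _∷_; length; filter; concatMap; tabulate)
  open import Data.List.Properties using (filter-++; length-++)
  open import Data.Product using (_,_; proj₁; proj₂; ∃)
  open import Data.Sum using (inj₁; inj₂)
  open import Data.Empty using (⊥-elim)
  open import Function using (_∘_; id)
  open import Relation.Nullary using (does; ¬_)
  open import Relation.Binary.PropositionalEquality
  open import Algebra.Properties.CommutativeMonoid.Sum +-0-commutativeMonoid using (sum; sum-cong-≗; ∑-distrib-+; ∑-comm; sum-remove; sum-replicate-zero)

  private variable
    t n : ℕ

  sum-mono : ∀ {k} {f g : Fin k → ℕ} → (∀ i → f i ≤ g i) → sum f ≤ sum g
  sum-mono {zero} h = z≤n
  sum-mono {suc k} h = +-mono-≤ (h zero) (sum-mono (h ∘ suc))

  sum-mono-< : ∀ {k} {f g : Fin k → ℕ} i → (∀ j → f j ≤ g j) → f i < g i → sum f < sum g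
  sum-mono-< zero h lt = +-mono-<-≤ lt (sum-mono (h ∘ suc))
  sum-mono-< (suc i) h lt = +-mono-≤-< (h zero) (sum-mono-< i (h ∘ suc) lt)

  sum-const : ∀ k c → sum {k} (λ _ → c) ≡ k * c
  sum-const zero c = refl
  sum-const (suc k) c = cong (c +_) (sum-const k c)

  sum≤ : ∀ {k} {f : Fin k → ℕ} {c} → (∀ i → f i ≤ c) → sum f ≤ k * c
  sum≤ {k} {c = c} h = ≤-trans (sum-mono h) (≤-reflexive (sum-const k c))

  ≤sum : ∀ {k} {f : Fin k → ℕ} {c} → (∀ i → c ≤ f i) → k * c ≤ sum f
  ≤sum {k} {c = c} h = ≤-trans (≤-reflexive (sym (sum-const k c))) (sum-mono h)

  argmax : ∀ {k} (f : Fin (suc k) → ℕ) → ∃ λ i → ∀ j → f j ≤ f i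
  argmax {zero} f = zero , λ { zero → ≤-refl }
  argmax {suc k} f with argmax (f ∘ suc)
  ... | i , h with ≤-total (f zero) (f (suc i))
  ... | inj₁ le = suc i , λ { zero → le ; (suc j) → h j }
  ... | inj₂ ge = zero , λ { zero → ≤-refl ; (suc j) → ≤-trans (h j) ge }

  argmin : ∀ {k} (f : Fin (suc k) → ℕ) → ∃ λ i → ∀ j → f i ≤ f j
  argmin {zero} f = zero , λ { zero → ≤-refl }
  argmin {suc k} f with argmin (f ∘ suc)
  ... | i , h with ≤-total (f (suc i)) (f zero)
  ... | inj₁ le = suc i , λ { zero → le ; (suc j) → h j }
  ... | inj₂ ge = zero , λ { zero → ≤-refl ; (suc j) → ≤-trans ge (h j) }

  ⟦_⟧ : Bool → ℕ
  ⟦ b ⟧ = if b then 1 else 0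

  cnt : VSet t n → ℕ
  cnt {n = zero}  S = ⟦ S [] ⟧
  cnt {n = suc n} S = sum (λ a → cnt (S ∘ (a ∷_)))

  length-filter-map : ∀ {A B : Set} (h : A → B) (S : B → Bool) xs →
    length (filter (λ x → T? (S x)) (List.map h xs)) ≡ length (filter (λ x → T? (S (h x))) xs)
  length-filter-map h S [] = refl
  length-filter-map h S (x ∷ xs) with does (T? (S (h x)))
  ... | true  = cong suc (length-filter-map h S xs)
  ... | false = length-filter-map h S xs

  length-filter-concatMap : ∀ {A B : Set} {k} (h : A → List B) (S : B → Bool) (g : Fin k → A) →
    length (filter (λ x → T? (S x)) (concatMap h (tabulate g))) ≡
    sum (λ a → length (filter (λ x → T? (S x)) (h (g a))))
  length-filter-concatMap {k = zero} h S g = refl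
  length-filter-concatMap {k = suc k} h S g =
    trans (cong length (filter-++ (λ x → T? (S x)) (h (g zero)) _))
    (trans (length-++ (filter (λ x → T? (S x)) (h (g zero))))
      (cong (_ +_) (length-filter-concatMap h S (g ∘ suc))))

  card≡cnt : (S : VSet t n) → card S ≡ cnt S
  card≡cnt {n = zero} S with S []
  ... | true  = refl
  ... | false = refl
  card≡cnt {t} {suc n} S =
    trans (length-filter-concatMap (λ a → List.map (a ∷_) (allVertices t n)) S id)
      (sum-cong-≗ λ a → trans (length-filter-map (a ∷_) S (allVertices t n)) (card≡cnt (S ∘ (a ∷_))))

  cnt-mono : {A B : VSet t n} → (∀ x → A x ≡ true → B x ≡ true) → cnt A ≤ cnt B
  cnt-mono {n = zero} {A} {B} h with A [] | h []
  ... | false | _ = z≤n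
  ... | true  | f rewrite f refl = ≤-refl
  cnt-mono {n = suc n} h = sum-mono λ a → cnt-mono (λ x → h (a ∷ x))

  -- Four sets are enough for partitions (with an empty fourth set) and for the bookkeeping of
  -- compressions, each reduced to a finite check at a point.
  cnt-add : {A B C D : VSet t n} → (∀ x → ⟦ A x ⟧ + ⟦ B x ⟧ ≡ ⟦ C x ⟧ + ⟦ D x ⟧) → cnt A + cnt B ≡ cnt C + cnt D
  cnt-add {n = zero} h = h []
  cnt-add {n = suc n} {A} {B} {C} {D} h = begin
    cnt A + cnt B ≡⟨ ∑-distrib-+ (λ a → cnt (A ∘ (a ∷_))) (λ a → cnt (B ∘ (a ∷_))) ⟨
    sum (λ a → cnt (A ∘ (a ∷_)) + cnt (B ∘ (a ∷_))) ≡⟨ sum-cong-≗ (λ a → cnt-add (λ x → h (a ∷ x))) ⟩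
    sum (λ a → cnt (C ∘ (a ∷_)) + cnt (D ∘ (a ∷_))) ≡⟨ ∑-distrib-+ (λ a → cnt (C ∘ (a ∷_))) (λ a → cnt (D ∘ (a ∷_))) ⟩
    cnt C + cnt D ∎
    where open ≡-Reasoning

  cnt-cong : {A B : VSet t n} → (∀ x → A x ≡ B x) → cnt A ≡ cnt B
  cnt-cong {n = zero} h = cong ⟦_⟧ (h [])
  cnt-cong {n = suc n} h = sum-cong-≗ λ a → cnt-cong (λ x → h (a ∷ x))

  cnt-empty : cnt {t} {n} (λ _ → false) ≡ 0
  cnt-empty {n = zero} = refl
  cnt-empty {t} {n = suc n} = trans (sum-cong-≗ {t} λ _ → cnt-empty {t} {n}) (sum-replicate-zero t)

  cnt-all : cnt {t} {n} (λ _ → true) ≡ t ^ n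
  cnt-all {n = zero} = refl
  cnt-all {t} {n = suc n} = trans (sum-cong-≗ {t} λ _ → cnt-all {t} {n}) (sum-const t (t ^ n))

  cnt-split : (A f : VSet t n) → cnt A ≡ cnt (λ x → A x ∧ f x) + cnt (λ x → A x ∧ not (f x))
  cnt-split {t} {n} A f = trans (sym (+-identityʳ _))
    (trans (cong (cnt A +_) (sym (cnt-empty {t} {n}))) (cnt-add λ x → e (A x) (f x)))
    where
    e : ∀ a f → ⟦ a ⟧ + 0 ≡ ⟦ a ∧ f ⟧ + ⟦ a ∧ not f ⟧
    e false _ = refl
    e true false = refl
    e true true = refl

  cnt-not : (A : VSet t n) → cnt A + cnt (not ∘ A) ≡ t ^ n
  cnt-not {t} {n} A = trans (sym (cnt-split (λ _ → true) A)) (cnt-all {t} {n})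

  cnt≡0 : {A : VSet t n} → cnt A ≡ 0 → ∀ x → A x ≡ false
  cnt≡0 {n = zero} {A} h [] with A []
  ... | false = refl
  cnt≡0 {n = suc n} {A} h (a ∷ x) = cnt≡0 (sum≡0 _ h a) x
    where
    sum≡0 : ∀ {k} (f : Fin k → ℕ) → sum f ≡ 0 → ∀ i → f i ≡ 0
    sum≡0 f h zero = m+n≡0⇒m≡0 (f zero) h
    sum≡0 f h (suc i) = sum≡0 (f ∘ suc) (m+n≡0⇒n≡0 (f zero) h) i

  slice : Fin (suc n) → Fin t → VSet t (suc n) → VSet t n
  slice i a S x = S (insertAt x i a)

  cnt-slices : ∀ i (S : VSet t (suc n)) → cnt S ≡ sum (λ a → cnt (slice i a S))
  cnt-slices zero S = refl
  cnt-slices {n = suc n} (suc i) S =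
    trans (sum-cong-≗ λ b → cnt-slices i (S ∘ (b ∷_))) (∑-comm λ b a → cnt (slice i a (S ∘ (b ∷_))))

  CrossIndependent : VSet t n → VSet t n → Set
  CrossIndependent A B = ∀ x y → A x ≡ true → B y ≡ true → ¬ Adjacent x y

  -- Slices of A and B at different values are cross-independent.  So the largest slice of A constrains all slices
  -- of B but one, and that one is constrained by the second largest slice of A.
  module Cross (m₁ : ℕ) (R : (n g v : ℕ) → Set)
    (R-mono : ∀ {n g g′ v v′} → g′ ≤ g → v ≤ v′ → R n g v → R n g′ v′)
    (R-base₀ : R 0 0 0) (R-base₁ : R 0 1 1)
    (R-step : ∀ {n g g′ v v′} → g′ ≤ g → v′ ≤ v → R n g v → R n g′ v′ →
      R (suc n) (g + suc m₁ * g′) (suc m₁ * v + v′)) where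

    private
      m : ℕ
      m = suc m₁

    cross : (A B : VSet (suc m) n) → CrossIndependent A B → R n (cnt A) (cnt (not ∘ B))
    cross {n = zero} A B cr with A [] | B [] | cr [] []
    ... | false | false | _ = R-mono z≤n z≤n R-base₀
    ... | false | true  | _ = R-base₀
    ... | true  | false | _ = R-base₁
    -- The empty vector is vacuously adjacent to itself.
    ... | true  | true  | h = ⊥-elim (h refl refl λ ())
    cross {n = suc n} A B cr = R-mono g-le v-le (R-step (h₁ _) (m⊓n≤m (v b₁) (v a₁)) Ru Rv)
      where
      g v : Fin (suc m) → ℕ
      g a = cnt (A ∘ (a ∷_))
      v b = cnt (not ∘ B ∘ (b ∷_))
      off : ∀ {a b} → a ≢ b → R n (g a) (v b)
      off {a} {b} a≢b = cross (A ∘ (a ∷_)) (B ∘ (b ∷_)) λ x y Ax By adj →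
        cr (a ∷ x) (b ∷ y) Ax By λ { zero → a≢b ; (suc i) → adj i }
      a₁ : Fin (suc m)
      a₁ = proj₁ (argmax g)
      h₁ : ∀ a → g a ≤ g a₁
      h₁ = proj₂ (argmax g)
      a₂ b₁ : Fin (suc m)
      a₂ = punchIn a₁ (proj₁ (argmax (g ∘ punchIn a₁)))
      b₁ = punchIn a₁ (proj₁ (argmin (v ∘ punchIn a₁)))
      Ru : R n (g a₁) (v b₁)
      Ru = off (punchInᵢ≢i a₁ _ ∘ sym)
      -- `R-step` wants its second value to be at most the first, hence the minimum. When it is
      -- `v b₁`, the relation follows from `Ru` because `g a₂ ≤ g a₁`.
      Rv : R n (g a₂) (v b₁ ⊓ v a₁)
      Rv with ⊓-sel (v b₁) (v a₁)
      ... | inj₁ e = subst (R n (g a₂)) (sym e) (R-mono (h₁ a₂) ≤-refl Ru)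
      ... | inj₂ e = subst (R n (g a₂)) (sym e) (off (punchInᵢ≢i a₁ _))
      g-le : sum g ≤ g a₁ + m * g a₂
      g-le = ≤-trans (≤-reflexive (sum-remove {i = a₁} g))
        (+-monoʳ-≤ (g a₁) (sum≤ (proj₂ (argmax (g ∘ punchIn a₁)))))
      v-le : m * v b₁ + (v b₁ ⊓ v a₁) ≤ sum v
      v-le = ≤-trans (+-mono-≤ (≤sum (proj₂ (argmin (v ∘ punchIn a₁)))) (m⊓n≤n (v b₁) (v a₁)))
        (≤-reflexive (trans (+-comm _ (v a₁)) (sym (sum-remove {i = a₁} v))))

-- Hoffman's bound for vectors agreeing pairwise at least twice.

module Spectral where
  open import Data.Nat as ℕ using (ℕ; zero; suc; z≤n; s≤s; z<s)
  import Data.Nat.Properties as ℕ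
  open import Data.Integer as ℤ using (ℤ; +_; -_; _+_; _*_; _-_; _≤_; 0ℤ; 1ℤ; +≤+; _^_)
  open import Data.Integer.Properties hiding (_≟_)
  open import Data.Integer.Tactic.RingSolver using (solve-∀)
  import Data.Nat.Tactic.RingSolver as ℕS
  open import Data.Bool using (true; false)
  open import Data.Fin using (Fin; zero; suc; punchIn; _≟_)
  open import Data.Fin.Properties using (punchInᵢ≢i)
  open import Data.Vec using ([]; _∷_)
  open import Data.Product using (_×_; _,_)
  open import Data.Sum using (_⊎_; inj₁; inj₂)
  open import Data.Empty using (⊥-elim)
  open import Function using (_∘_)
  open import Relation.Nullary using (yes; no; does)
  open import Relation.Binary.PropositionalEquality
  open import Algebra.Properties.Semiring.Sum +-*-semiring using (sum; sum-cong-≗; ∑-distrib-+; ∑-comm; sum-remove; sum-replicate-zero; *-distribˡ-sum)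
  import Algebra.Properties.CommutativeMonoid.Sum ℕ.+-0-commutativeMonoid as ℕΣ
  open Counting using (cnt; ⟦_⟧)

  *-nonneg : ∀ {i j} → 0ℤ ≤ i → 0ℤ ≤ j → 0ℤ ≤ i * j
  *-nonneg {+ m} {+ n} _ _ = subst (0ℤ ≤_) (pos-* m n) (+≤+ z≤n)

  +-nonneg : ∀ {i j} → 0ℤ ≤ i → 0ℤ ≤ j → 0ℤ ≤ i + j
  +-nonneg {+ m} {+ n} _ _ = +≤+ z≤n

  sum-nonneg : ∀ {k} {f : Fin k → ℤ} → (∀ i → 0ℤ ≤ f i) → 0ℤ ≤ sum f
  sum-nonneg {zero} h = +≤+ z≤n
  sum-nonneg {suc k} h = +-nonneg (h zero) (sum-nonneg (h ∘ suc))

  i≡i+i⇒i≡0 : ∀ i → i ≡ i + i → i ≡ 0ℤ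
  i≡i+i⇒i≡0 i e = trans (s i) (trans (cong (_- i) (sym e)) (+-inverseʳ i))
    where
    s : ∀ i → i ≡ i + i - i
    s = solve-∀

  -- Additivity over the integers already yields zero, finite sums and differences. A form may be
  -- asymmetric, so mixed terms are kept in both orders.
  record Bilinear (X : Set) : Set where
    field
      form    : (X → ℤ) → (X → ℤ) → ℤ
      form-cong : ∀ {f f′ g g′} → f ≗ f′ → g ≗ g′ → form f g ≡ form f′ g′
      addˡ    : ∀ f f′ g → form (λ x → f x + f′ x) g ≡ form f g + form f′ g
      addʳ    : ∀ f g g′ → form f (λ x → g x + g′ x) ≡ form f g + form f g′

    zeroˡ : ∀ g → form (λ _ → 0ℤ) g ≡ 0ℤ
    zeroˡ g = i≡i+i⇒i≡0 (form (λ _ → 0ℤ) g) (addˡ (λ _ → 0ℤ) (λ _ → 0ℤ) g)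

    zeroʳ : ∀ f → form f (λ _ → 0ℤ) ≡ 0ℤ
    zeroʳ f = i≡i+i⇒i≡0 (form f (λ _ → 0ℤ)) (addʳ f (λ _ → 0ℤ) (λ _ → 0ℤ))

    sumˡ : ∀ {k} (F : Fin k → X → ℤ) g → form (λ x → sum (λ a → F a x)) g ≡ sum (λ a → form (F a) g)
    sumˡ {zero} F g = zeroˡ g
    sumˡ {suc k} F g = trans (addˡ (F zero) _ g) (cong (_+_ (form (F zero) g)) (sumˡ (F ∘ suc) g))

    sumʳ : ∀ {k} f (G : Fin k → X → ℤ) → form f (λ x → sum (λ a → G a x)) ≡ sum (λ a → form f (G a))
    sumʳ {zero} f G = zeroʳ f
    sumʳ {suc k} f G = trans (addʳ f (G zero) _) (cong (_+_ (form f (G zero))) (sumʳ f (G ∘ suc)))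

    -- Differences are reached by applying additivity to `f = (f - g) + g`.
    square-sub : ∀ f g → form (λ x → f x - g x) (λ x → f x - g x) ≡ form f f - form f g - form g f + form g g
    square-sub f g = trans (s (form d d) (form d g) (form g d) (form g g))
      (trans (cong₂ (λ y z → y - z - (form g d + form g g) + form g g) ff fg)
             (cong (λ z → form f f - form f g - z + form g g) gf))
      where
      d : X → ℤ
      d x = f x - g x
      s : ∀ dd dg gd gg → dd ≡ (dd + dg + (gd + gg)) - (dg + gg) - (gd + gg) + gg
      s = solve-∀
      back : (λ x → d x + g x) ≗ f
      back x = b (f x) (g x)
        where
        b : ∀ i j → i - j + j ≡ i
        b = solve-∀
      fg : form d g + form g g ≡ form f g
      fg = trans (sym (addˡ d g g)) (form-cong back λ _ → refl)
      gf : form g d + form g g ≡ form g f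
      gf = trans (sym (addʳ g d g)) (form-cong (λ _ → refl) back)
      ff : form d d + form d g + (form g d + form g g) ≡ form f f
      ff = trans (cong₂ _+_ (trans (sym (addʳ d d g)) (form-cong (λ _ → refl) back))
                            (trans (sym (addʳ g d g)) (form-cong (λ _ → refl) back)))
           (trans (sym (addˡ d g f)) (form-cong back λ _ → refl))

    jensen-gap : ∀ {k} f (F : Fin k → X → ℤ) → let S = λ x → sum (λ a → F a x) in
      sum (λ a → form (λ x → f x - F a x) (λ x → f x - F a x)) ≡
      + k * form f f - form f S - form S f + sum (λ a → form (F a) (F a))
    jensen-gap {zero} f F = trans (s (form f f)) (sym (cong₂ (λ y z → 0ℤ * form f f - y - z + 0ℤ) (zeroʳ f) (zeroˡ f)))
      where
      s : ∀ i → 0ℤ ≡ 0ℤ * i - 0ℤ - 0ℤ + 0ℤ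
      s = solve-∀
    jensen-gap {suc k} f F = begin
      _ ≡⟨ cong₂ _+_ (square-sub f (F zero)) (jensen-gap f (F ∘ suc)) ⟩
      ff - fz - zf + zz + (+ k * ff - fS - Sf + SS) ≡⟨ s ff fz zf zz (+ k) fS Sf SS ⟩
      (1ℤ + + k) * ff - (fz + fS) - (zf + Sf) + (zz + SS)
        ≡⟨ cong₂ (λ y z → + suc k * ff - y - z + (zz + SS)) (addʳ f (F zero) S) (addˡ (F zero) S f) ⟨
      _ ∎
      where
      open ≡-Reasoning
      S : X → ℤ
      S x = sum (λ a → F (suc a) x)
      ff = form f f
      fz = form f (F zero)
      zf = form (F zero) f
      zz = form (F zero) (F zero)
      fS = form f S
      Sf = form S f
      SS = sum (λ a → form (F (suc a)) (F (suc a)))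
      s : ∀ ff fz zf zz k fS Sf SS → ff - fz - zf + zz + (k * ff - fS - Sf + SS) ≡
        (1ℤ + k) * ff - (fz + fS) - (zf + Sf) + (zz + SS)
      s = solve-∀

    -- The difference equals the sum of the squares of `F a - F b` over the pairs `a < b`; each step
    -- of the induction peels off the pairs containing the first index.
    jensen : (∀ f → 0ℤ ≤ form f f) → ∀ {k} (F : Fin k → X → ℤ) → let S = λ x → sum (λ a → F a x) in
      0ℤ ≤ + k * sum (λ a → form (F a) (F a)) - form S S
    jensen pos {zero} F = ≤-reflexive (sym (cong (λ z → 0ℤ - z) (zeroˡ (λ _ → 0ℤ))))
    jensen pos {suc k} F = subst (0ℤ ≤_) eq
        (+-nonneg (sum-nonneg λ a → pos (λ x → F zero x - F (suc a) x)) (jensen pos (F ∘ suc)))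
      where
      open ≡-Reasoning
      S : X → ℤ
      S x = sum (λ a → F (suc a) x)
      zS = form (F zero) S
      Sz = form S (F zero)
      zz = form (F zero) (F zero)
      SS = sum (λ a → form (F (suc a)) (F (suc a)))
      s : ∀ k zz zS Sz SS SfS → k * zz - zS - Sz + SS + (k * SS - SfS) ≡
        (1ℤ + k) * (zz + SS) - ((zz + Sz) + (zS + SfS))
      s = solve-∀
      eq : sum (λ a → form (λ x → F zero x - F (suc a) x) (λ x → F zero x - F (suc a) x)) +
          (+ k * SS - form S S) ≡
        + suc k * (zz + SS) - form (λ x → F zero x + S x) (λ x → F zero x + S x)
      eq = begin
        _ ≡⟨ cong (_+ (+ k * SS - form S S)) (jensen-gap (F zero) (F ∘ suc)) ⟩
        + k * zz - zS - Sz + SS + (+ k * SS - form S S) ≡⟨ s (+ k) zz zS Sz SS (form S S) ⟩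
        (1ℤ + + k) * (zz + SS) - ((zz + Sz) + (zS + form S S))
          ≡⟨ cong (λ z → + suc k * (zz + SS) - z)
               (trans (addʳ _ (F zero) S) (cong₂ _+_ (addˡ (F zero) S (F zero)) (addˡ (F zero) S S))) ⟨
        _ ∎

  open Bilinear

  product₀ : ∀ {t} → Bilinear (Vertex t 0)
  product₀ .form f g = f [] * g []
  product₀ .form-cong p q = cong₂ _*_ (p []) (q [])
  product₀ .addˡ f f′ g = *-distribʳ-+ (g []) (f []) (f′ [])
  product₀ .addʳ f g g′ = *-distribˡ-+ (f []) (g []) (g′ [])

  infixl 6 _⊕_
  infixl 7 _⊙_

  interchange : ∀ a b c d → a + b + (c + d) ≡ a + c + (b + d)
  interchange = solve-∀

  _⊕_ : ∀ {X} → Bilinear X → Bilinear X → Bilinear X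
  (A ⊕ B) .form f g = form A f g + form B f g
  (A ⊕ B) .form-cong p q = cong₂ _+_ (form-cong A p q) (form-cong B p q)
  (A ⊕ B) .addˡ f f′ g = trans (cong₂ _+_ (addˡ A f f′ g) (addˡ B f f′ g)) (interchange (form A f g) _ _ _)
  (A ⊕ B) .addʳ f g g′ = trans (cong₂ _+_ (addʳ A f g g′) (addʳ B f g g′)) (interchange (form A f g) _ _ _)

  _⊙_ : ∀ {X} → ℤ → Bilinear X → Bilinear X
  (c ⊙ A) .form f g = c * form A f g
  (c ⊙ A) .form-cong p q = cong (c *_) (form-cong A p q)
  (c ⊙ A) .addˡ f f′ g = trans (cong (c *_) (addˡ A f f′ g)) (*-distribˡ-+ c _ _)
  (c ⊙ A) .addʳ f g g′ = trans (cong (c *_) (addʳ A f g g′)) (*-distribˡ-+ c _ _)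

  module _ {t n : ℕ} where
    total : (Vertex t (suc n) → ℤ) → Vertex t n → ℤ
    total f x = sum (λ a → f (a ∷ x))

    ontotal : Bilinear (Vertex t n) → Bilinear (Vertex t (suc n))
    ontotal A .form f g = form A (total f) (total g)
    ontotal A .form-cong p q = form-cong A (λ x → sum-cong-≗ λ a → p (a ∷ x)) (λ x → sum-cong-≗ λ a → q (a ∷ x))
    ontotal A .addˡ f f′ g = trans
      (form-cong A (λ x → ∑-distrib-+ (λ a → f (a ∷ x)) (λ a → f′ (a ∷ x))) (λ _ → refl)) (addˡ A _ _ _)
    ontotal A .addʳ f g g′ = trans
      (form-cong A (λ _ → refl) (λ x → ∑-distrib-+ (λ a → g (a ∷ x)) (λ a → g′ (a ∷ x)))) (addʳ A _ _ _)

    diagonal : Bilinear (Vertex t n) → Bilinear (Vertex t (suc n))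
    diagonal A .form f g = sum (λ a → form A (f ∘ (a ∷_)) (g ∘ (a ∷_)))
    diagonal A .form-cong p q = sum-cong-≗ λ a → form-cong A (λ x → p (a ∷ x)) (λ x → q (a ∷ x))
    diagonal A .addˡ f f′ g = trans (sum-cong-≗ λ a → addˡ A (f ∘ (a ∷_)) (f′ ∘ (a ∷_)) (g ∘ (a ∷_))) (∑-distrib-+ {t} _ _)
    diagonal A .addʳ f g g′ = trans (sum-cong-≗ λ a → addʳ A (f ∘ (a ∷_)) (g ∘ (a ∷_)) (g′ ∘ (a ∷_))) (∑-distrib-+ {t} _ _)

  grand : ∀ {t n} → (Vertex t n → ℤ) → ℤ
  grand {n = zero} f = f []
  grand {n = suc n} f = grand (total f)

  grand-cong : ∀ {t n} {f g : Vertex t n → ℤ} → f ≗ g → grand f ≡ grand g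
  grand-cong {n = zero} h = h []
  grand-cong {n = suc n} h = grand-cong λ x → sum-cong-≗ λ a → h (a ∷ x)

  grand-sum : ∀ {t n k} (F : Fin k → Vertex t n → ℤ) → grand (λ x → sum (λ a → F a x)) ≡ sum (λ a → grand (F a))
  grand-sum {n = zero} F = refl
  grand-sum {n = suc n} F = trans (grand-cong λ x → ∑-comm λ b a → F a (b ∷ x)) (grand-sum λ a → total (F a))

  -- agreeₙ, agree₀ and agree₁ sum f x * g y over the pairs (x , y) that are equal, that agree nowhere, and that agree exactly once.
  agreeₙ agree₀ agree₁ : ∀ {t} n → Bilinear (Vertex t n)
  agreeₙ zero = product₀
  agreeₙ (suc n) = diagonal (agreeₙ n)
  agree₀ zero = product₀
  agree₀ (suc n) = ontotal (agree₀ n) ⊕ - 1ℤ ⊙ diagonal (agree₀ n)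
  agree₁ zero = 0ℤ ⊙ product₀
  agree₁ (suc n) = ontotal (agree₁ n) ⊕ diagonal (agree₀ n) ⊕ - 1ℤ ⊙ diagonal (agree₁ n)

  weighted : ∀ {t} n (u v w : ℤ) → Bilinear (Vertex t n)
  weighted n u v w = u ⊙ agreeₙ n ⊕ v ⊙ agree₀ n ⊕ w ⊙ agree₁ n

  sum-linear : ∀ {k} u v w (i d r : Fin k → ℤ) →
    sum (λ a → u * i a + v * d a + w * r a) ≡ u * sum i + v * sum d + w * sum r
  sum-linear u v w i d r = trans (∑-distrib-+ (λ a → u * i a + v * d a) (λ a → w * r a))
    (cong₂ _+_ (trans (∑-distrib-+ (λ a → u * i a) (λ a → v * d a))
                      (cong₂ _+_ (sym (*-distribˡ-sum u i)) (sym (*-distribˡ-sum v d))))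
               (sym (*-distribˡ-sum w r)))

  -- The splitting of functions of one coordinate into constants and functions of sum zero diagonalises weighted; Condition
  -- says that all eigenvalues obtained in this way are nonnegative.
  Condition : ℤ → ℕ → (u v w : ℤ) → Set
  Condition M zero u v w = 0ℤ ≤ u + v
  Condition M (suc n) u v w = Condition M n u (M * v + w) (M * w) × Condition M n u (w - v) (- w)

  module _ {m : ℕ} where
    private
      M t : ℤ
      M = + m
      t = 1ℤ + M

    -- In the first coordinate `f` is its mean plus a part of sum zero; the factor `t` avoids
    -- dividing. There the matrix "all ones minus identity" has eigenvalue `M` on constants and `-1`
    -- on sum zero, which turns `v`, `w` into `M * v + w`, `M * w` and into `w - v`, `- w`.
    weighted-split : ∀ n u v w (f : Vertex (suc m) (suc n) → ℤ) →
      t * form (weighted (suc n) u v w) f f ≡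
      form (weighted n u (M * v + w) (M * w)) (total f) (total f) +
      (t * sum (λ a → form (weighted n u (w - v) (- w)) (f ∘ (a ∷_)) (f ∘ (a ∷_)))
        - form (weighted n u (w - v) (- w)) (total f) (total f))
    weighted-split n u v w f = trans
      (s M u v w (form (diagonal (agreeₙ n)) f f) (form (agreeₙ n) (total f) (total f))
         (form (agree₀ n) (total f) (total f)) (form (diagonal (agree₀ n)) f f)
         (form (agree₁ n) (total f) (total f)) (form (diagonal (agree₁ n)) f f))
      (cong (λ z → form (weighted n u (M * v + w) (M * w)) (total f) (total f) +
                   (t * z - form (weighted n u (w - v) (- w)) (total f) (total f)))
            (sym (sum-linear u (w - v) (- w)
              (λ a → form (agreeₙ n) (f ∘ (a ∷_)) (f ∘ (a ∷_)))
              (λ a → form (agree₀ n) (f ∘ (a ∷_)) (f ∘ (a ∷_)))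
              (λ a → form (agree₁ n) (f ∘ (a ∷_)) (f ∘ (a ∷_))))))
      where
      s : ∀ M u v w SI Is Ds SD Rs SR →
        (1ℤ + M) * (u * SI + v * (Ds + - 1ℤ * SD) + w * (Rs + SD + - 1ℤ * SR)) ≡
        u * Is + (M * v + w) * Ds + M * w * Rs +
        ((1ℤ + M) * (u * SI + (w - v) * SD + - w * SR) - (u * Is + (w - v) * Ds + - w * Rs))
      s = solve-∀

    *-cancel-nonneg : ∀ {i} → 0ℤ ≤ t * i → 0ℤ ≤ i
    *-cancel-nonneg {i} h = *-cancelˡ-≤-pos 0ℤ i (+ suc m) (subst (_≤ t * i) (sym (*-zeroʳ t)) h)

    weighted-nonneg : ∀ n {u v w} → Condition M n u v w → (f : Vertex (suc m) n → ℤ) → 0ℤ ≤ form (weighted n u v w) f f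
    weighted-nonneg zero {u} {v} {w} c f = subst (0ℤ ≤_) (s u v w (f []))
        (*-nonneg c (square (f [])))
      where
      square : ∀ i → 0ℤ ≤ i * i
      square (+ k) = *-nonneg {+ k} (+≤+ z≤n) (+≤+ z≤n)
      square (ℤ.-[1+_] k) = +≤+ z≤n
      s : ∀ u v w x → (u + v) * (x * x) ≡ u * (x * x) + v * (x * x) + w * (0ℤ * (x * x))
      s = solve-∀
    weighted-nonneg (suc n) {u} {v} {w} (c₁ , c₂) f = *-cancel-nonneg (subst (0ℤ ≤_) (sym (weighted-split n u v w f))
      (+-nonneg (weighted-nonneg n c₁ (total f)) (jensen (weighted n u (w - v) (- w)) (weighted-nonneg n c₂) (λ a → f ∘ (a ∷_)))))

    sign : ℕ → ℤ
    sign zero = 1ℤ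
    sign (suc k) = - sign k

    sign-±1 : ∀ k → sign k ≡ 1ℤ ⊎ sign k ≡ - 1ℤ
    sign-±1 zero = inj₁ refl
    sign-±1 (suc k) with sign-±1 k
    ... | inj₁ e = inj₂ (cong -_ e)
    ... | inj₂ e = inj₁ (cong -_ e)

    pos-^ : ∀ k → + (m ℕ.^ k) ≡ M ^ k
    pos-^ zero = refl
    pos-^ (suc k) = trans (pos-* m (m ℕ.^ k)) (cong (M *_) (pos-^ k))

    M^k≥0 : ∀ k → 0ℤ ≤ M ^ k
    M^k≥0 k = subst (0ℤ ≤_) (pos-^ k) (+≤+ z≤n)

    module _ (2≤m : 2 ℕ.≤ m) where
      -- The power at least doubles with each step, the left side grows linearly. For `m = 2` and
      -- exponent 3 it is the equality `9 = 1 + 8`, so `t ≥ 3` enters the spectral argument here.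
      exp-bound : ∀ k → (3 ℕ.+ k) ℕ.* suc m ℕ.≤ 1 ℕ.+ m ℕ.^ (3 ℕ.+ k)
      exp-bound zero = subst (λ m → 3 ℕ.* suc m ℕ.≤ 1 ℕ.+ m ℕ.^ 3) (ℕ.m+[n∸m]≡n 2≤m)
        (subst (3 ℕ.* (3 ℕ.+ d) ℕ.≤_) (s d) (ℕ.m≤m+n _ _))
        where
        d : ℕ
        d = m ℕ.∸ 2
        s : ∀ d → 3 ℕ.* (3 ℕ.+ d) ℕ.+ (9 ℕ.* d ℕ.+ 6 ℕ.* (d ℕ.* d) ℕ.+ d ℕ.* (d ℕ.* d)) ≡
          1 ℕ.+ (2 ℕ.+ d) ℕ.* ((2 ℕ.+ d) ℕ.* ((2 ℕ.+ d) ℕ.* 1))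
        s = ℕS.solve-∀
      exp-bound (suc k) = ℕ.s≤s⁻¹ (begin
        1 ℕ.+ (4 ℕ.+ k) ℕ.* suc m                         ≤⟨ ℕ.m≤m+n _ _ ⟩
        1 ℕ.+ (4 ℕ.+ k) ℕ.* suc m ℕ.+ (m ℕ.+ (1 ℕ.+ k) ℕ.* suc m) ≡⟨ s k m ⟩
        2 ℕ.* ((3 ℕ.+ k) ℕ.* suc m)                       ≤⟨ ℕ.*-monoʳ-≤ 2 (exp-bound k) ⟩
        2 ℕ.* (1 ℕ.+ E)                                   ≡⟨ s′ E ⟩
        2 ℕ.+ 2 ℕ.* E                                     ≤⟨ ℕ.+-monoʳ-≤ 2 (ℕ.*-monoˡ-≤ E 2≤m) ⟩
        2 ℕ.+ m ℕ.* E                                     ∎)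
        where
        open ℕ.≤-Reasoning
        E : ℕ
        E = m ℕ.^ (3 ℕ.+ k)
        s : ∀ k m → 1 ℕ.+ (4 ℕ.+ k) ℕ.* suc m ℕ.+ (m ℕ.+ (1 ℕ.+ k) ℕ.* suc m) ≡ 2 ℕ.* ((3 ℕ.+ k) ℕ.* suc m)
        s = ℕS.solve-∀
        s′ : ∀ E → 2 ℕ.* (1 ℕ.+ E) ≡ 2 ℕ.+ 2 ℕ.* E
        s′ = ℕS.solve-∀

      -- Up to a power of `M`, this is the eigenvalue for `k + 1` nonconstant coordinates under the
      -- weights of `hoffman`. It vanishes for `k = 0` and `k = 1`, and only odd `k ≥ 3` need
      -- `exp-bound`.
      leaf : ∀ k → 0ℤ ≤ M ^ k + sign k * (+ k * t - 1ℤ)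
      leaf zero = +≤+ z≤n
      leaf (suc zero) = ≤-reflexive (s M)
        where
        s : ∀ M → 0ℤ ≡ M * 1ℤ + - 1ℤ * (1ℤ * (1ℤ + M) - 1ℤ)
        s = solve-∀
      leaf (suc (suc zero)) = subst (0ℤ ≤_) (s M)
          (+-nonneg (*-nonneg {M} {M} (+≤+ z≤n) (+≤+ z≤n)) (+≤+ z≤n))
        where
        s : ∀ M → M * M + ((1ℤ + M) + M) ≡ M * (M * 1ℤ) + - - 1ℤ * (+ 2 * (1ℤ + M) - 1ℤ)
        s = solve-∀
      leaf k@(suc (suc (suc k₀))) with sign-±1 k
      ... | inj₁ e = subst (λ z → 0ℤ ≤ M ^ k + z * (+ k * t - 1ℤ)) (sym e)
          (subst (0ℤ ≤_) (s (M ^ k) (+ (2 ℕ.+ k₀)) M)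
            (+-nonneg (M^k≥0 k) (+-nonneg {M} (+≤+ z≤n) (*-nonneg {+ (2 ℕ.+ k₀)} {t} (+≤+ z≤n) (+≤+ z≤n)))))
        where
        s : ∀ E k M → E + (M + k * (1ℤ + M)) ≡ E + 1ℤ * ((1ℤ + k) * (1ℤ + M) - 1ℤ)
        s = solve-∀
      ... | inj₂ e = subst (λ z → 0ℤ ≤ M ^ k + z * (+ k * t - 1ℤ)) (sym e)
          (subst (0ℤ ≤_) (trans (cong₂ (λ y z → 1ℤ + y - z) (pos-^ k) (pos-* k (suc m))) (s (M ^ k) (+ k * t)))
            (i≤j⇒0≤j-i (+≤+ (exp-bound k₀))))
        where
        s : ∀ E k → 1ℤ + E - k ≡ E + - 1ℤ * (k - 1ℤ)
        s = solve-∀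

      -- The state after j constant and k + 1 nonconstant coordinates of the recursion starting in hoffman.
      condition : ∀ r k j n → j ℕ.+ k ℕ.+ r ≡ n → let y = sign (suc k) * M ^ j in
        Condition M r (M ^ n) (y * (1ℤ - + k * t - + r)) (y * M)
      condition zero k j n refl = subst (0ℤ ≤_)
          (trans (s (M ^ j) (M ^ k) (sign k) (+ k) t)
            (cong (_+ sign (suc k) * M ^ j * (1ℤ - + k * t - 0ℤ))
              (trans (sym (^-distribˡ-+-* M j k)) (cong (M ^_) (sym (ℕ.+-identityʳ (j ℕ.+ k)))))))
          (*-nonneg (M^k≥0 j) (leaf k))
        where
        s : ∀ J K σ k t → J * (K + σ * (k * t - 1ℤ)) ≡ J * K + - σ * J * (1ℤ - k * t - 0ℤ)
        s = solve-∀
      condition (suc r) k j n eq =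
          subst₂ (Condition M r (M ^ n)) (s₁ (sign (suc k)) (M ^ j) M (+ k) (+ r)) (s₂ (sign (suc k)) (M ^ j) M)
            (condition r k (suc j) n (trans (sym (ℕ.+-suc (j ℕ.+ k) r)) eq))
        , subst₂ (Condition M r (M ^ n)) (s₃ (sign (suc k)) (M ^ j) M (+ k) (+ r)) (s₄ (sign (suc k)) (M ^ j) M)
            (condition r (suc k) j n (trans (cong (ℕ._+ r) (ℕ.+-suc j k)) (trans (sym (ℕ.+-suc (j ℕ.+ k) r)) eq)))
        where
        s₁ : ∀ σ J M k r → σ * (M * J) * (1ℤ - k * (1ℤ + M) - r) ≡
          M * (σ * J * (1ℤ - k * (1ℤ + M) - (1ℤ + r))) + σ * J * M
        s₁ = solve-∀
        s₂ : ∀ σ J M → σ * (M * J) * M ≡ M * (σ * J * M)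
        s₂ = solve-∀
        s₃ : ∀ σ J M k r → - σ * J * (1ℤ - (1ℤ + k) * (1ℤ + M) - r) ≡
          σ * J * M - σ * J * (1ℤ - k * (1ℤ + M) - (1ℤ + r))
        s₃ = solve-∀
        s₄ : ∀ σ J M → - σ * J * M ≡ - (σ * J * M)
        s₄ = solve-∀

      -- The weights are chosen such that the eigenvalues of levels 1 and 2 vanish.
      hoffman : ∀ n r j (f : Vertex (suc m) r → ℤ) → j ℕ.+ r ≡ suc n →
        0ℤ ≤ t ^ r * form (weighted r (M ^ n) (M ^ j * (t + 1ℤ - + r)) (M ^ j * M)) f f
          - M ^ n * (t * t) * (grand f * grand f)
      hoffman n zero j f eq = ≤-reflexive (trans (s (M ^ n) M (f []))
          (cong (λ z → 1ℤ * (M ^ n * (f [] * f []) + z * (t + 1ℤ - 0ℤ) * (f [] * f []) + z * M * (0ℤ * (f [] * f [])))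
            - M ^ n * (t * t) * (f [] * f [])) (cong (M ^_) (sym (trans (sym (ℕ.+-identityʳ j)) eq)))))
        where
        s : ∀ E M x → 0ℤ ≡ 1ℤ * (E * (x * x) + M * E * (1ℤ + M + 1ℤ - 0ℤ) * (x * x) + M * E * M * (0ℤ * (x * x)))
          - E * ((1ℤ + M) * (1ℤ + M)) * (x * x)
        s = solve-∀
      -- The recursion keeps only the part constant in the first coordinate, so in the end just the
      -- constant function is left, measured by `grand f`. The parts of sum zero are discarded as
      -- nonnegative.
      hoffman n (suc r) j f eq = subst (0ℤ ≤_) final
          (+-nonneg (hoffman n r (suc j) (total f) (trans (sym (ℕ.+-suc j r)) eq))
            (*-nonneg (t^r≥0 r) (jensen (weighted r (M ^ n) (w - v) (- w)) (weighted-nonneg r cond) (λ a → f ∘ (a ∷_)))))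
        where
        v w X Y G : ℤ
        v = M ^ j * (t + 1ℤ - + suc r)
        w = M ^ j * M
        X = form (weighted r (M ^ n) (M * v + w) (M * w)) (total f) (total f)
        Y = t * sum (λ a → form (weighted r (M ^ n) (w - v) (- w)) (f ∘ (a ∷_)) (f ∘ (a ∷_)))
          - form (weighted r (M ^ n) (w - v) (- w)) (total f) (total f)
        G = M ^ n * (t * t) * (grand (total f) * grand (total f))
        t^r≥0 : ∀ r → 0ℤ ≤ t ^ r
        t^r≥0 zero = +≤+ z≤n
        t^r≥0 (suc r) = *-nonneg {t} (+≤+ z≤n) (t^r≥0 r)
        cond : Condition M r (M ^ n) (w - v) (- w)
        cond = subst₂ (Condition M r (M ^ n)) (s₁ (M ^ j) M (+ r)) (s₂ (M ^ j) M)
            (condition r 0 j n (trans (cong (ℕ._+ r) (ℕ.+-identityʳ j)) (ℕ.suc-injective (trans (sym (ℕ.+-suc j r)) eq))))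
          where
          s₁ : ∀ J M r → - 1ℤ * J * (1ℤ - 0ℤ * (1ℤ + M) - r) ≡ J * M - J * (1ℤ + M + 1ℤ - (1ℤ + r))
          s₁ = solve-∀
          s₂ : ∀ J M → - 1ℤ * J * M ≡ - (J * M)
          s₂ = solve-∀
        final : t ^ r * form (weighted r (M ^ n) (M * M ^ j * (t + 1ℤ - + r)) (M * M ^ j * M)) (total f) (total f) - G + t ^ r * Y
          ≡ t * t ^ r * form (weighted (suc r) (M ^ n) v w) f f - G
        final = begin
          t ^ r * form (weighted r (M ^ n) (M * M ^ j * (t + 1ℤ - + r)) (M * M ^ j * M)) (total f) (total f) - G + t ^ r * Y
            ≡⟨ cong₂ (λ v w → t ^ r * form (weighted r (M ^ n) v w) (total f) (total f) - G + t ^ r * Y)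
                 (s₁ (M ^ j) M (+ r)) (s₂ (M ^ j) M) ⟩
          t ^ r * X - G + t ^ r * Y ≡⟨ s₃ (t ^ r) X Y G ⟩
          t ^ r * (X + Y) - G ≡⟨ cong (λ z → t ^ r * z - G) (weighted-split r (M ^ n) v w f) ⟨
          t ^ r * (t * form (weighted (suc r) (M ^ n) v w) f f) - G ≡⟨ s₄ (t ^ r) t (form (weighted (suc r) (M ^ n) v w) f f) G ⟩
          t * t ^ r * form (weighted (suc r) (M ^ n) v w) f f - G ∎
          where
          open ≡-Reasoning
          s₁ : ∀ J M r → M * J * (1ℤ + M + 1ℤ - r) ≡ M * (J * (1ℤ + M + 1ℤ - (1ℤ + r))) + J * M
          s₁ = solve-∀
          s₂ : ∀ J M → M * J * M ≡ M * (J * M)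
          s₂ = solve-∀
          s₃ : ∀ T X Y G → T * X - G + T * Y ≡ T * (X + Y) - G
          s₃ = solve-∀
          s₄ : ∀ T t F G → T * (t * F) - G ≡ t * T * F - G
          s₄ = solve-∀

  sum-pos : ∀ {k} (f : Fin k → ℕ) → sum (λ a → + f a) ≡ + ℕΣ.sum f
  sum-pos {zero} f = refl
  sum-pos {suc k} f = cong (_+_ (+ f zero)) (sum-pos (f ∘ suc))

  agreements : ∀ {t n} → Vertex t n → Vertex t n → ℕ
  agreements [] [] = 0
  agreements (a ∷ x) (b ∷ y) = ⟦ does (a ≟ b) ⟧ ℕ.+ agreements x y

  module _ {m : ℕ} where
    private
      t : ℕ
      t = suc m

    VanishBelow : ∀ {n} → ℕ → (f g : Vertex t n → ℤ) → Set
    VanishBelow k f g = ∀ x y → agreements x y ℕ.< k → f x * g y ≡ 0ℤ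

    vanish-off : ∀ {n k} {f g : Vertex t (suc n) → ℤ} {a b} → a ≢ b → VanishBelow k f g →
      VanishBelow k (f ∘ (a ∷_)) (g ∘ (b ∷_))
    vanish-off {k = k} {a = a} {b} a≢b h x y lt = h (a ∷ x) (b ∷ y) lt′
      where
      lt′ : ⟦ does (a ≟ b) ⟧ ℕ.+ agreements x y ℕ.< k
      lt′ with a ≟ b
      ... | yes a≡b = ⊥-elim (a≢b a≡b)
      ... | no _ = lt

    vanish-diag : ∀ {n k} {f g : Vertex t (suc n) → ℤ} a → VanishBelow (suc k) f g →
      VanishBelow k (f ∘ (a ∷_)) (g ∘ (a ∷_))
    vanish-diag {k = k} a h x y lt = h (a ∷ x) (a ∷ y) lt′
      where
      lt′ : ⟦ does (a ≟ a) ⟧ ℕ.+ agreements x y ℕ.< suc k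
      lt′ with a ≟ a
      ... | yes _ = s≤s lt
      ... | no _ = ℕ.m<n⇒m<1+n lt

    ontotal-diagonal : ∀ {n} (A : Bilinear (Vertex t n)) (f g : Vertex t (suc n) → ℤ) →
      (∀ a b → a ≢ b → form A (f ∘ (a ∷_)) (g ∘ (b ∷_)) ≡ 0ℤ) →
      form (ontotal A) f g ≡ form (diagonal A) f g
    ontotal-diagonal A f g off = trans (sumˡ A (λ a → f ∘ (a ∷_)) (total g)) (sum-cong-≗ λ a →
      trans (sumʳ A (f ∘ (a ∷_)) (λ b → g ∘ (b ∷_)))
      (trans (sum-remove {i = a} (λ b → form A (f ∘ (a ∷_)) (g ∘ (b ∷_))))
      (trans (cong (_+_ (form A (f ∘ (a ∷_)) (g ∘ (a ∷_))))
          (trans (sum-cong-≗ (λ b → off a (punchIn a b) (punchInᵢ≢i a b ∘ sym))) (sum-replicate-zero m)))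
        (+-identityʳ (form A (f ∘ (a ∷_)) (g ∘ (a ∷_)))))))

    -- Blocks with different first values gain no agreement there and vanish by induction. Hence
    -- `ontotal` collapses to `diagonal`, which `agree₀` subtracts.
    agree₀-vanish : ∀ {n} (f g : Vertex t n → ℤ) → VanishBelow 1 f g → form (agree₀ n) f g ≡ 0ℤ
    agree₀-vanish {zero} f g h = h [] [] z<s
    agree₀-vanish {suc n} f g h = trans
      (cong (_+ - 1ℤ * d) (ontotal-diagonal (agree₀ n) f g λ a b a≢b → agree₀-vanish _ _ (vanish-off {f = f} {g} a≢b h)))
      (s d)
      where
      d : ℤ
      d = form (diagonal (agree₀ n)) f g
      s : ∀ d → d + - 1ℤ * d ≡ 0ℤ
      s = solve-∀

    agree₁-vanish : ∀ {n} (f g : Vertex t n → ℤ) → VanishBelow 2 f g → form (agree₁ n) f g ≡ 0ℤ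
    agree₁-vanish {zero} f g h = refl
    agree₁-vanish {suc n} f g h = trans
      (cong₂ (λ y z → y + z + - 1ℤ * d)
        (ontotal-diagonal (agree₁ n) f g λ a b a≢b → agree₁-vanish _ _ (vanish-off {f = f} {g} a≢b h))
        (trans (sum-cong-≗ {t} λ a → agree₀-vanish (f ∘ (a ∷_)) (g ∘ (a ∷_)) (vanish-diag {f = f} {g} a h)) (sum-replicate-zero t)))
      (s d)
      where
      d : ℤ
      d = form (diagonal (agree₁ n)) f g
      s : ∀ d → d + 0ℤ + - 1ℤ * d ≡ 0ℤ
      s = solve-∀

    indicator : ∀ {n} → VSet t n → Vertex t n → ℤ
    indicator A x = + ⟦ A x ⟧

    agreeₙ-indicator : ∀ {n} (A : VSet t n) → form (agreeₙ n) (indicator A) (indicator A) ≡ + cnt A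
    agreeₙ-indicator {zero} A with A []
    ... | true = refl
    ... | false = refl
    agreeₙ-indicator {suc n} A = trans (sum-cong-≗ λ a → agreeₙ-indicator (A ∘ (a ∷_))) (sum-pos λ a → cnt (A ∘ (a ∷_)))

    grand-indicator : ∀ {n} (A : VSet t n) → grand (indicator A) ≡ + cnt A
    grand-indicator {zero} A = refl
    grand-indicator {suc n} A = trans (grand-sum λ a → indicator (A ∘ (a ∷_)))
      (trans (sum-cong-≗ λ a → grand-indicator (A ∘ (a ∷_))) (sum-pos λ a → cnt (A ∘ (a ∷_))))

    -- On the indicator of `A` the forms `agree₀` and `agree₁` vanish, so in dimension `n + 1`, with
    -- `c = cnt A`, `hoffman` reads `m^n t² c² ≤ t^(n+1) m^n c`. The empty set is set apart because
    -- `m^n c` is cancelled.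
    two-intersecting : 2 ℕ.≤ m → ∀ {n} (A : VSet t n) →
      (∀ x y → A x ≡ true → A y ≡ true → 2 ℕ.≤ agreements x y) → t ℕ.* t ℕ.* cnt A ℕ.≤ t ℕ.^ n
    two-intersecting 2≤m {zero} A h with A [] in eq
    ... | false = subst (ℕ._≤ 1) (sym (ℕ.*-zeroʳ (t ℕ.* t))) z≤n
    ... | true with () ← h [] [] eq eq
    two-intersecting 2≤m {suc n} A h with cnt A in c≡
    ... | zero = subst (ℕ._≤ t ℕ.^ suc n) (sym (ℕ.*-zeroʳ (t ℕ.* t))) z≤n
    ... | suc c₀ = drop‿+≤+ (0≤i-j⇒j≤i (*-cancelˡ-≤-pos 0ℤ _ (+ e) {{pos}} (subst₂ _≤_ (sym (*-zeroʳ (+ e))) eq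
            (hoffman 2≤m n (suc n) 0 f refl))))
      where
      c e : ℕ
      c = suc c₀
      e = m ℕ.^ n ℕ.* c
      pos : ℤ.Positive (+ e)
      pos = ℤ.positive (ℤ.+<+ (ℕ.*-mono-≤ (ℕ.m^n>0 m {{ℕ.>-nonZero (ℕ.≤-trans (s≤s z≤n) 2≤m)}} n) (s≤s z≤n)))
      f : Vertex t (suc n) → ℤ
      f = indicator A
      vanish : VanishBelow 2 f f
      vanish x y lt with A x in ax | A y in ay
      ... | false | _ = refl
      ... | true | false = refl
      ... | true | true = ⊥-elim (ℕ.<⇒≱ lt (h x y ax ay))
      M v w : ℤ
      M = + m
      v = 1ℤ * (+ t + 1ℤ - + suc n)
      w = 1ℤ * M
      eq : (+ t) ^ suc n * form (weighted (suc n) (M ^ n) v w) f f - M ^ n * (+ t * + t) * (grand f * grand f) ≡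
        + e * (+ (t ℕ.^ suc n) - + (t ℕ.* t ℕ.* c))
      eq = begin
        _ ≡⟨ cong₂ (λ y z → (+ t) ^ suc n * y - M ^ n * (+ t * + t) * (z * z))
               (trans (cong₂ (λ y z → M ^ n * form (agreeₙ (suc n)) f f + v * y + w * z)
                        (agree₀-vanish f f λ x y lt → vanish x y (ℕ.m<n⇒m<1+n lt)) (agree₁-vanish f f vanish))
                      (cong (λ z → M ^ n * z + v * 0ℤ + w * 0ℤ) (trans (agreeₙ-indicator A) (cong +_ c≡))))
               (trans (grand-indicator A) (cong +_ c≡)) ⟩
        (+ t) ^ suc n * (M ^ n * + c + v * 0ℤ + w * 0ℤ) - M ^ n * (+ t * + t) * (+ c * + c)
          ≡⟨ s ((+ t) ^ suc n) (M ^ n) (+ c) v w (+ t) ⟩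
        M ^ n * + c * ((+ t) ^ suc n - + t * + t * + c)
          ≡⟨ cong₂ (λ y z → y * + c * (z - + t * + t * + c)) (pos-^ {m} n) (pos-^ {t} (suc n)) ⟨
        + (m ℕ.^ n) * + c * (+ (t ℕ.^ suc n) - + t * + t * + c)
          ≡⟨ cong₂ (λ y z → y * (+ (t ℕ.^ suc n) - z)) (pos-* (m ℕ.^ n) c)
               (trans (pos-* (t ℕ.* t) c) (cong (_* + c) (pos-* t t))) ⟨
        + e * (+ (t ℕ.^ suc n) - + (t ℕ.* t ℕ.* c)) ∎
        where
        open ≡-Reasoning
        s : ∀ T E c v w t → T * (E * c + v * 0ℤ + w * 0ℤ) - E * (t * t) * (c * c) ≡ E * c * (T - t * t * c)
        s = solve-∀

-- Compressions along an involution.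

module Shifting where
  open import Data.Nat hiding (_≟_)
  open import Data.Nat.Properties hiding (_≟_)
  open import Data.Bool using (true; false; not; _∧_; _∨_; if_then_else_)
  open import Data.Fin using (Fin; zero; suc; punchIn; _≟_)
  open import Data.Fin.Properties using (punchInᵢ≢i)
  open import Data.Vec using (_∷_; lookup; insertAt)
  open import Data.Vec.Properties using (insertAt-lookup)
  open import Data.Product using (_×_; _,_)
  open import Data.Sum using (_⊎_; inj₁; inj₂)
  open import Data.Empty using (⊥; ⊥-elim)
  open import Function using (_∘_; id)
  open import Relation.Nullary using (does; ¬_)
  open import Relation.Nullary.Decidable using (dec-true; dec-false)
  open import Relation.Binary.PropositionalEquality
  open import Algebra.Properties.CommutativeMonoid.Sum +-0-commutativeMonoid using (sum; sum-cong-≗; sum-remove; sum-replicate-zero)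
  open Counting

  private variable
    t n : ℕ

  dictator : Fin n → Fin t → VSet t n
  dictator i a x = does (lookup x i ≟ a)

  off : Fin n → Fin t → VSet t n → ℕ
  off i a I = cnt (I ∖ dictator i a)

  _∩_ : VSet t n → VSet t n → VSet t n
  (A ∩ B) x = A x ∧ B x

  cnt-∩-dictator : ∀ i a (I : VSet (suc t) (suc n)) → cnt (I ∩ dictator i a) ≡ cnt (slice i a I)
  cnt-∩-dictator {t} {n} i a I = begin
    cnt (I ∩ dictator i a)                                ≡⟨ cnt-slices i (I ∩ dictator i a) ⟩
    sum (λ b → cnt (slice i b (I ∩ dictator i a)))        ≡⟨ sum-remove {i = a} (λ b → cnt (slice i b (I ∩ dictator i a))) ⟩
    cnt (slice i a (I ∩ dictator i a)) + sum (λ b → cnt (slice i (punchIn a b) (I ∩ dictator i a)))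
      ≡⟨ cong₂ _+_ (cnt-cong on) (trans (sum-cong-≗ λ b → trans (cnt-cong (away b)) (cnt-empty {suc t} {n}))
           (sum-replicate-zero t)) ⟩
    cnt (slice i a I) + 0                                 ≡⟨ +-identityʳ _ ⟩
    cnt (slice i a I) ∎
    where
    open ≡-Reasoning
    on : ∀ x → slice i a (I ∩ dictator i a) x ≡ slice i a I x
    on x rewrite insertAt-lookup x i a | dec-true (a ≟ a) refl with slice i a I x
    ... | true = refl
    ... | false = refl
    away : ∀ b x → slice i (punchIn a b) (I ∩ dictator i a) x ≡ false
    away b x rewrite insertAt-lookup x i (punchIn a b) | dec-false (punchIn a b ≟ a) (punchInᵢ≢i a b)
      with slice i (punchIn a b) I x
    ... | true = refl
    ... | false = refl

  cnt-dictator : ∀ i a (I : VSet (suc t) (suc n)) → cnt I ≡ cnt (slice i a I) + off i a I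
  cnt-dictator i a I = trans (cnt-split I (dictator i a)) (cong (_+ off i a I) (cnt-∩-dictator i a I))

  off-slices : ∀ i a (I : VSet (suc t) (suc n)) → off i a I ≡ sum (λ b → cnt (slice i (punchIn a b) I))
  off-slices i a I = +-cancelˡ-≡ (cnt (slice i a I)) _ _ (trans (sym (cnt-dictator i a I))
    (trans (cnt-slices i I) (sum-remove {i = a} (λ b → cnt (slice i b I)))))

  adjacent-insertAt : ∀ i {a b} {x y : Vertex t n} → a ≢ b → Adjacent x y → Adjacent (insertAt x i a) (insertAt y i b)
  adjacent-insertAt zero a≢b adj zero = a≢b
  adjacent-insertAt zero a≢b adj (suc k) = adj k
  adjacent-insertAt (suc i) {x = _ ∷ _} {_ ∷ _} a≢b adj zero = adj zero
  adjacent-insertAt (suc i) {x = _ ∷ _} {_ ∷ _} a≢b adj (suc k) = adjacent-insertAt i a≢b (adj ∘ suc) k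

  cross-slices : ∀ {I : VSet t (suc n)} i {a b} → a ≢ b → Independent I → CrossIndependent (slice i a I) (slice i b I)
  cross-slices i a≢b ind x y Ix Iy adj = ind _ _ Ix Iy (adjacent-insertAt i a≢b adj)

  -- Common form of both compressions: an element `x` of `source` is replaced by `σ x` whenever that
  -- place is free.
  record Move (t n : ℕ) : Set where
    field
      σ : Vertex t n → Vertex t n
      source : VSet t n
      involutive : ∀ x → σ (σ x) ≡ x
      source-σ : ∀ x → source x ≡ true → source (σ x) ≡ false
      cnt-σ : ∀ f → cnt (f ∘ σ) ≡ cnt f

    shift : VSet t n → VSet t n
    shift I x = if source x then I x ∧ I (σ x) else (if source (σ x) then I x ∨ I (σ x) else I x)

    moved : VSet t n → VSet t n
    moved I x = source x ∧ (I x ∧ not (I (σ x)))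

    cnt-shift : ∀ I → cnt (shift I) ≡ cnt I
    cnt-shift I = +-cancelʳ-≡ (cnt (moved I)) _ _ (trans (cnt-add pointwise) (cong (cnt I +_) (cnt-σ (moved I))))
      where
      pointwise : ∀ x → ⟦ shift I x ⟧ + ⟦ moved I x ⟧ ≡ ⟦ I x ⟧ + ⟦ moved I (σ x) ⟧
      pointwise x rewrite involutive x with source x | source (σ x) | I x | I (σ x) | source-σ x
      ... | false | false | false | _     | _ = refl
      ... | false | false | true  | _     | _ = refl
      ... | false | true  | false | false | _ = refl
      ... | false | true  | false | true  | _ = refl
      ... | false | true  | true  | false | _ = refl
      ... | false | true  | true  | true  | _ = refl
      ... | true  | false | false | _     | _ = refl
      ... | true  | false | true  | false | _ = refl
      ... | true  | false | true  | true  | _ = refl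
      ... | true  | true  | _     | _     | h with () ← h refl

    off-invariant : ∀ I J → (∀ x → J (σ x) ≡ J x) → cnt (shift I ∖ J) ≡ cnt (I ∖ J)
    off-invariant I J inv = trans (cnt-cong pointwise) (cnt-shift (I ∖ J))
      where
      pointwise : ∀ x → (shift I ∖ J) x ≡ shift (I ∖ J) x
      pointwise x rewrite inv x with source x | source (σ x) | I x | I (σ x) | J x
      ... | false | false | false | _ | _ = refl
      ... | false | false | true  | _ | _ = refl
      ... | false | true  | false | false | _ = refl
      ... | false | true  | false | true  | _ = refl
      ... | false | true  | true  | false | true = refl
      ... | false | true  | true  | true | true = refl
      ... | false | true  | true  | false | false = refl
      ... | false | true  | true  | true | false = refl
      ... | true | _ | false | _ | _ = refl
      ... | true | _ | true | false | true = refl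
      ... | true | _ | true | false | false = refl
      ... | true | _ | true | true | true = refl
      ... | true | _ | true | true | false = refl

    -- Every moved point passes from outside `J` into `J`. The exact loss makes `off` a measure that
    -- drops with each effective compression.
    off-decrease : ∀ I J → (∀ x → source x ≡ true → J x ≡ false) → (∀ x → source (σ x) ≡ true → J x ≡ true) →
      cnt (shift I ∖ J) + cnt (moved I) ≡ cnt (I ∖ J)
    off-decrease I J out into = trans (cnt-add pointwise) (trans (cong (cnt (I ∖ J) +_) (cnt-empty {t} {n})) (+-identityʳ _))
      where
      pointwise : ∀ x → ⟦ (shift I ∖ J) x ⟧ + ⟦ moved I x ⟧ ≡ ⟦ (I ∖ J) x ⟧ + ⟦ false ⟧
      pointwise x with source x | source (σ x) | I x | I (σ x) | J x | out x | into x
      ... | true | _ | _ | _ | true | h | _ with () ← h refl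
      pointwise x | true | _ | false | _ | false | _ | _ = refl
      pointwise x | true | _ | true | false | false | _ | _ = refl
      pointwise x | true | _ | true | true | false | _ | _ = refl
      pointwise x | false | true | _ | _ | false | _ | h with () ← h refl
      pointwise x | false | true | false | false | true | _ | _ = refl
      pointwise x | false | true | false | true | true | _ | _ = refl
      pointwise x | false | true | true | _ | true | _ | _ = refl
      pointwise x | false | false | false | _ | _ | _ | _ = refl
      pointwise x | false | false | true | _ | _ | _ | _ = refl

    off-increase : ∀ I J → (∀ x → source x ≡ true → J x ≡ true) → cnt (I ∖ J) ≤ cnt (shift I ∖ J)
    off-increase I J within = cnt-mono pointwise
      where
      pointwise : ∀ x → (I ∖ J) x ≡ true → (shift I ∖ J) x ≡ true
      pointwise x with source x | source (σ x) | I x | I (σ x) | J x | within x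
      ... | true | _ | true | _ | false | h = λ _ → ⊥-elim (false≢true (h refl))
        where
        false≢true : false ≢ true
        false≢true ()
      ... | true | _ | true | _ | true | _ = λ ()
      ... | true | _ | false | _ | _ | _ = λ ()
      ... | false | true | true | _ | _ | _ = id
      ... | false | true | false | _ | _ | _ = λ ()
      ... | false | false | true | _ | _ | _ = id
      ... | false | false | false | _ | _ | _ = λ ()

    shift⁻ : ∀ I x → shift I x ≡ true → I x ≡ true ⊎ (source (σ x) ≡ true × I (σ x) ≡ true)
    shift⁻ I x with source x | source (σ x) | I x | I (σ x)
    ... | true | _ | true | _ = λ _ → inj₁ refl
    ... | true | _ | false | _ = λ ()
    ... | false | true | true | _ = λ _ → inj₁ refl
    ... | false | true | false | true = λ _ → inj₂ (refl , refl)
    ... | false | true | false | false = λ ()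
    ... | false | false | true | _ = λ _ → inj₁ refl
    ... | false | false | false | _ = λ ()

    shift-source : ∀ I x → shift I x ≡ true → source x ≡ true → I (σ x) ≡ true
    shift-source I x with source x | I x | I (σ x)
    ... | true | true | true = λ _ _ → refl
    ... | true | true | false = λ ()
    ... | true | false | _ = λ ()
    ... | false | _ | _ = λ _ ()

    module _ (_~_ : Vertex t n → Vertex t n → Set)
      (~-sym : ∀ {x y} → x ~ y → y ~ x)
      (~-σ : ∀ {x y} → x ~ y → σ x ~ σ y)
      (targets : ∀ {x y} → source (σ x) ≡ true → source (σ y) ≡ true → ¬ (x ~ y))
      (one-sided : ∀ {x y} → source (σ x) ≡ true → source y ≡ false → x ~ y → σ x ~ y) where

      -- The new point `x` stands for `σ x` in `I`. If `y` is a source, it stayed only because `σ y`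
      -- is in `I` too, and `σ` carries the relation over to both images; otherwise `one-sided`
      -- relates `σ x` to `y`.
      shift-added : ∀ I → (∀ x y → I x ≡ true → I y ≡ true → ¬ (x ~ y)) → ∀ x y →
        source (σ x) ≡ true → I (σ x) ≡ true → I y ≡ true → shift I y ≡ true → ¬ (x ~ y)
      shift-added I ind x y tx Iσx Iy Sy x~y = by-source (source y) refl
        where
        by-source : ∀ b → source y ≡ b → ⊥
        by-source true  sy = ind (σ x) (σ y) Iσx (shift-source I y Sy sy) (~-σ x~y)
        by-source false sy = ind (σ x) y Iσx Iy (one-sided tx sy x~y)

      shift-preserves : ∀ I → (∀ x y → I x ≡ true → I y ≡ true → ¬ (x ~ y)) →
        ∀ x y → shift I x ≡ true → shift I y ≡ true → ¬ (x ~ y)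
      shift-preserves I ind x y Sx Sy x~y with shift⁻ I x Sx | shift⁻ I y Sy
      ... | inj₁ Ix         | inj₁ Iy         = ind x y Ix Iy x~y
      ... | inj₂ (tx , _)   | inj₂ (ty , _)   = targets tx ty x~y
      ... | inj₂ (tx , Iσx) | inj₁ Iy         = shift-added I ind x y tx Iσx Iy Sy x~y
      ... | inj₁ Ix         | inj₂ (ty , Iσy) = shift-added I ind y x ty Iσy Ix Sx (~-sym x~y)

    stable : ∀ I → cnt (moved I) ≡ 0 → ∀ x → source x ≡ true → I x ≡ true → I (σ x) ≡ true
    stable I none x sx Ix with cnt≡0 none x
    ... | e rewrite sx | Ix with I (σ x)
    ... | true = refl

-- Compression of values towards 0 and of coordinates towards the first.

module Moves where
  open import Data.Nat hiding (_≟_)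
  open import Data.Nat.Properties hiding (_≟_)
  open import Data.Bool using (true; false; not; _∧_; if_then_else_)
  open import Data.Fin using (Fin; zero; suc; _≟_)
  open import Data.Fin.Permutation using (permutation)
  open import Data.Vec using (_∷_; lookup; insertAt; updateAt; _[_]≔_)
  open import Data.Vec.Properties using (insertAt-lookup; lookup∘updateAt; lookup∘updateAt′; lookup∘update; lookup∘update′; updateAt-updateAt; updateAt-id-local; updateAt-cong-local; []≔-lookup; []≔-idempotent)
  open import Data.Product using (_×_; _,_; proj₁; proj₂)
  open import Data.Sum using (_⊎_; [_,_]′)
  open import Data.Empty using (⊥-elim)
  open import Function using (_∘_; id)
  open import Relation.Nullary using (yes; no; does; ¬_)
  open import Relation.Nullary.Decidable using (dec-true; dec-false)
  open import Relation.Binary.PropositionalEquality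
  open import Algebra.Properties.CommutativeMonoid.Sum +-0-commutativeMonoid using (sum; sum-cong-≗; ∑-comm; sum-permute)
  open Counting
  open Shifting

  private variable
    t n : ℕ

  ≟-true : ∀ {a b : Fin n} → does (a ≟ b) ≡ true → a ≡ b
  ≟-true {a = a} {b} h with a ≟ b
  ... | yes e = e

  ≟-false : ∀ {a b : Fin n} → does (a ≟ b) ≡ false → a ≢ b
  ≟-false {a = a} {b} h with a ≟ b
  ... | no ne = ne

  swap₀ : Fin t → Fin (suc t) → Fin (suc t)
  swap₀ j zero = suc j
  swap₀ j (suc k) = if does (k ≟ j) then zero else suc k

  swap₀-same : (j : Fin t) → swap₀ j (suc j) ≡ zero
  swap₀-same j rewrite dec-true (j ≟ j) refl = refl

  swap₀-other : ∀ {j : Fin t} {a} → a ≢ zero → a ≢ suc j → swap₀ j a ≡ a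
  swap₀-other {a = zero} a≢0 _ = ⊥-elim (a≢0 refl)
  swap₀-other {j = j} {suc k} _ a≢j rewrite dec-false (k ≟ j) (a≢j ∘ cong suc) = refl

  swap₀-involutive : (j : Fin t) → ∀ a → swap₀ j (swap₀ j a) ≡ a
  swap₀-involutive j zero = swap₀-same j
  swap₀-involutive j (suc k) with k ≟ j
  ... | yes refl = refl
  ... | no k≢j = swap₀-other (λ ()) (k≢j ∘ λ { refl → refl })

  swap₀-injective : (j : Fin t) → ∀ {a b} → swap₀ j a ≡ swap₀ j b → a ≡ b
  swap₀-injective j {a} {b} e = trans (sym (swap₀-involutive j a)) (trans (cong (swap₀ j) e) (swap₀-involutive j b))

  swap₀-target : ∀ {j : Fin t} {a} → swap₀ j a ≡ suc j → a ≡ zero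
  swap₀-target {j = j} {a} e = swap₀-injective j e

  updateAt-insertAt : ∀ (f : Fin t → Fin t) (x : Vertex t n) i a → updateAt (insertAt x i a) i f ≡ insertAt x i (f a)
  updateAt-insertAt f x zero a = refl
  updateAt-insertAt f (b ∷ x) (suc i) a = cong (b ∷_) (updateAt-insertAt f x i a)

  module _ (i : Fin (suc n)) (j : Fin t) where
    open Move

    private
      σᵥ : Vertex (suc t) (suc n) → Vertex (suc t) (suc n)
      σᵥ x = updateAt x i (swap₀ j)

      σᵥ-at : ∀ x → lookup (σᵥ x) i ≡ swap₀ j (lookup x i)
      σᵥ-at x = lookup∘updateAt i x

      σᵥ-away : ∀ {k} → k ≢ i → ∀ x → lookup (σᵥ x) k ≡ lookup x k
      σᵥ-away {k} k≢i x = lookup∘updateAt′ k i k≢i x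

    valueMove : Move (suc t) (suc n)
    valueMove .σ = σᵥ
    valueMove .source = dictator i (suc j)
    valueMove .involutive x = trans (updateAt-updateAt i x) (updateAt-id-local i x (swap₀-involutive j (lookup x i)))
    valueMove .source-σ x sx = dec-false (lookup (σᵥ x) i ≟ suc j) λ e → contra
      (trans (sym e) (trans (σᵥ-at x) (trans (cong (swap₀ j) (≟-true {a = lookup x i} sx)) (swap₀-same j))))
      where
      contra : suc j ≢ zero
      contra ()
    valueMove .cnt-σ f = begin
      cnt (f ∘ σᵥ)                                  ≡⟨ cnt-slices i (f ∘ σᵥ) ⟩
      sum (λ a → cnt (slice i a (f ∘ σᵥ)))          ≡⟨ sum-cong-≗ (λ a → cnt-cong λ x → cong f (updateAt-insertAt (swap₀ j) x i a)) ⟩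
      sum (λ a → cnt (slice i (swap₀ j a) f))       ≡⟨ sum-permute (λ a → cnt (slice i a f))
                                                         (permutation (swap₀ j) (swap₀ j) (swap₀-involutive j) (swap₀-involutive j)) ⟨
      sum (λ a → cnt (slice i a f))                 ≡⟨ cnt-slices i f ⟨
      cnt f ∎
      where open ≡-Reasoning

    value-target : ∀ x → dictator i (suc j) (σᵥ x) ≡ true → lookup x i ≡ zero
    value-target x h = swap₀-target (trans (sym (σᵥ-at x)) (≟-true h))

    valueMove-independent : ∀ I → Independent I → Independent (shift valueMove I)
    valueMove-independent = shift-preserves valueMove Adjacent (λ adj k → adj k ∘ sym)
      (λ {x} {y} → adj-σ {x} {y})
      (λ {x} {y} tx ty adj → adj i (trans (value-target x tx) (sym (value-target y ty))))
      (λ {x} {y} → one {x} {y})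
      where
      adj-σ : ∀ {x y} → Adjacent x y → Adjacent (σᵥ x) (σᵥ y)
      adj-σ {x} {y} adj k e with k ≟ i
      ... | yes refl = adj i (swap₀-injective j (trans (sym (σᵥ-at x)) (trans e (σᵥ-at y))))
      ... | no k≢i = adj k (trans (sym (σᵥ-away k≢i x)) (trans e (σᵥ-away k≢i y)))
      one : ∀ {x y} → dictator i (suc j) (σᵥ x) ≡ true → dictator i (suc j) y ≡ false → Adjacent x y → Adjacent (σᵥ x) y
      one {x} {y} tx sy adj k e with k ≟ i
      ... | yes refl = ≟-false sy (trans (sym e) (≟-true tx))
      ... | no k≢i = adj k (trans (sym (σᵥ-away k≢i x)) e)

    valueMove-off : ∀ I k a → a ≢ zero ⊎ k ≢ i → off k a I ≤ off k a (shift valueMove I)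
    valueMove-off I k a h with k ≟ i
    ... | no k≢i = ≤-reflexive (sym (off-invariant valueMove I (dictator k a)
          λ x → cong (λ b → does (b ≟ a)) (σᵥ-away k≢i x)))
    ... | yes refl with a ≟ suc j
    ...   | yes refl = off-increase valueMove I (dictator k a) λ _ → id
    ...   | no a≢j = ≤-reflexive (sym (off-invariant valueMove I (dictator k a) inv))
      where
      a≢0 : a ≢ zero
      a≢0 = [ id , (λ p → ⊥-elim (p refl)) ]′ h
      inv : ∀ x → dictator k a (σᵥ x) ≡ dictator k a x
      inv x rewrite σᵥ-at x with lookup x i ≟ a
      ... | yes refl rewrite swap₀-other a≢0 a≢j = dec-true (a ≟ a) refl
      ... | no ne = dec-false (_ ≟ a) λ e → ne (swap₀-injective j (trans e (sym (swap₀-other a≢0 a≢j))))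

    valueMove-off₀ : ∀ I → off i zero (shift valueMove I) + cnt (moved valueMove I) ≡ off i zero I
    valueMove-off₀ I = off-decrease valueMove I (dictator i zero)
      (λ x sx → dec-false (lookup x i ≟ zero) λ e → contra (trans (sym (≟-true sx)) e))
      (λ x tx → dec-true (lookup x i ≟ zero) (value-target x tx))
      where
      contra : suc j ≢ zero
      contra ()

    valueMove-off-other : ∀ I k → k ≢ i → off k zero (shift valueMove I) ≡ off k zero I
    valueMove-off-other I k k≢i = off-invariant valueMove I (dictator k zero)
      λ x → cong (λ b → does (b ≟ zero)) (σᵥ-away k≢i x)

    valueMove-stable : ∀ I → cnt (moved valueMove I) ≡ 0 → ∀ x → lookup x i ≡ suc j → I x ≡ true → I (x [ i ]≔ zero) ≡ true
    valueMove-stable I none x e Ix = subst (λ y → I y ≡ true) eq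
      (stable valueMove I none x (dec-true (lookup x i ≟ suc j) e) Ix)
      where
      eq : σᵥ x ≡ x [ i ]≔ zero
      eq = updateAt-cong-local i x (trans (cong (swap₀ j) e) (swap₀-same j))

  cnt-swap : (f : VSet t (suc n)) (j : Fin n) → sum (λ a → cnt (λ x → f (lookup x j ∷ (x [ j ]≔ a)))) ≡ cnt f
  cnt-swap {n = suc n} f j = begin
    sum (λ a → cnt (λ x → f (lookup x j ∷ (x [ j ]≔ a))))
      ≡⟨ sum-cong-≗ (λ a → trans (cnt-slices j (λ x → f (lookup x j ∷ (x [ j ]≔ a))))
           (sum-cong-≗ λ b → cnt-cong λ x →
             cong₂ (λ y z → f (y ∷ z)) (insertAt-lookup x j b) (updateAt-insertAt (λ _ → a) x j b))) ⟩
    sum (λ a → sum (λ b → cnt (slice j a (f ∘ (b ∷_))))) ≡⟨ ∑-comm (λ a b → cnt (slice j a (f ∘ (b ∷_)))) ⟩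
    sum (λ b → sum (λ a → cnt (slice j a (f ∘ (b ∷_))))) ≡⟨ sum-cong-≗ (λ b → cnt-slices j (f ∘ (b ∷_))) ⟨
    cnt f ∎
    where open ≡-Reasoning

  Disjoint₀ : Vertex (suc t) n → Vertex (suc t) n → Set
  Disjoint₀ x y = ∀ k → ¬ (lookup x k ≡ zero × lookup y k ≡ zero)

  -- Stronger than `Independent`; value-stable independent sets have it.
  Intersecting₀ : VSet (suc t) n → Set
  Intersecting₀ I = ∀ x y → I x ≡ true → I y ≡ true → ¬ Disjoint₀ x y

  module _ (j : Fin n) where
    open Move

    private
      σ꜀ : Vertex (suc t) (suc n) → Vertex (suc t) (suc n)
      σ꜀ (a ∷ x) = lookup x j ∷ (x [ j ]≔ a)

      D : VSet (suc t) (suc n)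
      D x = not (dictator zero zero x) ∧ dictator (suc j) zero x

      D-true : ∀ (x : Vertex (suc t) (suc n)) → D x ≡ true → lookup x zero ≢ zero × lookup x (suc j) ≡ zero
      D-true x h with lookup x zero ≟ zero | lookup x (suc j) ≟ zero
      ... | no ne | yes e = ne , e

      true-D : ∀ (x : Vertex (suc t) (suc n)) → lookup x zero ≢ zero → lookup x (suc j) ≡ zero → D x ≡ true
      true-D x ne e with lookup x zero ≟ zero | lookup x (suc j) ≟ zero
      ... | no _ | yes _ = refl
      ... | yes e₀ | _ = ⊥-elim (ne e₀)
      ... | no _ | no ne′ = ⊥-elim (ne′ e)

      σ꜀-0 : ∀ (x : Vertex (suc t) (suc n)) → lookup (σ꜀ x) zero ≡ lookup x (suc j)
      σ꜀-0 (a ∷ x) = refl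

      σ꜀-j : ∀ (x : Vertex (suc t) (suc n)) → lookup (σ꜀ x) (suc j) ≡ lookup x zero
      σ꜀-j (a ∷ x) = lookup∘update j x a

      σ꜀-away : ∀ {k} → k ≢ j → ∀ (x : Vertex (suc t) (suc n)) → lookup (σ꜀ x) (suc k) ≡ lookup x (suc k)
      σ꜀-away k≢j (a ∷ x) = lookup∘update′ k≢j x a

      target : ∀ (x : Vertex (suc t) (suc n)) → D (σ꜀ x) ≡ true → lookup x (suc j) ≢ zero × lookup x zero ≡ zero
      target x h = let (p , q) = D-true (σ꜀ x) h in p ∘ trans (σ꜀-0 x) , trans (sym (σ꜀-j x)) q

    coordinateMove : Move (suc t) (suc n)
    coordinateMove .σ = σ꜀
    coordinateMove .source = D
    coordinateMove .involutive (a ∷ x) = cong₂ _∷_ (lookup∘update j x a) (trans ([]≔-idempotent x j) ([]≔-lookup x j))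
    coordinateMove .source-σ x sx with D (σ꜀ x) in tx
    ... | false = refl
    ... | true = ⊥-elim (proj₁ (D-true x sx) (proj₂ (target x tx)))
    coordinateMove .cnt-σ f = cnt-swap f j

    coordinateMove-intersecting : (I : VSet (suc t) (suc n)) → Intersecting₀ I → Intersecting₀ (shift coordinateMove I)
    coordinateMove-intersecting = shift-preserves coordinateMove Disjoint₀
      (λ d k (p , q) → d k (q , p))
      (λ {x} {y} → disjoint-σ {x} {y})
      (λ {x} {y} tx ty d → d zero (proj₂ (target x tx) , proj₂ (target y ty)))
      (λ {x} {y} → one {x} {y})
      where
      disjoint-σ : ∀ {x y} → Disjoint₀ x y → Disjoint₀ (σ꜀ x) (σ꜀ y)
      disjoint-σ {x} {y} d zero (p , q) = d (suc j) (trans (sym (σ꜀-0 x)) p , trans (sym (σ꜀-0 y)) q)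
      disjoint-σ {x} {y} d (suc k) (p , q) with k ≟ j
      ... | yes refl = d zero (trans (sym (σ꜀-j x)) p , trans (sym (σ꜀-j y)) q)
      ... | no k≢j = d (suc k) (trans (sym (σ꜀-away k≢j x)) p , trans (sym (σ꜀-away k≢j y)) q)
      one : ∀ {x y} → D (σ꜀ x) ≡ true → D y ≡ false → Disjoint₀ x y → Disjoint₀ (σ꜀ x) y
      one {x} {y} tx sy d zero (p , q) = proj₁ (target x tx) (trans (sym (σ꜀-0 x)) p)
      one {x} {y} tx sy d (suc k) (p , q) with k ≟ j
      ... | no k≢j = d (suc k) (trans (sym (σ꜀-away k≢j x)) p , q)
      -- As `y` is not a source, a zero at `j` forces a zero at the first coordinate, which it would
      -- share with the target `x`.
      ... | yes refl with () ← trans (sym sy) (true-D y (λ e → d zero (proj₂ (target x tx) , e)) q)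

    coordinateMove-off : (I : VSet (suc t) (suc n)) → ∀ k → off (suc k) zero I ≤ off (suc k) zero (shift coordinateMove I)
    coordinateMove-off I k with k ≟ j
    ... | yes refl = off-increase coordinateMove I (dictator (suc j) zero)
          λ x sx → dec-true (lookup x (suc j) ≟ zero) (proj₂ (D-true x sx))
    ... | no k≢j = ≤-reflexive (sym (off-invariant coordinateMove I (dictator (suc k) zero)
          λ x → cong (λ b → does (b ≟ zero)) (σ꜀-away k≢j x)))

    coordinateMove-off₀ : (I : VSet (suc t) (suc n)) →
      off zero zero (shift coordinateMove I) + cnt (moved coordinateMove I) ≡ off zero zero I
    coordinateMove-off₀ I = off-decrease coordinateMove I (dictator zero zero)
      (λ x sx → dec-false (lookup x zero ≟ zero) (proj₁ (D-true x sx)))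
      (λ x tx → dec-true (lookup x zero ≟ zero) (proj₂ (target x tx)))

    coordinateMove-stable : (I : VSet (suc t) (suc n)) → cnt (moved coordinateMove I) ≡ 0 → ∀ a x → a ≢ zero →
      lookup x j ≡ zero → I (a ∷ x) ≡ true → I (zero ∷ (x [ j ]≔ a)) ≡ true
    coordinateMove-stable I none a x a≢0 e Ix = subst (λ b → I (b ∷ (x [ j ]≔ a)) ≡ true) e
      (stable coordinateMove I none (a ∷ x) (true-D (a ∷ x) a≢0 e) Ix)

-- The gap, its stability under compression, and the near dictator.

module Approximation where
  open import Data.Nat hiding (_≟_)
  open import Data.Nat.Properties hiding (_≟_)
  open import Data.Nat.Tactic.RingSolver using (solve-∀)
  open import Data.Bool using (true; false; not; _∧_; if_then_else_)
  open import Data.Fin using (Fin; zero; suc; punchIn; _≟_)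
  open import Data.Fin.Properties using (punchInᵢ≢i; any?)
  open import Data.Vec using ([]; _∷_; lookup; insertAt; _[_]≔_; zipWith)
  open import Data.Vec.Properties using (lookup∘update; lookup∘update′; []≔-lookup)
  open import Data.Product using (_×_; _,_; proj₁; proj₂; ∃; ∃₂)
  open import Data.Sum using (_⊎_; inj₁; inj₂; [_,_]′)
  open import Data.Empty using (⊥; ⊥-elim)
  open import Function using (_∘_; id)
  open import Relation.Nullary using (yes; no; does; ¬_; Dec)
  open import Relation.Nullary.Decidable using (dec-true)
  open import Relation.Binary.PropositionalEquality hiding (J)
  open import Algebra.Properties.CommutativeMonoid.Sum +-0-commutativeMonoid using (sum; sum-cong-≗)
  open Counting
  open Shifting
  open Moves
  open PiecewiseLinear
  open Spectral using (agreements; two-intersecting)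

  module Coarse (m₂ : ℕ) where
    open PiecewiseLinear.PL (suc m₂)

    private variable
      n : ℕ

    module _ {T x v : ℕ} (h : PL T x v) where
      line₀ : T ≤ t * x → x ≤ T → m * T + x ≤ m * v + T
      line₀ lo hi = subst₂ _≤_ (e₁ m T x) (e₂ m T v)
        (proj₂ (h 0) (subst (T ≤_) (e₃ t x) lo) (subst (_≤ T) (e₄ x) hi))
        where
        e₁ : ∀ m T x → 1 * m * T + 1 * (1 * x) ≡ m * T + x
        e₁ = solve-∀
        e₂ : ∀ m T v → m * 1 * v + 1 * T ≡ m * v + T
        e₂ = solve-∀
        e₃ : ∀ t x → t * x ≡ t * 1 * x
        e₃ = solve-∀
        e₄ : ∀ x → x ≡ 1 * x
        e₄ = solve-∀

      line₁ : T ≤ t * t * x → t * x ≤ T → m * T + t * x ≤ t * v + T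
      line₁ lo hi = *-cancelˡ-pos m z<s (subst₂ _≤_ (e₁ m t T x) (e₂ m t T v)
        (proj₂ (h 1) (subst (T ≤_) (e₃ t x) lo) (subst (_≤ T) (e₄ t x) hi)))
        where
        e₁ : ∀ m t T x → m * 1 * m * T + m * 1 * (t * 1 * x) ≡ m * (m * T + t * x)
        e₁ = solve-∀
        e₂ : ∀ m t T v → m * (t * 1) * v + m * 1 * T ≡ m * (t * v + T)
        e₂ = solve-∀
        e₃ : ∀ t x → t * t * x ≡ t * (t * 1) * x
        e₃ = solve-∀
        e₄ : ∀ t x → t * x ≡ t * 1 * x
        e₄ = solve-∀

      line₂ : T ≤ t * t * t * x → t * t * x ≤ T → m * m * T + m * (t * t * x) ≤ t * t * v + m * T
      line₂ lo hi = *-cancelˡ-pos m z<s (subst₂ _≤_ (e₁ m t T x) (e₂ m t T v)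
        (proj₂ (h 2) (subst (T ≤_) (e₃ t x) lo) (subst (_≤ T) (e₄ t x) hi)))
        where
        e₁ : ∀ m t T x → m * (m * 1) * m * T + m * (m * 1) * (t * (t * 1) * x) ≡ m * (m * m * T + m * (t * t * x))
        e₁ = solve-∀
        e₂ : ∀ m t T v → m * (t * (t * 1)) * v + m * (m * 1) * T ≡ m * (t * t * v + m * T)
        e₂ = solve-∀
        e₃ : ∀ t x → t * t * t * x ≡ t * (t * (t * 1)) * x
        e₃ = solve-∀
        e₄ : ∀ t x → t * t * x ≡ t * (t * 1) * x
        e₄ = solve-∀

      chord₂ : t * t * x ≤ T → m * m * x ≤ v
      chord₂ hi = subst (_≤ v) (sym (e m x)) (proj₁ (h 2) (subst (_≤ T) (e t x) hi))
        where
        e : ∀ t x → t * t * x ≡ t * (t * 1) * x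
        e = solve-∀

      chord₃ : t * t * t * x ≤ T → m * m * m * x ≤ v
      chord₃ hi = subst (_≤ v) (sym (e m x)) (proj₁ (h 3) (subst (_≤ T) (e t x) hi))
        where
        e : ∀ t x → t * t * t * x ≡ t * (t * (t * 1)) * x
        e = solve-∀

    cross-PL : (A B : VSet t n) → CrossIndependent A B → PLCount n (cnt A) (cnt (not ∘ B))
    cross-PL = Cross.cross (suc m₂) PLCount (λ {n} → PLCount-mono {n}) PLCount-base₀ PLCount-base₁ (λ {n} → PLCount-step {n})

    cross-PL₁ : (A B : VSet t n) → CrossIndependent A B → PL (t ^ n) (cnt A) (cnt (not ∘ B))
    cross-PL₁ {n} A B cr = subst₂ (λ T v → PL T (cnt A) v) (*-identityˡ (t ^ n)) (*-identityˡ (cnt (not ∘ B)))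
      (proj₂ (cross-PL A B cr) 1 (cnt A) (≤-reflexive (sym (*-identityˡ (cnt A)))))

    cross-sym : {A B : VSet t n} → CrossIndependent A B → CrossIndependent B A
    cross-sym cr x y Bx Ay adj = cr y x Ay Bx (λ k → adj k ∘ sym)

    -- From `1 / t` upwards the topmost segment of `ψ` gives `cnt A + m * cnt B ≤ t ^ n`. For
    -- `A = B` this is the maximum size of an independent set.
    smaller-≤ : (A B : VSet t n) → CrossIndependent A B → cnt A ≤ cnt B → t * cnt A ≤ t ^ n
    smaller-≤ {n} A B cr α≤β with ≤-total (t * cnt A) (t ^ n)
    ... | inj₁ le = le
    ... | inj₂ ge = ≤-trans (+-monoʳ-≤ (cnt A) (*-monoʳ-≤ m α≤β))
        (≤-cancel-common (m * t ^ n) (e₁ m (t ^ n) (cnt A) (cnt B))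
          (trans (e₂ m (t ^ n) (cnt (not ∘ B)) (cnt B)) (cong (λ z → t ^ n + m * z) (cnt-not B)))
          (+-monoˡ-≤ (m * cnt B) (line₀ (cross-PL₁ A B cr) ge (proj₁ (cross-PL A B cr)))))
      where
      e₁ : ∀ m T a b → a + m * b + m * T ≡ m * T + a + m * b
      e₁ = solve-∀
      e₂ : ∀ m T v b → m * v + T + m * b ≡ T + m * (b + v)
      e₂ = solve-∀

    -- Between `1 / t²` and `1 / t` the slope of `ψ` is 1, so this segment bounds the sum of the two
    -- measures.
    cross-sum-≤ : (A B : VSet t n) → CrossIndependent A B → cnt A ≤ cnt B → t ^ n ≤ t * t * cnt A →
      t * (cnt A + cnt B) ≤ 2 * t ^ n
    cross-sum-≤ {n} A B cr α≤β lo = ≤-cancel-common (m * t ^ n) (e₁ m (t ^ n) (cnt A) (cnt B))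
        (trans (e₂ m (t ^ n) (cnt (not ∘ B)) (cnt B)) (trans (cong (λ z → t ^ n + t * z) (cnt-not B)) (e₃ m (t ^ n))))
        (+-monoˡ-≤ (t * cnt B) (line₁ (cross-PL₁ A B cr) lo (smaller-≤ A B cr α≤β)))
      where
      e₁ : ∀ m T a b → suc m * (a + b) + m * T ≡ m * T + suc m * a + suc m * b
      e₁ = solve-∀
      e₂ : ∀ m T v b → suc m * v + T + suc m * b ≡ T + suc m * (b + v)
      e₂ = solve-∀
      e₃ : ∀ m T → T + suc m * T ≡ 2 * T + m * T
      e₃ = solve-∀

    cross-sum : (A B : VSet t n) → CrossIndependent A B → t ^ n ≤ t * t * cnt A → t ^ n ≤ t * t * cnt B →
      t * (cnt A + cnt B) ≤ 2 * t ^ n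
    cross-sum {n} A B cr lo lo′ with ≤-total (cnt A) (cnt B)
    ... | inj₁ le = cross-sum-≤ A B cr le lo
    ... | inj₂ ge = subst (λ z → t * z ≤ 2 * t ^ n) (+-comm (cnt B) (cnt A)) (cross-sum-≤ B A (cross-sym cr) ge lo′)

    -- The mean of the `m` slices off the dictator is at most the largest of them, and `PLCount` of
    -- that slice accepts the mean as a fraction with denominator `m`.
    off-PL : ∀ i a (I : VSet t (suc n)) → Independent I →
      PL (m * t ^ n) (off i a I) (m * cnt (not ∘ slice i a I))
    off-PL {n} i a I ind = proj₂ (cross-PL (slice i b I) (slice i a I) (cross-slices i (punchInᵢ≢i a _) ind))
        m (off i a I) (≤-trans (≤-reflexive (off-slices i a I)) (sum≤ (proj₂ (argmax g))))
      where
      g : Fin m → ℕ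
      g b = cnt (slice i (punchIn a b) I)
      b : Fin t
      b = punchIn a (proj₁ (argmax g))

    Large : VSet t (suc n) → Set
    Large {n} I = (1 + 3 * m) * t ^ n < t * t * cnt I

    -- The part of I outside the dictator has normalised measure off i a I / (m * t ^ n).
    Far : Fin (suc n) → Fin t → VSet t (suc n) → Set
    Far {n} i a I = m * t ^ n < t * t * off i a I

    Near : Fin (suc n) → Fin t → VSet t (suc n) → Set
    Near {n} i a I = t * t * t * off i a I < m * t ^ n

    gap : ∀ i a (I : VSet t (suc n)) → Independent I → Large I → Far i a I ⊎ Near i a I
    gap {n} i a I ind large with ≤-<-connex (t * t * off i a I) (m * t ^ n) | ≤-<-connex (m * t ^ n) (t * t * t * off i a I)
    ... | inj₂ far | _ = inj₁ far
    ... | inj₁ _ | inj₂ near = inj₂ near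
    ... | inj₁ hi | inj₁ lo = ⊥-elim (<⇒≱ large bound)
      where
      T x g v : ℕ
      T = t ^ n
      x = off i a I
      g = cnt (slice i a I)
      v = cnt (not ∘ slice i a I)
      l : m * m * (m * T) + m * (t * t * x) ≤ t * t * (m * v) + m * (m * T)
      l = line₂ (off-PL i a I ind) lo hi
      l′ : m * m * T + t * t * x ≤ t * t * v + m * T
      l′ = *-cancelˡ-pos m z<s (subst₂ _≤_ (e₁ m t T x) (e₂ m t T v) l)
        where
        e₁ : ∀ m t T x → m * m * (m * T) + m * (t * t * x) ≡ m * (m * m * T + t * t * x)
        e₁ = solve-∀
        e₂ : ∀ m t T v → t * t * (m * v) + m * (m * T) ≡ m * (t * t * v + m * T)
        e₂ = solve-∀
      -- `t * t * x` has the same coefficient in `l′` and in `t * t * cnt I`, so the bound does not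
      -- depend on `x`.
      bound : t * t * cnt I ≤ (1 + 3 * m) * T
      bound = ≤-cancel-common (m * m * T) (trans (cong (λ z → t * t * z + m * m * T) (cnt-dictator i a I)) (e₁ m t T x g))
        (trans (e₂ m t T v g) (trans (cong (λ z → t * t * z + m * T) (cnt-not (slice i a I))) (e₃ m T)))
        (+-monoˡ-≤ (t * t * g) l′)
        where
        e₁ : ∀ m t T x g → t * t * (g + x) + m * m * T ≡ m * m * T + t * t * x + t * t * g
        e₁ = solve-∀
        e₂ : ∀ m t T v g → t * t * v + m * T + t * t * g ≡ t * t * (g + v) + m * T
        e₂ = solve-∀
        e₃ : ∀ m T → suc m * suc m * T + m * T ≡ (1 + 3 * m) * T + m * m * T
        e₃ = solve-∀

    -- Removing at most `m T / t³` from more than `m T / t²` leaves at least `m² T / t³`, and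
    -- `m² ≥ t`; the polynomial in `m₂` is `m² - t`.
    part-large : ∀ T y c → m * T < t * t * (y + c) → t * t * t * c ≤ m * T → T ≤ t * t * y
    part-large T y c far near = *-cancelˡ-pos t z<s (≤-cancel-common (m * T) refl refl (begin
      t * T + m * T                       ≤⟨ m≤m+n _ ((1 + 3 * m₂ + m₂ * m₂) * T) ⟩
      t * T + m * T + (1 + 3 * m₂ + m₂ * m₂) * T ≡⟨ e₁ m₂ T ⟩
      t * (m * T)                         ≤⟨ *-monoʳ-≤ t (<⇒≤ far) ⟩
      t * (t * t * (y + c))               ≡⟨ e₂ t y c ⟩
      t * (t * t * y) + t * t * t * c     ≤⟨ +-monoʳ-≤ (t * (t * t * y)) near ⟩
      t * (t * t * y) + m * T             ∎))
      where
      open ≤-Reasoning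
      e₁ : ∀ k T → (3 + k) * T + (2 + k) * T + (1 + 3 * k + k * k) * T ≡ (3 + k) * ((2 + k) * T)
      e₁ = solve-∀
      e₂ : ∀ t y c → t * (t * t * (y + c)) ≡ t * (t * t * y) + t * t * t * c
      e₂ = solve-∀

    -- The part `c` outside both dictators stays off, so a jump to `Near` makes it tiny. Farness
    -- from both then gives `A` and `B` measure at least `1 / t²`, `cross-sum` allows them at most
    -- `2 T / t` together, and `I` is too small; the margin is `t² - 3 t + 1`.
    module ValueJump (i : Fin (suc n)) (j : Fin m) (I : VSet t (suc n)) (ind : Independent I) (large : Large I)
      (far₀ : Far i zero I) (farⱼ : Far i (suc j) I) where
      open Move (valueMove i j)

      private
        d₀ dⱼ : VSet t (suc n)
        d₀ = dictator i zero
        dⱼ = dictator i (suc j)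
        A B : VSet t n
        A = slice i zero I
        B = slice i (suc j) I
        T c : ℕ
        T = t ^ n
        c = cnt ((I ∖ d₀) ∖ dⱼ)

        off₀≡ : off i zero I ≡ cnt B + c
        off₀≡ = trans (cnt-split (I ∖ d₀) dⱼ) (cong (_+ c) (trans (cnt-cong pointwise) (cnt-∩-dictator i (suc j) I)))
          where
          pointwise : ∀ x → ((I ∖ d₀) ∩ dⱼ) x ≡ (I ∩ dⱼ) x
          pointwise x with I x | lookup x i
          ... | false | _ = refl
          ... | true | zero = refl
          ... | true | suc a = refl

        offⱼ≡ : off i (suc j) I ≡ cnt A + c
        offⱼ≡ = trans (cnt-split (I ∖ dⱼ) d₀)
            (cong₂ _+_ (trans (cnt-cong pointwise) (cnt-∩-dictator i zero I)) (cnt-cong pointwise′))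
          where
          pointwise : ∀ x → ((I ∖ dⱼ) ∩ d₀) x ≡ (I ∩ d₀) x
          pointwise x with I x | lookup x i
          ... | false | _ = refl
          ... | true | zero = refl
          ... | true | suc a with does (suc a ≟ suc j)
          ...   | true = refl
          ...   | false = refl
          pointwise′ : ∀ x → ((I ∖ dⱼ) ∖ d₀) x ≡ ((I ∖ d₀) ∖ dⱼ) x
          pointwise′ x with I x | d₀ x | dⱼ x
          ... | false | _ | _ = refl
          ... | true | false | false = refl
          ... | true | false | true = refl
          ... | true | true | false = refl
          ... | true | true | true = refl

        c≤ : c ≤ off i zero (shift I)
        c≤ = cnt-mono pointwise
          where
          pointwise : ∀ x → ((I ∖ d₀) ∖ dⱼ) x ≡ true → (shift I ∖ d₀) x ≡ true
          pointwise x with I x | d₀ x | dⱼ x | source (σ x)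
          ... | true | false | false | true = λ _ → refl
          ... | true | false | false | false = λ _ → refl
          ... | true | false | true | _ = λ ()
          ... | true | true | _ | _ = λ ()
          ... | false | _ | _ | _ = λ ()

      not-near : ¬ Near i zero (shift I)
      not-near near = <⇒≱ large (*-cancelˡ-pos t z<s (begin
        t * (t * t * cnt I)            ≡⟨ cong (λ z → t * (t * t * z)) (trans (cnt-dictator i zero I) (cong (cnt A +_) off₀≡)) ⟩
        t * (t * t * (cnt A + (cnt B + c)))  ≡⟨ e₁ t (cnt A) (cnt B) c ⟩
        t * t * (t * (cnt A + cnt B)) + t * t * t * c
          ≤⟨ +-mono-≤ (*-monoʳ-≤ (t * t) (cross-sum A B (cross-slices i (λ ()) ind)
               (part-large T (cnt A) c (subst (λ z → m * T < t * t * z) offⱼ≡ farⱼ) c-small)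
               (part-large T (cnt B) c (subst (λ z → m * T < t * t * z) off₀≡ far₀) c-small))) c-small ⟩
        t * t * (2 * T) + m * T        ≤⟨ m≤m+n _ ((1 + 3 * m₂ + m₂ * m₂) * T) ⟩
        t * t * (2 * T) + m * T + (1 + 3 * m₂ + m₂ * m₂) * T ≡⟨ e₂ m₂ T ⟩
        t * ((1 + 3 * m) * T)          ∎))
        where
        open ≤-Reasoning
        c-small : t * t * t * c ≤ m * T
        c-small = ≤-trans (*-monoʳ-≤ (t * t * t) c≤) (<⇒≤ near)
        e₁ : ∀ t a b c → t * (t * t * (a + (b + c))) ≡ t * t * (t * (a + b)) + t * t * t * c
        e₁ = solve-∀
        e₂ : ∀ k T → (3 + k) * (3 + k) * (2 * T) + (2 + k) * T + (1 + 3 * k + k * k) * T ≡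
          (3 + k) * ((1 + 3 * (2 + k)) * T)
        e₂ = solve-∀

    corner-small : ∀ T γ o → γ ≤ o → t * t * t * o < m * (t * T) → t * t * γ ≤ m * T
    corner-small T γ o γ≤o near = *-cancelˡ-pos t z<s (begin
      t * (t * t * γ)   ≡⟨ e t γ ⟩
      t * t * t * γ     ≤⟨ *-monoʳ-≤ (t * t * t) γ≤o ⟩
      t * t * t * o     ≤⟨ <⇒≤ near ⟩
      m * (t * T)       ≡⟨ e′ m t T ⟩
      t * (m * T)       ∎)
      where
      open ≤-Reasoning
      e : ∀ t γ → t * (t * t * γ) ≡ t * t * t * γ
      e = solve-∀
      e′ : ∀ m t T → m * (t * T) ≡ t * (m * T)
      e′ = solve-∀

    part-large₂ : ∀ T y γ g → t * t * γ ≤ m * T → m * (t * T) < t * t * (y + γ) → y ≤ m * g → T ≤ t * t * g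
    part-large₂ T y γ g γ-small far y≤ = ≤-trans (m≤m+n T (suc m₂ * T)) (*-cancelˡ-pos m z<s (≤-cancel-common (m * T) (e m T) refl (begin
      m * (t * T)                          ≤⟨ <⇒≤ far ⟩
      t * t * (y + γ)                      ≡⟨ *-distribˡ-+ (t * t) y γ ⟩
      t * t * y + t * t * γ                ≤⟨ +-mono-≤ (*-monoʳ-≤ (t * t) y≤) γ-small ⟩
      t * t * (m * g) + m * T              ≡⟨ cong (_+ m * T) (e′ m t g) ⟩
      m * (t * t * g) + m * T              ∎)))
      where
      open ≤-Reasoning
      e : ∀ m T → m * (m * T) + m * T ≡ m * (suc m * T)
      e = solve-∀
      e′ : ∀ m t g → t * t * (m * g) ≡ m * (t * t * g)
      e′ = solve-∀

    pair-sum : ∀ T α β A B → α ≤ m * A → β ≤ m * B → t * (A + B) ≤ 2 * T → t * (α + β) ≤ 2 * (m * T)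
    pair-sum T α β A B hα hβ h = begin
      t * (α + β)            ≤⟨ *-monoʳ-≤ t (+-mono-≤ hα hβ) ⟩
      t * (m * A + m * B)    ≡⟨ e m t A B ⟩
      m * (t * (A + B))      ≤⟨ *-monoʳ-≤ m h ⟩
      m * (2 * T)            ≡⟨ e′ m T ⟩
      2 * (m * T)            ∎
      where
      open ≤-Reasoning
      e : ∀ m t a b → t * (m * a + m * b) ≡ m * (t * (a + b))
      e = solve-∀
      e′ : ∀ m T → m * (2 * T) ≡ 2 * (m * T)
      e′ = solve-∀

    four-parts : ∀ T α β γ δ → γ + δ ≤ T → t * (α + β) ≤ 2 * (m * T) →
      t * t * ((δ + β) + (α + γ)) ≤ (1 + 3 * m) * (t * T)
    four-parts T α β γ δ h h′ = begin
      t * t * ((δ + β) + (α + γ))          ≡⟨ e₁ t α β γ δ ⟩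
      t * (t * (γ + δ) + t * (α + β))      ≤⟨ *-monoʳ-≤ t (+-mono-≤ (*-monoʳ-≤ t h) h′) ⟩
      t * (t * T + 2 * (m * T))            ≡⟨ e₂ m T ⟩
      (1 + 3 * m) * (t * T)                ∎
      where
      open ≤-Reasoning
      e₁ : ∀ t α β γ δ → t * t * ((δ + β) + (α + γ)) ≡ t * (t * (γ + δ) + t * (α + β))
      e₁ = solve-∀
      e₂ : ∀ m T → suc m * (suc m * T + 2 * (m * T)) ≡ (1 + 3 * m) * (suc m * T)
      e₂ = solve-∀

    cross-slices₂ : ∀ {I : VSet t (suc (suc n))} j {a b a′ b′} → ¬ (a ≡ zero × a′ ≡ zero) → ¬ (b ≡ zero × b′ ≡ zero) →
      Intersecting₀ I → CrossIndependent (slice j b (slice zero a I)) (slice j b′ (slice zero a′ I))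
    cross-slices₂ j ¬a ¬b int x y Ix Iy adj = int _ _ Ix Iy λ { zero → ¬a ; (suc k) → inner j x y ¬b adj k }
      where
      inner : ∀ {n} j {b b′} (x y : Vertex t n) → ¬ (b ≡ zero × b′ ≡ zero) → Adjacent x y →
        Disjoint₀ (insertAt x j b) (insertAt y j b′)
      inner zero x y ¬b adj zero = ¬b
      inner zero x y ¬b adj (suc k) (p , q) = adj k (trans p (sym q))
      inner (suc j) (_ ∷ _) (_ ∷ _) ¬b adj zero (p , q) = adj zero (trans p (sym q))
      inner (suc j) (_ ∷ x) (_ ∷ y) ¬b adj (suc k) = inner j x y ¬b (adj ∘ suc) k

    -- The parts `α`, `β`, `γ`, `δ` record which of the two coordinates vanish. `γ` stays off, so a
    -- jump makes it small; the pair `γ`, `δ` then satisfies `γ + δ ≤ T`, the pair `α`, `β` obeys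
    -- `cross-sum`, and the total is exactly the threshold.
    module CoordinateJump (j : Fin (suc n)) (I : VSet t (suc (suc n))) (int : Intersecting₀ I) (large : Large I)
      (far₀ : Far zero zero I) (farⱼ : Far (suc j) zero I) where
      open Move (coordinateMove j {t = m})

      private
        d₀ dⱼ : VSet t (suc (suc n))
        d₀ = dictator zero zero
        dⱼ = dictator (suc j) zero
        T α β γ δ : ℕ
        T = t ^ n
        α = cnt ((I ∖ dⱼ) ∩ d₀)
        β = cnt ((I ∩ dⱼ) ∖ d₀)
        γ = cnt ((I ∖ dⱼ) ∖ d₀)
        δ = cnt ((I ∩ dⱼ) ∩ d₀)
        S : Fin t → Fin t → VSet t n
        S a b = slice j b (slice zero a I)

        off₀≡ : off zero zero I ≡ β + γ
        off₀≡ = trans (cnt-split (I ∖ d₀) dⱼ) (cong₂ _+_ (cnt-cong λ x → p (I x) (d₀ x) (dⱼ x)) (cnt-cong λ x → q (I x) (d₀ x) (dⱼ x)))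
          where
          p : ∀ a b c → (a ∧ not b) ∧ c ≡ (a ∧ c) ∧ not b
          p false _ _ = refl
          p true false false = refl
          p true false true = refl
          p true true false = refl
          p true true true = refl
          q : ∀ a b c → (a ∧ not b) ∧ not c ≡ (a ∧ not c) ∧ not b
          q a b c = p a b (not c)

        offⱼ≡ : off (suc j) zero I ≡ α + γ
        offⱼ≡ = cnt-split (I ∖ dⱼ) d₀

        cnt≡ : cnt I ≡ (δ + β) + (α + γ)
        cnt≡ = trans (cnt-split I dⱼ) (cong₂ _+_ (cnt-split (I ∩ dⱼ) d₀) offⱼ≡)

        δ≡ : δ ≡ cnt (S zero zero)
        δ≡ = trans (cnt-∩-dictator zero zero (I ∩ dⱼ)) (cnt-∩-dictator j zero (slice zero zero I))

        α≤ : ∃ λ b → α ≤ m * cnt (S zero (suc b))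
        α≤ = let (b , max) = argmax (λ b → cnt (S zero (suc b))) in
          b , ≤-trans (≤-reflexive (trans (cnt-∩-dictator zero zero (I ∖ dⱼ)) (off-slices j zero (slice zero zero I)))) (sum≤ max)

        β≤ : ∃ λ a → β ≤ m * cnt (S (suc a) zero)
        β≤ = let (a , max) = argmax (λ a → cnt (S (suc a) zero)) in
          a , ≤-trans (≤-reflexive (trans (off-slices zero zero (I ∩ dⱼ))
            (sum-cong-≗ λ a → cnt-∩-dictator j zero (slice zero (suc a) I)))) (sum≤ max)

        γ≤ : ∃₂ λ a b → γ ≤ m * m * cnt (S (suc a) (suc b))
        γ≤ = let (a , max) = argmax (λ a → off j zero (slice zero (suc a) I))
                 (b , max′) = argmax (λ b → cnt (S (suc a) (suc b))) in
          a , b , ≤-trans (≤-reflexive (off-slices zero zero (I ∖ dⱼ)))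
            (≤-trans (sum≤ max) (≤-trans (*-monoʳ-≤ m (≤-trans (≤-reflexive (off-slices j zero (slice zero (suc a) I))) (sum≤ max′)))
              (≤-reflexive (sym (*-assoc m m (cnt (S (suc a) (suc b))))))))

        γ≤off : γ ≤ off zero zero (shift I)
        γ≤off = cnt-mono pointwise
          where
          pointwise : ∀ x → ((I ∖ dⱼ) ∖ d₀) x ≡ true → (shift I ∖ d₀) x ≡ true
          pointwise x with I x | dⱼ x | d₀ x | source (σ x)
          ... | true | false | false | true = λ _ → refl
          ... | true | false | false | false = λ _ → refl
          ... | true | false | true | _ = λ ()
          ... | true | true | _ | _ = λ ()
          ... | false | _ | _ | _ = λ ()

      not-near : ¬ Near zero zero (shift I)
      not-near near = <⇒≱ large (subst (λ z → t * t * z ≤ (1 + 3 * m) * (t * T)) (sym cnt≡)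
          (four-parts T α β γ δ γ+δ≤T (pair-sum T α β A B α≤ₘ β≤ₘ (cross-sum (S zero (suc b)) (S (suc a) zero)
            (cross-slices₂ {I = I} j (λ { (_ , ()) }) (λ { (() , _) }) int)
            (part-large₂ T α γ A γ-small (subst (λ z → m * (t * T) < t * t * z) offⱼ≡ farⱼ) α≤ₘ)
            (part-large₂ T β γ B γ-small (subst (λ z → m * (t * T) < t * t * z) off₀≡ far₀) β≤ₘ)))))
        where
        a b a′ b′ : Fin m
        a = proj₁ β≤
        b = proj₁ α≤
        a′ = proj₁ γ≤
        b′ = proj₁ (proj₂ γ≤)
        α≤ₘ : α ≤ m * cnt (S zero (suc b))
        α≤ₘ = proj₂ α≤
        β≤ₘ : β ≤ m * cnt (S (suc a) zero)
        β≤ₘ = proj₂ β≤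
        γ≤ₘ : γ ≤ m * m * cnt (S (suc a′) (suc b′))
        γ≤ₘ = proj₂ (proj₂ γ≤)
        A B v : ℕ
        A = cnt (S zero (suc b))
        B = cnt (S (suc a) zero)
        v = cnt (not ∘ S zero zero)
        γ-small : t * t * γ ≤ m * T
        γ-small = corner-small T γ (off zero zero (shift I)) γ≤off near
        pl : PL (m * m * T) γ (m * m * v)
        pl = proj₂ (cross-PL (S (suc a′) (suc b′)) (S zero zero) (cross-slices₂ {I = I} j (λ { (() , _) }) (λ { (() , _) }) int))
          (m * m) γ γ≤ₘ
        -- Averaged over `m²` slices, `γ` has measure at most `1 / (m t²)`, hence `chord₂` applies;
        -- its slope `m²` matches the number of slices.
        γ+δ≤T : γ + δ ≤ T
        γ+δ≤T = subst₂ _≤_ (cong (γ +_) (sym δ≡)) (trans (+-comm v (cnt (S zero zero))) (cnt-not (S zero zero)))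
          (+-monoˡ-≤ (cnt (S zero zero)) (*-cancelˡ-pos (m * m) z<s (chord₂ pl (≤-trans γ-small (*-monoˡ-≤ T (m≤m*n m m))))))

    large-cong : {I J : VSet t (suc n)} → cnt J ≡ cnt I → Large I → Large J
    large-cong {n} e = subst (λ z → (1 + 3 * m) * t ^ n < t * t * z) (sym e)

    far-mono : ∀ {i a} {I J : VSet t (suc n)} → off i a I ≤ off i a J → Far i a I → Far i a J
    far-mono le far = <-≤-trans far (*-monoʳ-≤ (t * t) le)

    intersecting⇒independent : {I : VSet t n} → Intersecting₀ I → Independent I
    intersecting⇒independent int x y Ix Iy adj = int x y Ix Iy λ k (p , q) → adj k (trans p (sym q))

    one-agreement : ∀ k (x y : Vertex t n) → lookup x k ≡ lookup y k → 1 ≤ agreements x y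
    one-agreement zero (a ∷ x) (b ∷ y) e rewrite dec-true (a ≟ b) e = s≤s z≤n
    one-agreement (suc k) (a ∷ x) (b ∷ y) e = ≤-trans (one-agreement k x y e) (m≤n+m _ ⟦ does (a ≟ b) ⟧)

    two-agreements : ∀ {j k} (x y : Vertex t n) → j ≢ k → lookup x j ≡ lookup y j → lookup x k ≡ lookup y k → 2 ≤ agreements x y
    two-agreements {j = zero} {zero} x y j≢k p q = ⊥-elim (j≢k refl)
    two-agreements {j = zero} {suc k} (a ∷ x) (b ∷ y) j≢k p q rewrite dec-true (a ≟ b) p = s≤s (one-agreement k x y q)
    two-agreements {j = suc j} {zero} (a ∷ x) (b ∷ y) j≢k p q rewrite dec-true (a ≟ b) q = s≤s (one-agreement j x y p)
    two-agreements {j = suc j} {suc k} (a ∷ x) (b ∷ y) j≢k p q =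
      ≤-trans (two-agreements x y (j≢k ∘ cong suc) p q) (m≤n+m _ ⟦ does (a ≟ b) ⟧)

    -- Two vectors starting with `suc a₀` share a zero at some `j`. Stability allows exchanging this
    -- zero of the first vector with its initial entry; the result must share another zero with the
    -- second vector, at some `k ≢ j`. So the original vectors agree at `j` and at `k`.
    coordinate-stable : (I : VSet t (suc n)) → Intersecting₀ I → (∀ j → cnt (Move.moved (coordinateMove j) I) ≡ 0) → ¬ Far zero zero I
    coordinate-stable {n} I int none far = <⇒≱ far (begin
      t * t * off zero zero I                        ≡⟨ cong (t * t *_) (off-slices zero zero I) ⟩
      t * t * sum (λ a → cnt (slice zero (suc a) I)) ≤⟨ *-monoʳ-≤ (t * t) (sum≤ max) ⟩
      t * t * (m * g)                                ≡⟨ e m t g ⟩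
      m * (t * t * g)                                ≤⟨ *-monoʳ-≤ m (two-intersecting (s≤s (s≤s z≤n)) (slice zero (suc a₀) I) two) ⟩
      m * t ^ n                                      ∎)
      where
      open ≤-Reasoning
      a₀ : Fin m
      a₀ = proj₁ (argmax (λ a → cnt (slice zero (suc a) I)))
      max : ∀ a → cnt (slice zero (suc a) I) ≤ cnt (slice zero (suc a₀) I)
      max = proj₂ (argmax (λ a → cnt (slice zero (suc a) I)))
      g : ℕ
      g = cnt (slice zero (suc a₀) I)
      e : ∀ m t g → t * t * (m * g) ≡ m * (t * t * g)
      e = solve-∀
      two : ∀ x y → I (suc a₀ ∷ x) ≡ true → I (suc a₀ ∷ y) ≡ true → 2 ≤ agreements x y
      two x y Ix Iy with 2 ≤? agreements x y
      ... | yes le = le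
      ... | no ¬le = ⊥-elim (int (suc a₀ ∷ x) (suc a₀ ∷ y) Ix Iy disjoint)
        where
        disjoint : Disjoint₀ (suc a₀ ∷ x) (suc a₀ ∷ y)
        disjoint zero (() , _)
        disjoint (suc j) (p , q) = int (zero ∷ (x [ j ]≔ suc a₀)) (suc a₀ ∷ y)
            (coordinateMove-stable j I (none j) (suc a₀) x (λ ()) p Ix) Iy disjoint′
          where
          disjoint′ : Disjoint₀ (zero ∷ (x [ j ]≔ suc a₀)) (suc a₀ ∷ y)
          disjoint′ zero (_ , ())
          disjoint′ (suc k) (p′ , q′) with k ≟ j
          ... | yes refl with () ← trans (sym (lookup∘update j x (suc a₀))) p′
          ... | no k≢j = ¬le (two-agreements x y k≢j
            (trans (trans (sym (lookup∘update′ k≢j x (suc a₀))) p′) (sym q′)) (trans p (sym q)))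

    coordinate-not-near : (j : Fin n) (I : VSet t (suc n)) → Intersecting₀ I → Large I → (∀ k → Far k zero I) →
      ¬ Near zero zero (Move.shift (coordinateMove j) I)
    coordinate-not-near {suc n} j I int large far = CoordinateJump.not-near j I int large (far zero) (far (suc j))

    -- An effective exchange strictly lowers `off zero zero`, which `N` bounds. Farness from the
    -- first dictator survives by the gap, from the others by monotonicity of `off`.
    no-far-intersecting : ∀ N (I : VSet t (suc n)) → off zero zero I < N → Intersecting₀ I → Large I → ¬ (∀ k → Far k zero I)
    no-far-intersecting {n} (suc N) I lt int large far =
        decide (any? (λ j → 0 <? cnt (Move.moved (coordinateMove j) I)))
      where
      module _ (j : Fin n) (pos : 0 < cnt (Move.moved (coordinateMove j) I)) where
        J : VSet t (suc n)
        J = Move.shift (coordinateMove j) I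
        int′ : Intersecting₀ J
        int′ = coordinateMove-intersecting j I int
        large′ : Large J
        large′ = large-cong {I = I} {J} (Move.cnt-shift (coordinateMove j) I) large
        far′ : ∀ k → Far k zero J
        far′ zero = [ id , ⊥-elim ∘ coordinate-not-near j I int large far ]′
          (gap zero zero J (intersecting⇒independent int′) large′)
        far′ (suc k) = far-mono {i = suc k} {I = I} {J} (coordinateMove-off j I k) (far (suc k))
        next : ⊥
        next = no-far-intersecting N J
          (<-≤-trans (m<m+n (off zero zero J) pos) (≤-trans (≤-reflexive (coordinateMove-off₀ j I)) (s≤s⁻¹ lt)))
          int′ large′ far′
      decide : Dec (∃ λ j → 0 < cnt (Move.moved (coordinateMove j) I)) → ⊥
      decide (yes (j , pos)) = next j pos
      decide (no none) = coordinate-stable I int (λ j → n≤0⇒n≡0 (≮⇒≥ λ pos → none (j , pos))) (far zero)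

    zeroAgreements : Vertex t n → Vertex t n → Vertex t n
    zeroAgreements = zipWith (λ a b → if does (a ≟ b) then zero else a)

    zeroAgreements-closed : (P : Vertex t n → Set) → (∀ i x → P x → P (x [ i ]≔ zero)) → ∀ x y → P x → P (zeroAgreements x y)
    zeroAgreements-closed P closed [] [] Px = Px
    zeroAgreements-closed P closed (a ∷ x) (b ∷ y) Px =
      zeroAgreements-closed (P ∘ (_ ∷_)) (λ i x → closed (suc i) _) x y head
      where
      head : P ((if does (a ≟ b) then zero else a) ∷ x)
      head with does (a ≟ b)
      ... | true = closed zero (a ∷ x) Px
      ... | false = Px

    zeroAgreements-adjacent : (x y : Vertex t n) → Disjoint₀ x y → Adjacent (zeroAgreements x y) y
    zeroAgreements-adjacent (a ∷ x) (b ∷ y) d zero with a ≟ b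
    ... | yes refl = λ e → d zero (sym e , sym e)
    ... | no a≢b = a≢b
    zeroAgreements-adjacent (a ∷ x) (b ∷ y) d (suc k) = zeroAgreements-adjacent x y (d ∘ suc) k

    -- If `x` and `y` had no common zero, setting `x` to zero wherever they agree would stay in `I`
    -- by stability and produce a neighbour of `y`.
    value-stable : (I : VSet t (suc n)) → Independent I → (∀ i j → cnt (Move.moved (valueMove i j) I) ≡ 0) → Intersecting₀ I
    value-stable I ind none x y Ix Iy d = ind (zeroAgreements x y) y
        (zeroAgreements-closed (λ x → I x ≡ true) closed x y Ix) Iy (zeroAgreements-adjacent x y d)
      where
      closed : ∀ i x → I x ≡ true → I (x [ i ]≔ zero) ≡ true
      closed i x Ix with lookup x i in e
      ... | zero = subst (λ z → I z ≡ true) (trans (sym ([]≔-lookup x i)) (cong (x [ i ]≔_) e)) Ix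
      ... | suc j = valueMove-stable i j I (none i j) x e Ix

    -- The potential sums over all coordinates because a compression may act at any of them: it
    -- lowers the term of its own coordinate and fixes the rest.
    no-far : ∀ N (I : VSet t (suc n)) → sum (λ k → off k zero I) < N → Independent I → Large I → ¬ (∀ k a → Far k a I)
    no-far {n} (suc N) I lt ind large far =
        decide (any? (λ i → any? (λ j → 0 <? cnt (Move.moved (valueMove i j) I))))
      where
      module _ (i : Fin (suc n)) (j : Fin m) (pos : 0 < cnt (Move.moved (valueMove i j) I)) where
        J : VSet t (suc n)
        J = Move.shift (valueMove i j) I
        ind′ : Independent J
        ind′ = valueMove-independent i j I ind
        large′ : Large J
        large′ = large-cong {I = I} {J} (Move.cnt-shift (valueMove i j) I) large
        drop : off i zero J < off i zero I
        drop = <-≤-trans (m<m+n (off i zero J) pos) (≤-reflexive (valueMove-off₀ i j I))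
        le : ∀ k → Dec (k ≡ i) → off k zero J ≤ off k zero I
        le k (yes refl) = <⇒≤ drop
        le k (no k≢i) = ≤-reflexive (valueMove-off-other i j I k k≢i)
        far′ : ∀ k a → Dec (k ≡ i) → Dec (a ≡ zero) → Far k a J
        far′ k a (no k≢i) _ = far-mono {i = k} {a} {I} {J} (valueMove-off i j I k a (inj₂ k≢i)) (far k a)
        far′ k a (yes _) (no a≢0) = far-mono {i = k} {a} {I} {J} (valueMove-off i j I k a (inj₁ a≢0)) (far k a)
        far′ k a (yes refl) (yes refl) =
          [ id , ⊥-elim ∘ ValueJump.not-near i j I ind large (far i zero) (far i (suc j)) ]′ (gap i zero J ind′ large′)
        next : ⊥
        next = no-far N J (<-≤-trans (sum-mono-< i (λ k → le k (k ≟ i)) drop) (s≤s⁻¹ lt)) ind′ large′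
          (λ k a → far′ k a (k ≟ i) (a ≟ zero))
      decide : Dec (∃ λ i → ∃ λ j → 0 < cnt (Move.moved (valueMove i j) I)) → ⊥
      decide (yes (i , j , pos)) = next i j pos
      decide (no none) = no-far-intersecting (suc (off zero zero I)) I ≤-refl
        (value-stable I ind λ i j → n≤0⇒n≡0 (≮⇒≥ λ pos → none (i , j , pos))) large (λ k → far k zero)

    near-dictator : (I : VSet t (suc n)) → Independent I → Large I → ∃₂ λ i a → Near i a I
    near-dictator {n} I ind large = decide (any? (λ i → any? (λ a → t * t * t * off i a I <? m * t ^ n)))
      where
      decide : Dec (∃₂ λ i a → Near i a I) → ∃₂ λ i a → Near i a I
      decide (yes p) = p
      decide (no none) = ⊥-elim (no-far (suc (sum (λ k → off k zero I))) I ≤-refl ind large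
        λ k a → [ id , (λ near → ⊥-elim (none (k , a , near))) ]′ (gap k a I ind large))

-- From a near dictator to the exponent `η`.

module Exponent where
  open import Data.Nat hiding (_≟_)
  open import Data.Nat.Properties hiding (_≟_)
  open import Data.Nat.Tactic.RingSolver using (solve-∀)
  open import Data.Bool using (true; not)
  open import Data.Fin using (Fin; zero; suc; punchIn)
  open import Data.Fin.Properties using (punchInᵢ≢i)
  open import Data.Vec using (lookup)
  open import Data.Product using (_,_; proj₁; proj₂)
  open import Data.Sum using (inj₁; inj₂)
  open import Function using (_∘_)
  open import Relation.Binary.PropositionalEquality hiding (J)
  open Counting
  open Shifting
  open Moves using (≟-true)
  open PiecewiseLinear
  open PowerMeans
  open Approximation

  -- Bernoulli's inequality `(1 - 1/(w+1))^k ≥ 1 - k/(w+1)`.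
  bernoulli-below : ∀ w k s → k + s ≡ suc w → suc w ^ k * s ≤ w ^ k * suc w
  bernoulli-below w zero s refl = ≤-refl
  bernoulli-below w (suc k) s eq = begin
    suc w * suc w ^ k * s        ≡⟨ e₁ (suc w) (suc w ^ k) s ⟩
    suc w ^ k * (s + w * s)      ≤⟨ *-monoʳ-≤ (suc w ^ k) (+-monoˡ-≤ (w * s) s≤w) ⟩
    suc w ^ k * (w + w * s)      ≡⟨ e₂ (suc w ^ k) w s ⟩
    w * (suc w ^ k * suc s)      ≤⟨ *-monoʳ-≤ w (bernoulli-below w k (suc s) (trans (+-suc k s) eq)) ⟩
    w * (w ^ k * suc w)          ≡⟨ *-assoc w (w ^ k) (suc w) ⟨
    w * w ^ k * suc w            ∎
    where
    open ≤-Reasoning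
    s≤w : s ≤ w
    s≤w = subst (s ≤_) (suc-injective eq) (m≤n+m s k)
    e₁ : ∀ N E s → N * E * s ≡ E * (N * s)
    e₁ = solve-∀
    e₂ : ∀ E w s → E * (w + w * s) ≡ w * (E * suc s)
    e₂ = solve-∀

  ^-cancelˡ-≤ : ∀ k {a b} → 0 < k → a ^ k ≤ b ^ k → a ≤ b
  ^-cancelˡ-≤ k {a} {b} 0<k h = ≮⇒≥ λ b<a → <⇒≱ (^-monoˡ-< k {{>-nonZero 0<k}} b<a) h

  module Final (m₂ : ℕ) where
    open PiecewiseLinear.PL (suc m₂)
    open Coarse m₂

    private variable
      n : ℕ

    private
      k W : ℕ
      k = suc m₂
      W = k * t

      square : suc W ≡ m * m
      square = e m₂
        where
        e : ∀ x → suc (suc x * (3 + x)) ≡ (2 + x) * (2 + x)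
        e = solve-∀

    -- Here `W = m² - 1`. Bernoulli gives `(W / (W + 1))^k ≥ s / m²` with `s = m² - m + 1`, and
    -- `t * s = m³ + 1`.
    power-base : suc W ^ k * m ≤ W ^ k * t
    power-base = *-cancelˡ-pos (m * m) z<s (begin
      m * m * (suc W ^ k * m)                    ≤⟨ m≤m+n _ (suc W ^ k) ⟩
      m * m * (suc W ^ k * m) + suc W ^ k        ≡⟨ e₁ m₂ (suc W ^ k) ⟩
      t * (suc W ^ k * s)                        ≤⟨ *-monoʳ-≤ t (bernoulli-below W k s (e₂ m₂)) ⟩
      t * (W ^ k * suc W)                        ≡⟨ cong (λ z → t * (W ^ k * z)) square ⟩
      t * (W ^ k * (m * m))                      ≡⟨ e₃ t (W ^ k) m ⟩
      m * m * (W ^ k * t)                        ∎)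
      where
      open ≤-Reasoning
      s : ℕ
      s = 3 + 3 * m₂ + m₂ * m₂
      e₁ : ∀ x E → (2 + x) * (2 + x) * (E * (2 + x)) + E ≡ (3 + x) * (E * (3 + 3 * x + x * x))
      e₁ = solve-∀
      e₂ : ∀ x → suc x + (3 + 3 * x + x * x) ≡ suc (suc x * (3 + x))
      e₂ = solve-∀
      e₃ : ∀ t E m → t * (E * (m * m)) ≡ m * m * (E * t)
      e₃ = solve-∀

    t≤4^k : t ≤ 4 ^ k
    t≤4^k = go m₂
      where
      go : ∀ x → 3 + x ≤ 4 ^ suc x
      go zero = s≤s (s≤s (s≤s z≤n))
      go (suc x) = ≤-trans (+-monoʳ-≤ 1 (go x)) (≤-trans (+-monoˡ-≤ (4 ^ suc x) (m^n>0 4 (suc x))) (+-monoʳ-≤ (4 ^ suc x) (m≤m+n (4 ^ suc x) _)))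

    -- By `power-base`, the `k`-th power of `(m² / (m² - 1))^{p/q}` is at most
    -- `(t / m)^{p/q} ≤ t ≤ 4^k`. This is the source of the factor 4.
    power-four : ∀ p q → t ^ p ≤ t ^ q * m ^ p → suc W ^ p ≤ 4 ^ q * W ^ p
    power-four p q η = ^-cancelˡ-≤ k z<s (*-cancelˡ-pos (m ^ p) (m^n>0 m p) (begin
      m ^ p * (suc W ^ p) ^ k              ≡⟨ cong (m ^ p *_) (pow-comm (suc W) p k) ⟩
      m ^ p * (suc W ^ k) ^ p              ≡⟨ trans (*-comm (m ^ p) _) (sym (^-distribʳ-* p (suc W ^ k) m)) ⟩
      (suc W ^ k * m) ^ p                  ≤⟨ ^-monoˡ-≤ p power-base ⟩
      (W ^ k * t) ^ p                      ≡⟨ ^-distribʳ-* p (W ^ k) t ⟩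
      (W ^ k) ^ p * t ^ p                  ≤⟨ *-monoʳ-≤ ((W ^ k) ^ p) η ⟩
      (W ^ k) ^ p * (t ^ q * m ^ p)        ≤⟨ *-monoʳ-≤ ((W ^ k) ^ p) (*-monoˡ-≤ (m ^ p) (^-monoˡ-≤ q t≤4^k)) ⟩
      (W ^ k) ^ p * ((4 ^ k) ^ q * m ^ p)  ≡⟨ cong₂ (λ y z → y * (z * m ^ p)) (pow-comm W k p) (pow-comm 4 k q) ⟩
      (W ^ p) ^ k * ((4 ^ q) ^ k * m ^ p)  ≡⟨ e ((W ^ p) ^ k) ((4 ^ q) ^ k) (m ^ p) ⟩
      m ^ p * ((4 ^ q) ^ k * (W ^ p) ^ k)  ≡⟨ cong (m ^ p *_) (sym (^-distribʳ-* k (4 ^ q) (W ^ p))) ⟩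
      m ^ p * (4 ^ q * W ^ p) ^ k          ∎))
      where
      open ≤-Reasoning
      pow-comm : ∀ a i j → (a ^ i) ^ j ≡ (a ^ j) ^ i
      pow-comm a i j = trans (^-*-assoc a i j) (trans (cong (a ^_) (*-comm i j)) (sym (^-*-assoc a j i)))
      e : ∀ a b c → a * (b * c) ≡ c * (b * a)
      e = solve-∀

    -- Makes the exponent `m` available, to which all smaller ones are reduced. After cancelling
    -- `t`, Bernoulli with `k = t - 2` leaves `t ≤ 2 * m`.
    power-m : t ^ m ≤ t ^ 1 * m ^ m
    power-m = subst (t ^ m ≤_) (cong (_* m ^ m) (sym (*-identityʳ t))) (*-monoʳ-≤ t {t ^ k} {m ^ m} (*-cancelˡ-pos 2 {t ^ k} {m ^ m} z<s (begin
      2 * t ^ k          ≡⟨ *-comm 2 (t ^ k) ⟩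
      t ^ k * 2          ≤⟨ bernoulli-below m k 2 (+-comm k 2) ⟩
      m ^ k * t          ≤⟨ *-monoʳ-≤ (m ^ k) (≤-trans (m≤m+n t (suc m₂)) (≤-reflexive (e₁ m₂))) ⟩
      m ^ k * (2 * m)    ≡⟨ e₂ (m ^ k) m ⟩
      2 * (m * m ^ k)    ∎)))
      where
      open ≤-Reasoning
      e₁ : ∀ x → 3 + x + suc x ≡ 2 * (2 + x)
      e₁ = solve-∀
      e₂ : ∀ E m → E * (2 * m) ≡ 2 * (m * E)
      e₂ = solve-∀

    -- From `m² x ≤ e + x` follows `W * x ≤ e`, hence `v ≤ (1 + 1/W) e`.
    absorb : ∀ p q x e v → t ^ p ≤ t ^ q * m ^ p → m * m * x ≤ v → v ≡ e + x → v ^ p ≤ 4 ^ q * e ^ p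
    absorb p q x e v η h refl = *-cancelˡ-pos (W ^ p) (m^n>0 W p) (begin
      W ^ p * (e + x) ^ p          ≡⟨ ^-distribʳ-* p W (e + x) ⟨
      (W * (e + x)) ^ p            ≤⟨ ^-monoˡ-≤ p (≤-trans (≤-reflexive (*-distribˡ-+ W e x))
                                        (≤-trans (+-monoʳ-≤ (W * e) Wx≤e) (≤-reflexive (+-comm (W * e) e)))) ⟩
      (suc W * e) ^ p              ≡⟨ ^-distribʳ-* p (suc W) e ⟩
      suc W ^ p * e ^ p            ≤⟨ *-monoˡ-≤ (e ^ p) (power-four p q η) ⟩
      4 ^ q * W ^ p * e ^ p        ≡⟨ f (4 ^ q) (W ^ p) (e ^ p) ⟩
      W ^ p * (4 ^ q * e ^ p)      ∎)
      where
      open ≤-Reasoning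
      Wx≤e : W * x ≤ e
      Wx≤e = +-cancelʳ-≤ x _ _ (subst (_≤ e + x) (trans (cong (_* x) (sym square)) (+-comm x (W * x))) h)
      f : ∀ a b c → a * b * c ≡ b * (a * c)
      f = solve-∀

    module Bound (i : Fin (suc n)) (a : Fin t) (I : VSet t (suc n)) (ind : Independent I) (near : Near i a I)
      (e : ℕ) (e+cnt : e + cnt I ≡ t ^ n) where

      private
        T x v : ℕ
        T = t ^ n
        x = off i a I
        v = cnt (not ∘ slice i a I)

      v≡e+x : v ≡ e + x
      v≡e+x = +-cancelˡ-≡ (cnt (slice i a I)) _ _ (trans (cnt-not (slice i a I)) (trans (sym e+cnt)
        (trans (cong (e +_) (cnt-dictator i a I)) (f e (cnt (slice i a I)) x))))
        where
        f : ∀ e g x → e + (g + x) ≡ g + (e + x)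
        f = solve-∀

      m²x≤v : m * m * x ≤ v
      m²x≤v = *-cancelˡ-pos m z<s (subst (_≤ m * v) (f m x) (chord₃ (off-PL i a I ind) (<⇒≤ near)))
        where
        f : ∀ m x → m * m * m * x ≡ m * (m * m * x)
        f = solve-∀

      -- The largest slice off the dictator carries at least `x / m` points and is cross-independent
      -- of the slice on it, so the power bound in `v` applies; `absorb` turns `v` into `e`.
      steep : ∀ q r → 0 < q → 0 < r → m * q ≤ q + r → t ^ (q + r) ≤ t ^ q * m ^ (q + r) →
        x ^ q * T ^ (q + r) ≤ (4 * (t * T)) ^ q * e ^ (q + r)
      steep q r 0<q 0<r mq≤p η = begin
        x ^ q * T ^ p                          ≤⟨ *-monoˡ-≤ (T ^ p) (^-monoˡ-≤ q x≤) ⟩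
        (m * cnt B) ^ q * T ^ p                ≡⟨ trans (cong (_* T ^ p) (^-distribʳ-* q m (cnt B))) (*-assoc (m ^ q) _ _) ⟩
        m ^ q * (cnt B ^ q * T ^ p)            ≤⟨ *-monoʳ-≤ (m ^ q) power ⟩
        m ^ q * (v ^ p * T ^ q)                ≤⟨ *-mono-≤ (^-monoˡ-≤ q (n≤1+n m))
                                                    (*-monoˡ-≤ (T ^ q) (absorb p q x e v η m²x≤v v≡e+x)) ⟩
        t ^ q * (4 ^ q * e ^ p * T ^ q)        ≡⟨ f (t ^ q) (4 ^ q) (e ^ p) (T ^ q) ⟩
        4 ^ q * (t ^ q * T ^ q) * e ^ p        ≡⟨ cong (_* e ^ p) (trans (cong (4 ^ q *_) (sym (^-distribʳ-* q t T)))
                                                    (sym (^-distribʳ-* q 4 (t * T)))) ⟩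
        (4 * (t * T)) ^ q * e ^ p              ∎
        where
        open ≤-Reasoning
        p : ℕ
        p = q + r
        g : Fin m → ℕ
        g b = cnt (slice i (punchIn a b) I)
        b : Fin t
        b = punchIn a (proj₁ (argmax g))
        B : VSet t n
        B = slice i b I
        x≤ : x ≤ m * cnt B
        x≤ = ≤-trans (≤-reflexive (off-slices i a I)) (sum≤ (proj₂ (argmax g)))
        module P = PowerStep m q r z<s 0<q 0<r mq≤p η
        power : cnt B ^ q * T ^ p ≤ v ^ p * T ^ q
        power = Cross.cross (suc m₂) P.PowerCount (λ {n} → P.PowerCount-mono {n}) P.PowerCount-base₀ P.PowerCount-base₁
          (λ {n} → P.PowerCount-step {n}) B (slice i a I) (cross-slices i (punchInᵢ≢i a _) ind)
        f : ∀ a b c d → a * (b * c * d) ≡ b * (a * d) * c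
        f = solve-∀

      e≤T : e ≤ T
      e≤T = subst (e ≤_) e+cnt (m≤m+n e (cnt I))

      -- `PowerStep` covers exponents from `m` upwards. A smaller one follows from the exponent `m`,
      -- since `e / T ≤ 1` makes powers decrease in the exponent.
      bound : ∀ p q → 0 < q → t ^ p ≤ t ^ q * m ^ p → x ^ q * T ^ p ≤ (4 * (t * T)) ^ q * e ^ p
      bound p q 0<q η with ≤-total (m * q) p
      ... | inj₁ mq≤p = subst (λ p → x ^ q * T ^ p ≤ (4 * (t * T)) ^ q * e ^ p) q+r≡p
          (steep q (p ∸ q) 0<q 0<r (subst (m * q ≤_) (sym q+r≡p) mq≤p)
            (subst (λ p → t ^ p ≤ t ^ q * m ^ p) (sym q+r≡p) η))
        where
        q+q≤p : q + q ≤ p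
        q+q≤p = ≤-trans (+-monoʳ-≤ q (m≤m+n q (m₂ * q))) mq≤p
        q+r≡p : q + (p ∸ q) ≡ p
        q+r≡p = m+[n∸m]≡n (≤-trans (m≤m+n q q) q+q≤p)
        0<r : 0 < p ∸ q
        0<r = ≤-trans 0<q (subst (_≤ p ∸ q) (m+n∸n≡m q q) (∸-monoˡ-≤ q q+q≤p))
      ... | inj₂ p≤mq = *-cancelˡ-pos (T ^ d) (m^n>0 T {{m^n≢0 t n}} d) (begin
        T ^ d * (x ^ q * T ^ p)                 ≡⟨ f₁ (T ^ d) (x ^ q) (T ^ p) ⟩
        x ^ q * (T ^ p * T ^ d)                 ≡⟨ cong (x ^ q *_) (trans (sym (^-distribˡ-+-* T p d)) (cong (T ^_) p+d)) ⟩
        x ^ q * T ^ (m * q)                     ≡⟨ cong (x ^ q *_) (^-*-assoc T m q) ⟨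
        x ^ q * (T ^ m) ^ q                     ≡⟨ ^-distribʳ-* q x (T ^ m) ⟨
        (x * T ^ m) ^ q                         ≤⟨ ^-monoˡ-≤ q one ⟩
        (4 * (t * T) * e ^ m) ^ q               ≡⟨ ^-distribʳ-* q (4 * (t * T)) (e ^ m) ⟩
        (4 * (t * T)) ^ q * (e ^ m) ^ q         ≡⟨ cong ((4 * (t * T)) ^ q *_) (trans (^-*-assoc e m q)
                                                     (trans (cong (e ^_) (sym p+d)) (^-distribˡ-+-* e p d))) ⟩
        (4 * (t * T)) ^ q * (e ^ p * e ^ d)     ≤⟨ *-monoʳ-≤ ((4 * (t * T)) ^ q) (*-monoʳ-≤ (e ^ p) (^-monoˡ-≤ d e≤T)) ⟩
        (4 * (t * T)) ^ q * (e ^ p * T ^ d)     ≡⟨ f₂ ((4 * (t * T)) ^ q) (e ^ p) (T ^ d) ⟩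
        T ^ d * ((4 * (t * T)) ^ q * e ^ p)     ∎)
        where
        open ≤-Reasoning
        d : ℕ
        d = m * q ∸ p
        p+d : p + d ≡ m * q
        p+d = m+[n∸m]≡n p≤mq
        one : x * T ^ m ≤ 4 * (t * T) * e ^ m
        one = subst₂ (λ y z → y * T ^ m ≤ z * e ^ m) (*-identityʳ x) (*-identityʳ (4 * (t * T)))
          (steep 1 (suc m₂) z<s z<s (≤-reflexive (*-identityʳ m)) power-m)
        f₁ : ∀ a b c → a * (b * c) ≡ b * (c * a)
        f₁ = solve-∀
        f₂ : ∀ a b c → a * (b * c) ≡ c * (a * b)
        f₂ = solve-∀

    cnt-dictator-all : ∀ (i : Fin (suc n)) (a : Fin t) → cnt (dictator i a) ≡ t ^ n
    cnt-dictator-all {n} i a = trans (cnt-∩-dictator i a (λ _ → true)) (cnt-all {t} {n})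

    independent-≤ : (K : VSet t (suc n)) → Independent K → cnt K ≤ t ^ n
    independent-≤ K ind = *-cancelˡ-pos t z<s (smaller-≤ K K ind ≤-refl)

    dictator-max : ∀ (i : Fin (suc n)) (a : Fin t) → MaxIndependent (dictator i a)
    dictator-max i a = (λ x y xa ya adj → adj i (trans (≟-true {a = lookup x i} xa) (sym (≟-true {a = lookup y i} ya))))
      , λ K ind → subst₂ _≤_ (sym (card≡cnt K)) (sym (trans (card≡cnt (dictator i a)) (cnt-dictator-all i a))) (independent-≤ K ind)

-- Rationals as unreduced fractions of naturals.

module Fractions where
  open import Data.Nat as ℕ using (ℕ; zero; suc; NonZero)
  import Data.Nat.Properties as ℕ
  open import Data.Integer as ℤ using (+_; -_; 1ℤ)
  import Data.Integer.Properties as ℤ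
  open import Data.Integer.Tactic.RingSolver using (solve-∀)
  open import Data.Rational as ℚ using (ℚ; _/_; _*_; _-_; 1ℚ; toℚᵘ; _≤_; _<_; _+_)
  import Data.Rational.Properties as ℚ
  open import Data.Rational.Unnormalised as ℚᵘ using (mkℚᵘ; _≃_; *≡*; *≤*; *<*)
  import Data.Rational.Unnormalised.Properties as ℚᵘ
  open import Relation.Binary.PropositionalEquality

  -- r = a / (1 + b)
  IsFraction : ℚ → ℕ → ℕ → Set
  IsFraction r a b = toℚᵘ r ≃ mkℚᵘ (+ a) b

  fraction-/ : ∀ z b .{{_ : NonZero b}} → toℚᵘ (z / b) ≃ (z ℚᵘ./ b)
  fraction-/ z (suc b) = ℚ.toℚᵘ-fromℚᵘ (mkℚᵘ z b)

  fraction-≤ : ∀ {r s a b c d} → IsFraction r a b → IsFraction s c d → a ℕ.* suc d ℕ.≤ c ℕ.* suc b → r ≤ s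
  fraction-≤ {a = a} {b} {c} {d} hr hs h = ℚ.toℚᵘ-cancel-≤ (begin
    _ ≃⟨ hr ⟩
    mkℚᵘ (+ a) b ≤⟨ *≤* (subst₂ ℤ._≤_ (ℤ.pos-* a (suc d)) (ℤ.pos-* c (suc b)) (ℤ.+≤+ h)) ⟩
    mkℚᵘ (+ c) d ≃⟨ hs ⟨
    _ ∎)
    where open ℚᵘ.≤-Reasoning

  fraction-< : ∀ {r s a b c d} → IsFraction r a b → IsFraction s c d → r < s → a ℕ.* suc d ℕ.< c ℕ.* suc b
  fraction-< {a = a} {b} {c} {d} hr hs h with ℚᵘ.<-respʳ-≃ hs (ℚᵘ.<-respˡ-≃ hr (ℚ.toℚᵘ-mono-< h))
  ... | *<* lt = ℤ.drop‿+<+ (subst₂ ℤ._<_ (sym (ℤ.pos-* a (suc d))) (sym (ℤ.pos-* c (suc b))) lt)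

  fraction-* : ∀ {r s a b c d} → IsFraction r a b → IsFraction s c d → IsFraction (r * s) (a ℕ.* c) (d ℕ.+ b ℕ.* suc d)
  fraction-* {r} {s} {a} {b} {c} {d} hr hs = ℚᵘ.≃-trans (ℚ.toℚᵘ-homo-* r s)
    (ℚᵘ.≃-trans (ℚᵘ.*-cong hr hs) (*≡* (cong (ℤ._* + (suc b ℕ.* suc d)) (sym (ℤ.pos-* a c)))))

  -- A power is not literally a successor, so its predecessor `b′` is specified by an equation.
  fraction-^ : ∀ {r a b} k B → B ≡ suc b → IsFraction r a b → ∀ {b′} → suc b′ ≡ B ℕ.^ k → IsFraction (r ^ℚ k) (a ℕ.^ k) b′
  fraction-^ zero B eq h refl = ℚᵘ.≃-refl
  fraction-^ {r} {a} {b} (suc k) B refl h {b′} e = go (ℕ.m^n>0 B k)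
    where
    go : 0 ℕ.< B ℕ.^ k → IsFraction (r ^ℚ suc k) (a ℕ.^ suc k) b′
    go pos with B ℕ.^ k in eq
    go () | zero
    ... | suc b″ = subst (IsFraction (r ^ℚ suc k) (a ℕ.^ suc k)) (ℕ.suc-injective (sym e))
      (fraction-* {r} {r ^ℚ k} {a} {b} {a ℕ.^ k} {b″} h (fraction-^ k B refl h (sym eq)))

  fraction-1- : ∀ r {s} → toℚᵘ r ≃ s → toℚᵘ (1ℚ - r) ≃ ℚᵘ.1ℚᵘ ℚᵘ.- s
  fraction-1- r h = ℚᵘ.≃-trans (ℚ.toℚᵘ-homo-+ 1ℚ (ℚ.- r))
    (ℚᵘ.+-congʳ ℚᵘ.1ℚᵘ (ℚᵘ.≃-trans (ℚ.toℚᵘ-homo‿- r) (ℚᵘ.-‿cong h)))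

  fraction-ε : ∀ t T c e .{{_ : NonZero (t ℕ.* T)}} → ∀ {b} → suc b ≡ T → 0 ℕ.< t → e ℕ.+ c ≡ T →
    IsFraction (1ℚ - (+ t / 1) * (+ c / (t ℕ.* T))) e b
  fraction-ε t@(suc _) T@(suc b) c e refl _ e+c = ℚᵘ.≃-trans
      (fraction-1- ((+ t / 1) * (+ c / (t ℕ.* T))) (ℚᵘ.≃-trans (ℚ.toℚᵘ-homo-* (+ t / 1) (+ c / (t ℕ.* T)))
        (ℚᵘ.*-cong (fraction-/ (+ t) 1) (fraction-/ (+ c) (t ℕ.* T)))))
      (*≡* eq)
    where
    s : ∀ t T c e N N′ → N ≡ t ℤ.* T → N′ ≡ t ℤ.* T → T ≡ e ℤ.+ c →
      (1ℤ ℤ.* N ℤ.+ - (t ℤ.* c) ℤ.* 1ℤ) ℤ.* T ≡ e ℤ.* N′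
    s t T c e N N′ refl refl refl = f t c e
      where
      f : ∀ t c e → (1ℤ ℤ.* (t ℤ.* (e ℤ.+ c)) ℤ.+ - (t ℤ.* c) ℤ.* 1ℤ) ℤ.* (e ℤ.+ c) ≡ e ℤ.* (t ℤ.* (e ℤ.+ c))
      f = solve-∀
    eq : (1ℤ ℤ.* + (1 ℕ.* (t ℕ.* T)) ℤ.+ - (+ t ℤ.* + c) ℤ.* 1ℤ) ℤ.* + T ≡ + e ℤ.* + (1 ℕ.* (1 ℕ.* (t ℕ.* T)))
    eq = s (+ t) (+ T) (+ c) (+ e) _ _ (trans (cong +_ (ℕ.*-identityˡ _)) (ℤ.pos-* t T))
      (trans (cong +_ (trans (ℕ.*-identityˡ _) (ℕ.*-identityˡ _))) (ℤ.pos-* t T)) (cong +_ (sym e+c))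

  -- `1 - 3/t + 2/t²` factors as `(t - 1)(t - 2) / t²`, with `t = m + 2`.
  fraction-threshold : ∀ m .{{_ : NonZero (suc (suc m))}} →
    IsFraction (1ℚ - (+ 3 / suc (suc m)) + (+ 2 / suc (suc m)) * (+ 1 / suc (suc m))) (suc m ℕ.* m) (suc m ℕ.+ suc m ℕ.* suc (suc m))
  fraction-threshold m = ℚᵘ.≃-trans
      (ℚᵘ.≃-trans (ℚ.toℚᵘ-homo-+ (1ℚ - (+ 3 / t)) ((+ 2 / t) * (+ 1 / t)))
        (ℚᵘ.+-cong (fraction-1- (+ 3 / t) (fraction-/ (+ 3) t))
          (ℚᵘ.≃-trans (ℚ.toℚᵘ-homo-* (+ 2 / t) (+ 1 / t)) (ℚᵘ.*-cong (fraction-/ (+ 2) t) (fraction-/ (+ 1) t)))))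
      (*≡* eq)
    where
    t : ℕ
    t = suc (suc m)
    s : ∀ m t tt t₁ ttt x → t ≡ + 2 ℤ.+ m → tt ≡ t ℤ.* t → t₁ ≡ t → ttt ≡ t ℤ.* (t ℤ.* t) → x ≡ (1ℤ ℤ.+ m) ℤ.* m →
      ((1ℤ ℤ.* t ℤ.+ - + 3 ℤ.* 1ℤ) ℤ.* tt ℤ.+ + 2 ℤ.* 1ℤ ℤ.* t₁) ℤ.* tt ≡ x ℤ.* ttt
    s m t tt t₁ ttt x refl refl refl refl refl = f m
      where
      f : ∀ m → let t = + 2 ℤ.+ m in
        ((1ℤ ℤ.* t ℤ.+ - + 3 ℤ.* 1ℤ) ℤ.* (t ℤ.* t) ℤ.+ + 2 ℤ.* 1ℤ ℤ.* t) ℤ.* (t ℤ.* t) ≡ (1ℤ ℤ.+ m) ℤ.* m ℤ.* (t ℤ.* (t ℤ.* t))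
      f = solve-∀
    eq : ((1ℤ ℤ.* + t ℤ.+ - + 3 ℤ.* 1ℤ) ℤ.* + (t ℕ.* t) ℤ.+ + 2 ℤ.* 1ℤ ℤ.* + (1 ℕ.* t)) ℤ.* + (t ℕ.* t)
      ≡ + (suc m ℕ.* m) ℤ.* + ((1 ℕ.* t) ℕ.* (t ℕ.* t))
    eq = s (+ m) (+ t) (+ (t ℕ.* t)) (+ (1 ℕ.* t)) _ _ refl (ℤ.pos-* t t) (cong +_ (ℕ.*-identityˡ t))
      (trans (cong (λ z → + (z ℕ.* (t ℕ.* t))) (ℕ.*-identityˡ t)) (trans (ℤ.pos-* t (t ℕ.* t)) (cong (+ t ℤ.*_) (ℤ.pos-* t t))))
      (ℤ.pos-* (suc m) m)

  fraction-/′ : ∀ a b .{{_ : NonZero b}} → ∀ {b′} → suc b′ ≡ b → IsFraction (+ a / b) a b′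
  fraction-/′ a (suc b) refl = fraction-/ (+ a) (suc b)

-- Translating `ε`, `μ` and the threshold into counts.

module Assembly where
  open import Data.Nat using (ℕ; NonZero)
  open import Data.Integer using (+_)
  open import Data.Rational using (_/_; _<_; _+_; _-_; _*_; 1ℚ)
  open import Data.Nat as ℕ using (suc; z<s; _^_; _∸_; pred)
  import Data.Nat.Properties as ℕ
  open import Data.Nat.Tactic.RingSolver using (solve-∀)
  open import Relation.Binary.PropositionalEquality hiding (J)
  open Counting
  open Shifting
  open Fractions

  module _ (m₂ n : ℕ) where
    open PiecewiseLinear.PL (suc m₂) using (m; t)
    open Approximation.Coarse m₂ using (Large; Near; near-dictator)
    open Exponent.Final m₂

    private
      T b : ℕ
      T = t ^ n
      b = pred T

      suc-b : suc b ≡ T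
      suc-b = ℕ.suc-pred T {{ℕ.m^n≢0 t n}}

    module _ (I : VSet t (suc n)) (ind : Independent I) where
      deficit : ℕ
      deficit = T ∸ cnt I

      deficit+cnt : deficit ℕ.+ cnt I ≡ T
      deficit+cnt = ℕ.m∸n+n≡m (independent-≤ I ind)

      ε-fraction : IsFraction (ε t (suc n) I) deficit b
      ε-fraction = fraction-ε t T (card I) deficit {{ℕ.m^n≢0 t (suc n)}} suc-b z<s
        (trans (cong (deficit ℕ.+_) (card≡cnt I)) deficit+cnt)

      -- Complementing the deficit turns the threshold into
      -- `t² - (t - 1)(t - 2) = 3 t - 2 = 1 + 3 m`.
      large : ε t (suc n) I < 1ℚ - (+ 3 / t) + (+ 2 / t) * (+ 1 / t) → Large I
      large small = ℕ.+-cancelʳ-< (deficit ℕ.* (t ℕ.* t)) _ _ (begin-strict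
        (1 ℕ.+ 3 ℕ.* m) ℕ.* T ℕ.+ deficit ℕ.* (t ℕ.* t)    <⟨ ℕ.+-monoʳ-< ((1 ℕ.+ 3 ℕ.* m) ℕ.* T) lt ⟩
        (1 ℕ.+ 3 ℕ.* m) ℕ.* T ℕ.+ m ℕ.* suc m₂ ℕ.* suc b  ≡⟨ cong (λ z → (1 ℕ.+ 3 ℕ.* m) ℕ.* T ℕ.+ m ℕ.* suc m₂ ℕ.* z) suc-b ⟩
        (1 ℕ.+ 3 ℕ.* m) ℕ.* T ℕ.+ m ℕ.* suc m₂ ℕ.* T      ≡⟨ e₁ m₂ T ⟩
        t ℕ.* t ℕ.* T                                      ≡⟨ cong (t ℕ.* t ℕ.*_) deficit+cnt ⟨
        t ℕ.* t ℕ.* (deficit ℕ.+ cnt I)                    ≡⟨ e₂ t deficit (cnt I) ⟩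
        t ℕ.* t ℕ.* cnt I ℕ.+ deficit ℕ.* (t ℕ.* t)        ∎)
        where
        open ℕ.≤-Reasoning
        lt : deficit ℕ.* (t ℕ.* t) ℕ.< m ℕ.* suc m₂ ℕ.* suc b
        lt = fraction-< ε-fraction (fraction-threshold (suc m₂)) small
        e₁ : ∀ x T → (1 ℕ.+ 3 ℕ.* (2 ℕ.+ x)) ℕ.* T ℕ.+ (2 ℕ.+ x) ℕ.* suc x ℕ.* T ≡ (3 ℕ.+ x) ℕ.* (3 ℕ.+ x) ℕ.* T
        e₁ = solve-∀
        e₂ : ∀ t e h → t ℕ.* t ℕ.* (e ℕ.+ h) ≡ t ℕ.* t ℕ.* h ℕ.+ e ℕ.* (t ℕ.* t)
        e₂ = solve-∀

      bounded : ∀ i a → Near i a I → BoundedByFourEpsPowEta t (μ t (suc n) (I ∖ dictator i a)) (ε t (suc n) I)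
      bounded i a near p q η = fraction-≤
          (fraction-^ q B B≡ quarter suc-pred-B) (fraction-^ p T (sym suc-b) ε-fraction suc-pred-T) (begin
        (x ℕ.* 1) ^ q ℕ.* suc (pred (T ^ p))           ≡⟨ cong₂ (λ y z → y ^ q ℕ.* z) x≡ suc-pred-T ⟩
        off i a I ^ q ℕ.* T ^ p                        ≤⟨ Bound.bound i a I ind near deficit deficit+cnt p q
                                                            (ℕ.>-nonZero⁻¹ q) (ℕ.<⇒≤ η) ⟩
        (4 ℕ.* (t ℕ.* T)) ^ q ℕ.* deficit ^ p          ≡⟨ ℕ.*-comm ((4 ℕ.* (t ℕ.* T)) ^ q) (deficit ^ p) ⟩
        deficit ^ p ℕ.* (4 ℕ.* (t ℕ.* T)) ^ q          ≡⟨ cong (λ z → deficit ^ p ℕ.* z ^ q) (ℕ.*-comm 4 (t ℕ.* T)) ⟩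
        deficit ^ p ℕ.* B ^ q                          ≡⟨ cong (deficit ^ p ℕ.*_) suc-pred-B ⟨
        deficit ^ p ℕ.* suc (pred (B ^ q))             ∎)
        where
        open ℕ.≤-Reasoning
        B : ℕ
        B = t ℕ.* T ℕ.* 4
        suc-pred-B : suc (pred (B ^ q)) ≡ B ^ q
        suc-pred-B = ℕ.suc-pred (B ^ q) {{ℕ.m^n≢0 B q {{nz}}}}
          where
          nz : NonZero B
          nz = ℕ.m*n≢0 (t ℕ.* T) 4 {{ℕ.m^n≢0 t (suc n)}}
        suc-pred-T : suc (pred (T ^ p)) ≡ T ^ p
        suc-pred-T = ℕ.suc-pred (T ^ p) {{ℕ.m^n≢0 T p {{ℕ.m^n≢0 t n}}}}
        x : ℕ
        x = card (I ∖ dictator i a)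
        x≡ : x ℕ.* 1 ≡ off i a I
        x≡ = trans (ℕ.*-identityʳ x) (card≡cnt (I ∖ dictator i a))
        tT : suc (pred (t ℕ.* T)) ≡ t ℕ.* T
        tT = ℕ.suc-pred (t ℕ.* T) {{ℕ.m^n≢0 t (suc n)}}
        B≡ : B ≡ suc (3 ℕ.+ pred (t ℕ.* T) ℕ.* 4)
        B≡ = cong (ℕ._* 4) (sym tT)
        quarter : IsFraction (μ t (suc n) (I ∖ dictator i a) * (+ 1 / 4)) (x ℕ.* 1) (3 ℕ.+ pred (t ℕ.* T) ℕ.* 4)
        quarter = fraction-* {μ t (suc n) (I ∖ dictator i a)} {+ 1 / 4}
          (fraction-/′ x (t ℕ.* T) {{ℕ.m^n≢0 t (suc n)}} tT) (fraction-/′ 1 4 refl)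

open import Data.Nat using (ℕ; _≤_; NonZero)
open import Data.Product using (Σ; _×_)
open import Data.Integer using (+_)
open import Data.Rational using (ℚ; _/_; _<_; _+_; _-_; _*_; 1ℚ)
open import Data.Nat using (suc; s≤s; z≤n)
open import Data.Product using (_,_)
open Shifting using (dictator)
open Approximation using (module Coarse)
open Exponent using (module Final)
open Assembly using (large; bounded)

theorem1p5 : (t n : ℕ) → .{{_ : NonZero t}} → 3 ≤ t → 1 ≤ n →
    (I : VSet t n) → Independent I →
    ε t n I < 1ℚ - (+ 3 / t) + (+ 2 / t) * (+ 1 / t) →
    Σ (VSet t n) (λ J → MaxIndependent J ×
    BoundedByFourEpsPowEta t (μ t n (I ∖ J)) (ε t n I))
theorem1p5 (suc (suc (suc m₂))) (suc n) (s≤s (s≤s (s≤s z≤n))) (s≤s z≤n) I ind small =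
  let (i , a , near) = Coarse.near-dictator m₂ I ind (large m₂ n I ind small)
  in dictator i a , Final.dictator-max m₂ i a , bounded m₂ n I ind i a near
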